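{- Let $p \geq 5$ be a prime and define $$w_2(p):= a_2\left( \frac{3(p^2-1)}{8}\right) + p^2 \left( \frac{ -6}{p}\right)_{L} \left( \frac{ -3(p^2-1)/8}{p}\right)_{L}.$$ (i) If $w_2(p) \equiv 0 \pmod2$, then for all integers $n,k \geq 0$ with $p \nmid n$, $B_{8,3} \left( p^{4k+3}n+ \frac{3 ( p^{4k+4}-1)}{8} \right) \equiv 0 \pmod2$. (ii) If $w_2(p) \not \equiv 0 \pmod2$, then for all integers $n,k \geq 0$ with $p \nmid n$, $B_{8,3} \left( p^{6k+5}n+ \frac{3 ( p^{6k+6}-1)}{8} \right) \equiv 0 \pmod2$. (iii) If $w_2(p) \not \equiv 0 \pmod2$, then for all integers $n,k \geq 0$ with $w_2(p)\equiv p^2 \left( \frac{ -6n-2+ \frac{p^2-1}{4}}{p}\right)_{L}\pmod2$, $B_{8,3} \left( p^{6k+2}n+ \frac{3 ( p^{6k+2}-1)}{8} \right) \equiv 0 \pmod2$.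
   Context: $a_2(n)$ is defined by $\sum_{n\ge0}a_2(n)q^n=(q;q)_\infty^6(q^3;q^3)_\infty$, where $(q^t;q^t)_\infty=\prod_{k\ge1}(1-q^{tk})$. $\left(\frac{a}{p}\right)_L$ is the Legendre symbol ($0$ if $p\mid a$). For integers $u,v\ge 2$, $B_{u,v}(n)$ is the number of bipartitions $(\alpha,\beta)$ of $n$ with $\alpha$ having no part divisible by $u$ and $\beta$ having no part divisible by $v$; $\sum_{n\ge0}B_{u,v}(n)q^n=\frac{(q^u;q^u)_\infty(q^v;q^v)_\infty}{(q;q)_\infty^2}$. -}

module Defs where

open import Data.Nat as ℕ using (ℕ; zero; suc; _+_; _*_; _∸_; _^_; _≤?_; _≟_)
open import Data.Nat.DivMod using (_/_)
open import Data.Nat.Divisibility using (_∣?_)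
open import Data.Integer as ℤ using (ℤ; +_; -_)
open import Data.Integer.DivMod using (_%ℕ_)
open import Data.List using (List; []; _∷_; [_]; map; concatMap; filter; length; upTo; replicate; _++_; cartesianProduct)
open import Data.List.Relation.Unary.All using (All)
open import Data.List.Relation.Unary.All as All using ()
open import Data.List.Relation.Unary.Any as Any using (Any)
open import Data.Product using (_×_; _,_; proj₁; proj₂)
open import Relation.Nullary using (¬?; does; yes; no)
open import Relation.Nullary.Decidable using (_×-dec_)
open import Relation.Binary.PropositionalEquality using (_≡_)
open import Data.Bool using (if_then_else_)

Series : Set
Series = ℕ → ℤ

mulOneMinus : ℕ → Series → Series
mulOneMinus m f n with m ≤? n
... | yes _ = f n ℤ.- f (n ∸ m)
... | no  _ = f n

one : Series
one zero    = + 1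
one (suc _) = + 0

mulEtaTrunc : ℕ → ℕ → Series → Series
mulEtaTrunc t zero    f = f
mulEtaTrunc t (suc N) f = mulOneMinus (t * suc N) (mulEtaTrunc t N f)

-- f · (q^t;q^t)_∞^e truncated at the first N factors (exact on coefficients ≤ N)
mulEtaPow : ℕ → ℕ → ℕ → Series → Series
mulEtaPow t e N f = go e
  where
  go : ℕ → Series
  go zero    = f
  go (suc e) = mulEtaTrunc t N (go e)

-- Σ a₂(n) qⁿ = (q;q)_∞^6 (q^3;q^3)_∞.  Factors (1 - q^{tk}) with k > n
-- do not affect the coefficient of qⁿ, so truncating at N = n is exact.
a₂ : ℕ → ℤ
a₂ n = mulEtaPow 1 6 n (mulEtaPow 3 1 n one) n

legendre : ℤ → (p : ℕ) → .{{_ : ℕ.NonZero p}} → ℤ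
legendre a p with a %ℕ p ≟ 0
... | yes _ = + 0
... | no _ with Any.any? (λ x → ((x * x) ℕ.% p) ≟ (a %ℕ p)) (upTo p)
...   | yes _ = + 1
...   | no  _ = - (+ 1)

-- Partitions: non-increasing lists of positive parts.

-- partitions of n with all parts ≤ m (each listed once, non-increasing)
partsBounded : ℕ → ℕ → List (List ℕ)
partsBounded zero    zero    = [ [] ]
partsBounded zero    (suc _) = []
partsBounded (suc m) n =
  concatMap (λ j → map (replicate j (suc m) ++_) (partsBounded m (n ∸ j * suc m)))
            (filter (λ j → j * suc m ≤? n) (upTo (suc n)))

partitions : ℕ → List (List ℕ)
partitions n = partsBounded n n

NoPartDivBy : ℕ → List ℕ → Set
NoPartDivBy u α = All (λ x → ¬ (u Data.Nat.Divisibility.∣ x)) α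
  where open import Relation.Nullary using (¬_)
        import Data.Nat.Divisibility

noPartDivBy? : (u : ℕ) → (α : List ℕ) → Relation.Nullary.Dec (NoPartDivBy u α)
noPartDivBy? u α = All.all? (λ x → ¬? (u ∣? x)) α

bipartitions : ℕ → List (List ℕ × List ℕ)
bipartitions n = concatMap (λ i → cartesianProduct (partitions i) (partitions (n ∸ i))) (upTo (suc n))

B : ℕ → ℕ → ℕ → ℕ
B u v n = length (filter (λ ab → noPartDivBy? u (proj₁ ab) ×-dec noPartDivBy? v (proj₂ ab)) (bipartitions n))

w₂ : (p : ℕ) → .{{_ : ℕ.NonZero p}} → ℤ
w₂ p = a₂ (3 * (p ^ 2 ∸ 1) / 8)
       ℤ.+ (+ (p ^ 2)) ℤ.* legendre (- (+ 6)) p ℤ.* legendre (- (+ (3 * (p ^ 2 ∸ 1) / 8))) p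

{-# OPTIONS --safe #-}
module Submission where

-- Modulo 2 we have B_{8,3}(m) ≡ a₂(m) ≡ r(8m + 3), where r(N) is the number of (x , y) ∈ ℕ² with
-- 2x² + y² = N and 3 ∤ y: indeed (q;q)⁶(q³;q³) ≡ (q²;q²)³(q³;q³), and mod 2 the cube is
-- Σ q^{j(j+1)} (Jacobi) and the last factor is Euler's pentagonal series.
--
-- Writing the representations as elements y + x√-2 of ℤ[√-2], r(3p²) is odd, because conjugating the
-- cofactor of 1 + √-2 is an involution with the single fixed point (p , p). Hence w₂(p) is always even
-- and parts (ii) and (iii) are vacuous.
--
-- For (i), 8m + 3 = p^{4k+3}N′ with p ∤ N′. Representations with p ∤ x correspond bijectively for M and
-- p²M whenever p ∣ M: if there are any then p = a² + 2b² by Thue's lemma, and multiplication by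
-- (a + b√-2)² is the bijection. The representations of p²M with p ∣ x are those of M multiplied by p. So
-- r(p^{2j+1}N′) = (j + 1) r(pN′), which is even for j = 2k + 1.

open import Defs
open import Data.Nat as ℕ using (ℕ; zero; suc; _+_; _*_; _∸_; _^_; _≤_; _<_; _≥_; z≤n; s≤s; _≤?_; _≟_; parity; NonZero)
import Data.Nat.Properties as ℕₚ
open import Data.Nat.DivMod using (_/_; _%_; m≡m%n+[m/n]*n; m%n<n; m*n/n≡m; m/n≤m)
import Data.Nat.Divisibility as N
open N using (_∣?_)
open import Data.Nat.Primality using (Prime; euclidsLemma; prime⇒nonZero; prime⇒nonTrivial; prime⇒irreducible; prime?; prime[2])
open import Data.Nat.Tactic.RingSolver using (solve-∀)
open import Data.Integer as ℤ using (ℤ; +_; -_; -[1+_]; ∣_∣)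
open import Data.Integer.DivMod using (_%ℕ_; _/ℕ_; a≡a%ℕn+[a/ℕn]*n)
import Data.Integer.Properties as ℤₚ
import Data.Integer.Divisibility as Z
import Data.Integer.Divisibility.Signed as S
import Data.Integer.Tactic.RingSolver as ℤSolver
open import Data.Parity.Base as ℙ using (Parity; 0ℙ; 1ℙ)
import Data.Parity.Properties as ℙₚ
open import Data.Fin using (Fin; toℕ; fromℕ<; remQuot; combine)
import Data.Fin.Properties as Finₚ
open import Data.Empty using (⊥; ⊥-elim)
open import Data.Maybe using (just; nothing)
open import Data.Product using (∃; _×_; _,_; proj₁; proj₂)
open import Data.Sum using (_⊎_; inj₁; inj₂; [_,_]′)
open import Data.List using (List; []; _∷_; _++_; map; concatMap; filter; length; upTo; applyUpTo; replicate; cartesianProduct)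
import Data.List.Properties as Listₚ
open import Data.List.Membership.Propositional using (_∈_)
open import Data.List.Membership.Propositional.Properties
open import Data.List.Relation.Binary.Permutation.Propositional using (_↭_; ↭-sym; ↭⇒↭ₛ)
import Data.List.Relation.Binary.Permutation.Propositional.Properties as ↭ₚ
import Data.List.Relation.Binary.Permutation.Setoid.Properties as Permutationₛ
open import Data.List.Relation.Unary.All as All using (All)
import Data.List.Relation.Unary.All.Properties as Allₚ
import Data.List.Relation.Unary.AllPairs as AllPairs
open import Data.List.Relation.Unary.Any as Any using (here; there)
open import Data.List.Relation.Unary.Unique.Propositional using (Unique)
import Data.List.Relation.Unary.Unique.Propositional.Properties as Uniqueₚ
open import Algebra.Bundles using (CommutativeSemiring; CommutativeRing)
open import Algebra.Properties.CommutativeSemigroup ℙₚ.+-commutativeSemigroup using () renaming (interchange to ℙ-interchange)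
import Algebra.Solver.Ring
open import Algebra.Solver.Ring.AlmostCommutativeRing using (fromCommutativeSemiring; _-Raw-AlmostCommutative⟶_; Induced-equivalence)
open import Algebra.Structures.Biased using (isCommutativeSemiringˡ)
open import Function using (_∘_; id)
open import Level using (0ℓ)
open import Relation.Binary.Definitions using (WeaklyDecidable; tri<; tri≈; tri>)
import Relation.Binary.Reasoning.Setoid
open import Relation.Binary.Structures using (IsEquivalence)
open import Relation.Nullary using (¬_; yes; no; Dec; ¬?)
open import Relation.Nullary.Decidable using (_×-dec_; toWitness)
open import Relation.Unary using (Pred; Decidable)
open import Relation.Binary.PropositionalEquality as ≡ using (_≡_; _≢_; refl; sym; trans; cong; cong₂; subst; _≗_; module ≡-Reasoning)

-- The number `8m + 3` comes from completing squares: `8j(j+1) + 2 = 2(2j+1)²`, and a pentagonal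
-- exponent e satisfies `24e + 1 = (6r ± 1)²`. Modulo 8 every solution of `2x² + y² = 8m + 3` has x
-- and y odd, so of the conditions on x and y only 3 ∤ y has to be kept.
--
-- A representation is a pair of natural numbers, so it fixes an element of ℤ[√-2] only up to sign
-- and conjugation. If a prime norm ℓ of π divides the norm of u and ℓ ∤ x, then exactly one of u
-- and its conjugate is a multiple of π, which selects a lift up to sign. The bijection and the
-- involution are therefore relations between pairs, witnessed by such lifts.
--
-- The multiplier is π² instead of π because π² = A + 2ab√-2 with 3 | ab and 3 ∤ A, which preserves
-- the condition 3 ∤ y.
--
-- The parity of `w₂ p` comes down to that of its first term: p² is odd and both Legendre symbols
-- are ±1, the second because i = 3(p²-1)/8 satisfies `8i + 3 = 3p²`, so that p | i would give p |
-- 3. The same equation turns the first term into r(3p²).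

-- Power series over 𝔽₂

-- Series over 𝔽₂, with Parity playing the role of 𝔽₂.
Series₂ : Set
Series₂ = ℕ → Parity

infixl 6 _⊕_
_⊕_ : Series₂ → Series₂ → Series₂
(f ⊕ g) n = f n ℙ.+ g n

shift : ℕ → Series₂ → Series₂
shift zero    f n       = f n
shift (suc d) f zero    = 0ℙ
shift (suc d) f (suc n) = shift d f n

one₂ : Series₂
one₂ zero    = 1ℙ
one₂ (suc _) = 0ℙ

-- Polynomials in q over 𝔽₂ as syntax: all that matters is how they act on series.
infixl 6 _⊞_
infixl 7 _⊠_
data Poly : Set where
  O       : Poly
  q^_     : ℕ → Poly
  _⊞_ _⊠_ : Poly → Poly → Poly

⟦_⟧ : Poly → Series₂ → Series₂
⟦ O ⟧ f _     = 0ℙ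
⟦ q^ d ⟧ f    = shift d f
⟦ a ⊞ b ⟧ f   = ⟦ a ⟧ f ⊕ ⟦ b ⟧ f
⟦ a ⊠ b ⟧ f   = ⟦ a ⟧ (⟦ b ⟧ f)

_≗[_]_ : Series₂ → ℕ → Series₂ → Set
f ≗[ m ] g = ∀ n → n ≤ m → f n ≡ g n

shift-local : ∀ d {f g} m → f ≗[ m ] g → shift d f ≗[ m ] shift d g
shift-local zero    m e n n≤m = e n n≤m
shift-local (suc d) m e zero n≤m = refl
shift-local (suc d) (suc m) e (suc n) (s≤s n≤m) =
  shift-local d m (λ i i≤m → e i (ℕₚ.m≤n⇒m≤1+n i≤m)) n n≤m

shift-⊕ : ∀ d f g → shift d (f ⊕ g) ≗ shift d f ⊕ shift d g
shift-⊕ zero    f g n       = refl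
shift-⊕ (suc d) f g zero    = refl
shift-⊕ (suc d) f g (suc n) = shift-⊕ d f g n

shift-0 : ∀ d {f} → (∀ n → f n ≡ 0ℙ) → ∀ n → shift d f n ≡ 0ℙ
shift-0 zero    e n       = e n
shift-0 (suc d) e zero    = refl
shift-0 (suc d) e (suc n) = shift-0 d e n

shift-+ : ∀ d e f → shift (d + e) f ≗ shift d (shift e f)
shift-+ zero    e f n       = refl
shift-+ (suc d) e f zero    = refl
shift-+ (suc d) e f (suc n) = shift-+ d e f n

shift-< : ∀ d f n → n < d → shift d f n ≡ 0ℙ
shift-< (suc d) f zero    _         = refl
shift-< (suc d) f (suc n) (s≤s n<d) = shift-< d f n n<d

shift-≥ : ∀ d f n → d ≤ n → shift d f n ≡ f (n ∸ d)
shift-≥ zero    f n       _         = refl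
shift-≥ (suc d) f (suc n) (s≤s d≤n) = shift-≥ d f n d≤n

⟦⟧-local : ∀ a {f g} m → f ≗[ m ] g → ⟦ a ⟧ f ≗[ m ] ⟦ a ⟧ g
⟦⟧-local O       m e n n≤m = refl
⟦⟧-local (q^ d)  m e = shift-local d m e
⟦⟧-local (a ⊞ b) m e n n≤m = cong₂ ℙ._+_ (⟦⟧-local a m e n n≤m) (⟦⟧-local b m e n n≤m)
⟦⟧-local (a ⊠ b) m e = ⟦⟧-local a m (⟦⟧-local b m e)

⟦⟧-cong : ∀ a {f g} → f ≗ g → ⟦ a ⟧ f ≗ ⟦ a ⟧ g
⟦⟧-cong a e n = ⟦⟧-local a n (λ i _ → e i) n ℕₚ.≤-refl

⟦⟧-⊕ : ∀ a f g → ⟦ a ⟧ (f ⊕ g) ≗ ⟦ a ⟧ f ⊕ ⟦ a ⟧ g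
⟦⟧-⊕ O       f g n = refl
⟦⟧-⊕ (q^ d)  f g   = shift-⊕ d f g
⟦⟧-⊕ (a ⊞ b) f g n = trans (cong₂ ℙ._+_ (⟦⟧-⊕ a f g n) (⟦⟧-⊕ b f g n))
  (ℙ-interchange (⟦ a ⟧ f n) (⟦ a ⟧ g n) (⟦ b ⟧ f n) (⟦ b ⟧ g n))
⟦⟧-⊕ (a ⊠ b) f g n = trans (⟦⟧-cong a (⟦⟧-⊕ b f g) n) (⟦⟧-⊕ a (⟦ b ⟧ f) (⟦ b ⟧ g) n)

⟦⟧-0 : ∀ a {f} → (∀ n → f n ≡ 0ℙ) → ∀ n → ⟦ a ⟧ f n ≡ 0ℙ
⟦⟧-0 O       e n = refl
⟦⟧-0 (q^ d)  e = shift-0 d e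
⟦⟧-0 (a ⊞ b) e n = cong₂ ℙ._+_ (⟦⟧-0 a e n) (⟦⟧-0 b e n)
⟦⟧-0 (a ⊠ b) e = ⟦⟧-0 a (⟦⟧-0 b e)

⟦⟧-shift : ∀ a d f → ⟦ a ⟧ (shift d f) ≗ shift d (⟦ a ⟧ f)
⟦⟧-shift O       d f n = sym (shift-0 d (λ _ → refl) n)
⟦⟧-shift (q^ e)  d f n = trans (sym (shift-+ e d f n))
  (trans (cong (λ k → shift k f n) (ℕₚ.+-comm e d)) (shift-+ d e f n))
⟦⟧-shift (a ⊞ b) d f n = trans (cong₂ ℙ._+_ (⟦⟧-shift a d f n) (⟦⟧-shift b d f n))
  (sym (shift-⊕ d (⟦ a ⟧ f) (⟦ b ⟧ f) n))
⟦⟧-shift (a ⊠ b) d f n = trans (⟦⟧-cong a (⟦⟧-shift b d f) n) (⟦⟧-shift a d (⟦ b ⟧ f) n)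

-- Every operator is linear and commutes with shifts, and the operators are generated by shifts.
-- This gives commutativity of the product with no formula for its coefficients.
⟦⟧-comm : ∀ a b f → ⟦ a ⟧ (⟦ b ⟧ f) ≗ ⟦ b ⟧ (⟦ a ⟧ f)
⟦⟧-comm O       b f n = sym (⟦⟧-0 b (λ _ → refl) n)
⟦⟧-comm (q^ d)  b f n = sym (⟦⟧-shift b d f n)
⟦⟧-comm (a ⊞ a′) b f n = trans (cong₂ ℙ._+_ (⟦⟧-comm a b f n) (⟦⟧-comm a′ b f n))
  (sym (⟦⟧-⊕ b (⟦ a ⟧ f) (⟦ a′ ⟧ f) n))
⟦⟧-comm (a ⊠ a′) b f n = trans (⟦⟧-cong a (⟦⟧-comm a′ b f) n) (⟦⟧-comm a b (⟦ a′ ⟧ f) n)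

-- The ring 𝔽₂[q]/(q^{m+1}).
module Truncated (m : ℕ) where

  infix 4 _≈_
  -- A record, so that unification can read off `a` and `b`, which the bare family of equations
  -- between values of `⟦_⟧` would not determine.
  record _≈_ (a b : Poly) : Set where
    constructor eq
    field at : ∀ f → ⟦ a ⟧ f ≗[ m ] ⟦ b ⟧ f
  open _≈_ public

  private
    ≈-isEquivalence : IsEquivalence _≈_
    ≈-isEquivalence = record
      { refl = eq λ _ _ _ → refl
      ; sym = λ e → eq λ f n n≤m → sym (at e f n n≤m)
      ; trans = λ e e′ → eq λ f n n≤m → trans (at e f n n≤m) (at e′ f n n≤m) }

  commutativeSemiring : CommutativeSemiring 0ℓ 0ℓ
  commutativeSemiring = record
    { Carrier = Poly ; _≈_ = _≈_ ; _+_ = _⊞_ ; _*_ = _⊠_ ; 0# = O ; 1# = q^ 0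
    ; isCommutativeSemiring = isCommutativeSemiringˡ record
      { +-isCommutativeMonoid = record
        { isMonoid = record
          { isSemigroup = record
            { isMagma = record
              { isEquivalence = ≈-isEquivalence
              ; ∙-cong = λ e e′ → eq λ f n n≤m → cong₂ ℙ._+_ (at e f n n≤m) (at e′ f n n≤m) }
            ; assoc = λ a b c → eq λ f n _ → ℙₚ.+-assoc (⟦ a ⟧ f n) (⟦ b ⟧ f n) (⟦ c ⟧ f n) }
          ; identity = (λ _ → eq λ _ _ _ → refl) , (λ a → eq λ f n _ → ℙₚ.+-identityʳ (⟦ a ⟧ f n)) }
        ; comm = λ a b → eq λ f n _ → ℙₚ.+-comm (⟦ a ⟧ f n) (⟦ b ⟧ f n) }
      ; *-isCommutativeMonoid = record
        { isMonoid = record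
          { isSemigroup = record
            { isMagma = record
              { isEquivalence = ≈-isEquivalence
              ; ∙-cong = λ {a} {a′} {b} {b′} e e′ → eq λ f n n≤m →
                  trans (⟦⟧-local a m (at e′ f) n n≤m) (at e (⟦ b′ ⟧ f) n n≤m) }
            ; assoc = λ _ _ _ → eq λ _ _ _ → refl }
          ; identity = (λ _ → eq λ _ _ _ → refl) , (λ _ → eq λ _ _ _ → refl) }
        ; comm = λ a b → eq λ f n _ → ⟦⟧-comm a b f n }
      ; distribʳ = λ _ _ _ → eq λ _ _ _ → refl
      ; zeroˡ = λ _ → eq λ _ _ _ → refl
      }
    }

  open CommutativeSemiring commutativeSemiring public
    using (setoid; +-cong; *-cong; zeroʳ)
    renaming (refl to ≈-refl; sym to ≈-sym; trans to ≈-trans; reflexive to ≈-reflexive)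

  ⊞-self : ∀ a → a ⊞ a ≈ O
  ⊞-self a = eq λ f n _ → ℙₚ.p+p≡0ℙ (⟦ a ⟧ f n)

  private
    coefficient : Parity → Poly
    coefficient 0ℙ = O
    coefficient 1ℙ = q^ 0

    coefficient-morphism : CommutativeRing.rawRing ℙₚ.+-*-commutativeRing -Raw-AlmostCommutative⟶ fromCommutativeSemiring commutativeSemiring
    coefficient-morphism = record
      { ⟦_⟧ = coefficient
      ; +-homo = λ { 0ℙ _ → eq λ _ _ _ → refl ; 1ℙ 0ℙ → eq λ _ _ _ → sym (ℙₚ.+-identityʳ _) ; 1ℙ 1ℙ → ≈-sym (⊞-self (q^ 0)) }
      ; *-homo = λ { 0ℙ _ → eq λ _ _ _ → refl ; 1ℙ _ → eq λ _ _ _ → refl }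
      ; -‿homo = λ _ → ≈-refl
      ; 0-homo = ≈-refl
      ; 1-homo = ≈-refl
      }

    coefficient-≟ : WeaklyDecidable (Induced-equivalence coefficient-morphism)
    coefficient-≟ 0ℙ 0ℙ = just ≈-refl
    coefficient-≟ 1ℙ 1ℙ = just ≈-refl
    coefficient-≟ _  _  = nothing

  -- With coefficients taken in Parity, the solver knows that 1 + 1 = 0.
  open Algebra.Solver.Ring (CommutativeRing.rawRing ℙₚ.+-*-commutativeRing)
    (fromCommutativeSemiring commutativeSemiring) coefficient-morphism coefficient-≟ public
    using (solve; _:=_; _:+_; _:*_; con)

  q^-+ : ∀ d e → q^ (d + e) ≈ q^ d ⊠ q^ e
  q^-+ d e = eq λ f n _ → shift-+ d e f n

  q^-high : ∀ d → m < d → q^ d ≈ O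
  q^-high d m<d = eq λ f n n≤m → shift-< d f n (ℕₚ.≤-<-trans n≤m m<d)

-- Finite theta identities mod 2

tri : ℕ → ℕ
tri zero    = 0
tri (suc n) = suc n + tri n

-- The generalised pentagonal numbers without division: `pent⁺ n` is n(3n+1)/2, and `pent⁻ n` is
-- k(3k-1)/2 at k = n + 1.
pent⁻ pent⁺ : ℕ → ℕ
pent⁻ n = suc n * suc n + tri n
pent⁺ n = n * n + tri n

1+q^_ : ℕ → Poly
1+q^ e = q^ 0 ⊞ q^ e

euler : ℕ → ℕ → Poly
euler t zero    = q^ 0
euler t (suc n) = 1+q^ (t * suc n) ⊠ euler t n

-- A symmetric partial sum of a two-sided series: `a` lists the exponents of index n ≥ 0, `b` those
-- of index -(n+1), and the final `a`-term stays unpaired.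
theta : (ℕ → ℕ) → (ℕ → ℕ) → ℕ → Poly
theta a b zero    = q^ a 0
theta a b (suc n) = theta a b n ⊞ (q^ b n ⊞ q^ a (suc n))

pentagonal : ℕ → ℕ → Poly
pentagonal t = theta (λ n → t * pent⁺ n) (λ n → t * pent⁻ n)

-- The triangular numbers tri (2n) and tri (2n + 1).
tri⁺ tri⁻ : ℕ → ℕ
tri⁺ n = n * suc (n * 2)
tri⁻ n = suc n * suc (n * 2)

triangular : ℕ → ℕ → Poly
triangular t = theta (λ n → t * tri⁺ n) (λ n → t * tri⁻ n)

geometric : ℕ → ℕ → Poly
geometric d zero    = O
geometric d (suc j) = geometric d j ⊞ q^ (j * d)

module _ {m : ℕ} where
  open Truncated m
  open Relation.Binary.Reasoning.Setoid setoid

  q^-cong : ∀ {d e} → d ≡ e → q^ d ≈ q^ e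
  q^-cong refl = ≈-refl

  -- The product telescopes to `1 + q^((m+1)d)`; the m + 1 terms suffice because d ≥ 1 pushes the
  -- last exponent beyond m.
  geometric-inverse : ∀ d → 0 < d → 1+q^ d ⊠ geometric d (suc m) ≈ q^ 0
  geometric-inverse d 0<d = begin
    1+q^ d ⊠ geometric d (suc m)   ≈⟨ telescope (suc m) ⟩
    q^ 0 ⊞ q^ (suc m * d)          ≈⟨ +-cong ≈-refl (q^-high (suc m * d) high) ⟩
    q^ 0 ⊞ O                       ≈⟨ solve 1 (λ a → a :+ con 0ℙ := a) ≈-refl (q^ 0) ⟩
    q^ 0                           ∎
    where
    high : m < suc m * d
    high = ℕₚ.m≤m*n (suc m) d {{ℕ.>-nonZero 0<d}}
    telescope : ∀ j → 1+q^ d ⊠ geometric d j ≈ 1+q^ (j * d)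
    telescope zero = ≈-trans (zeroʳ (1+q^ d)) (≈-sym (⊞-self (q^ 0)))
    telescope (suc j) = begin
      1+q^ d ⊠ (geometric d j ⊞ q^ (j * d))
        ≈⟨ solve 3 (λ a g b → (con 1ℙ :+ a) :* (g :+ b) := (con 1ℙ :+ a) :* g :+ (b :+ a :* b)) ≈-refl (q^ d) (geometric d j) (q^ (j * d)) ⟩
      1+q^ d ⊠ geometric d j ⊞ (q^ (j * d) ⊞ q^ d ⊠ q^ (j * d))
        ≈⟨ +-cong (telescope j) (+-cong ≈-refl (≈-sym (q^-+ d (j * d)))) ⟩
      1+q^ (j * d) ⊞ (q^ (j * d) ⊞ q^ (d + j * d))
        ≈⟨ solve 2 (λ b c → con 1ℙ :+ b :+ (b :+ c) := con 1ℙ :+ c) ≈-refl (q^ (j * d)) (q^ (d + j * d)) ⟩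
      1+q^ (d + j * d) ∎

  1+q^-high : ∀ {d} → m < d → 1+q^ d ≈ q^ 0
  1+q^-high {d} m<d = begin
    q^ 0 ⊞ q^ d   ≈⟨ +-cong ≈-refl (q^-high d m<d) ⟩
    q^ 0 ⊞ O      ≈⟨ solve 1 (λ a → a :+ con 0ℙ := a) ≈-refl (q^ 0) ⟩
    q^ 0          ∎

module _ {m : ℕ} (t : ℕ) where
  open Truncated m
  open Relation.Binary.Reasoning.Setoid setoid

  private
    X : ℕ → Poly
    X e = q^ (t * e)

    X-+ : ∀ {c} a b → c ≡ a + b → X c ≈ X a ⊠ X b
    X-+ a b refl = ≈-trans (q^-cong (ℕₚ.*-distribˡ-+ t a b)) (q^-+ (t * a) (t * b))

    X-high : ∀ {n} s r → m < t * n → X (suc s * n + r) ≈ O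
    X-high {n} s r m<tn = q^-high (t * (suc s * n + r)) (ℕₚ.<-≤-trans m<tn
      (ℕₚ.*-monoʳ-≤ t (ℕₚ.≤-trans (ℕₚ.m≤m+n n (s * n)) (ℕₚ.m≤m+n (suc s * n) r))))

  euler-inverse : 0 < t → ∀ n → ∃ λ r → euler t n ⊠ r ≈ q^ 0
  euler-inverse 0<t zero    = q^ 0 , solve 0 (con 1ℙ :* con 1ℙ := con 1ℙ) ≈-refl
  euler-inverse 0<t (suc n) with euler-inverse 0<t n
  ... | r , e = geometric (t * suc n) (suc m) ⊠ r , (begin
    1+q^ (t * suc n) ⊠ euler t n ⊠ (geometric (t * suc n) (suc m) ⊠ r)
      ≈⟨ solve 4 (λ a b c d → a :* b :* (c :* d) := (a :* c) :* (b :* d)) ≈-refl (1+q^ (t * suc n)) (euler t n) (geometric (t * suc n) (suc m)) r ⟩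
    1+q^ (t * suc n) ⊠ geometric (t * suc n) (suc m) ⊠ (euler t n ⊠ r)
      ≈⟨ *-cong (geometric-inverse (t * suc n) (ℕₚ.*-mono-≤ 0<t (s≤s z≤n))) e ⟩
    q^ 0 ⊠ q^ 0
      ≈⟨ solve 0 (con 1ℙ :* con 1ℙ := con 1ℙ) ≈-refl ⟩
    q^ 0 ∎)

  euler-stable : ∀ n j → m < t * suc n → euler t (j + n) ≈ euler t n
  euler-stable n zero    m<tn = ≈-refl
  euler-stable n (suc j) m<tn = begin
    1+q^ (t * suc (j + n)) ⊠ euler t (j + n)
      ≈⟨ *-cong (1+q^-high (ℕₚ.<-≤-trans m<tn (ℕₚ.*-monoʳ-≤ t (s≤s (ℕₚ.m≤n+m n j))))) (euler-stable n j m<tn) ⟩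
    q^ 0 ⊠ euler t n
      ≈⟨ solve 1 (λ a → con 1ℙ :* a := a) ≈-refl (euler t n) ⟩
    euler t n ∎

  -- Shanks' finite form of the pentagonal number theorem: with P_k = ∏_{i≤k} (1 + q^i) this is
  -- Σ_{j≤s} (P_s/P_j) q^{jn+j(j+1)/2}, written in Horner form.
  shanks : ℕ → ℕ → Poly
  shanks n zero    = q^ 0
  shanks n (suc s) = 1+q^ (t * suc s) ⊠ shanks n s ⊞ q^ (t * (suc s * n + tri (suc s)))

  -- Induction on s: the new tails of the two sums are `u ⊠ x` and `u`, where `u` is the right-hand
  -- side for s, so everything becomes a multiple of `u`. At s = k the right-hand side is the term
  -- of exponent `pent⁻ k`.
  shanks-step : ∀ k s → 1+q^ (t * suc k) ⊠ shanks (suc k) s ⊞ shanks k s ≈ q^ (t * (suc k * suc s + tri s))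
  shanks-step k zero = begin
    (q^ 0 ⊞ X (suc k)) ⊠ q^ 0 ⊞ q^ 0
      ≈⟨ solve 1 (λ x → (con 1ℙ :+ x) :* con 1ℙ :+ con 1ℙ := x) ≈-refl (X (suc k)) ⟩
    X (suc k)
      ≈⟨ q^-cong (cong (t *_) (exponent k)) ⟩
    X (suc k * 1 + 0) ∎
    where
    exponent : ∀ k → suc k ≡ suc k * 1 + 0
    exponent = solve-∀
  shanks-step k (suc s) = begin
    (q^ 0 ⊞ y) ⊠ ((q^ 0 ⊞ x) ⊠ h ⊞ X (suc s * suc k + tri (suc s))) ⊞ ((q^ 0 ⊞ x) ⊠ h′ ⊞ X (suc s * k + tri (suc s)))
      ≈⟨ +-cong (*-cong ≈-refl (+-cong ≈-refl (X-+ _ (suc s) (e₁ k s (tri s))))) (+-cong ≈-refl (q^-cong (cong (t *_) (e₂ k s (tri s))))) ⟩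
    (q^ 0 ⊞ y) ⊠ ((q^ 0 ⊞ x) ⊠ h ⊞ u ⊠ x) ⊞ ((q^ 0 ⊞ x) ⊠ h′ ⊞ u)
      ≈⟨ solve 5 (λ x y h h′ u → (con 1ℙ :+ y) :* ((con 1ℙ :+ x) :* h :+ u :* x) :+ ((con 1ℙ :+ x) :* h′ :+ u)
                  := (con 1ℙ :+ x) :* ((con 1ℙ :+ y) :* h :+ h′) :+ ((con 1ℙ :+ y) :* (u :* x) :+ u)) ≈-refl x y h h′ u ⟩
    (q^ 0 ⊞ x) ⊠ ((q^ 0 ⊞ y) ⊠ h ⊞ h′) ⊞ ((q^ 0 ⊞ y) ⊠ (u ⊠ x) ⊞ u)
      ≈⟨ +-cong (*-cong ≈-refl (shanks-step k s)) ≈-refl ⟩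
    (q^ 0 ⊞ x) ⊠ u ⊞ ((q^ 0 ⊞ y) ⊠ (u ⊠ x) ⊞ u)
      ≈⟨ solve 3 (λ x y u → (con 1ℙ :+ x) :* u :+ ((con 1ℙ :+ y) :* (u :* x) :+ u) := u :* (x :* y)) ≈-refl x y u ⟩
    u ⊠ (x ⊠ y)
      ≈⟨ *-cong ≈-refl (≈-sym (X-+ (suc s) (suc k) refl)) ⟩
    u ⊠ X (suc s + suc k)
      ≈⟨ ≈-sym (X-+ (suc k * suc s + tri s) (suc s + suc k) (e₃ k s (tri s))) ⟩
    X (suc k * suc (suc s) + tri (suc s)) ∎
    where
    x = X (suc s)
    y = X (suc k)
    h = shanks (suc k) s
    h′ = shanks k s
    u = X (suc k * suc s + tri s)
    e₁ : ∀ k s r → suc s * suc k + (suc s + r) ≡ (suc k * suc s + r) + suc s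
    e₁ = solve-∀
    e₂ : ∀ k s r → suc s * k + (suc s + r) ≡ suc k * suc s + r
    e₂ = solve-∀
    e₃ : ∀ k s r → suc k * suc (suc s) + (suc s + r) ≡ (suc k * suc s + r) + (suc s + suc k)
    e₃ = solve-∀

  shanks-pentagonal : ∀ n → shanks n n ≈ pentagonal t n
  shanks-pentagonal zero    = q^-cong (sym (ℕₚ.*-zeroʳ t))
  shanks-pentagonal (suc k) = begin
    f ⊠ shanks (suc k) k ⊞ b
      -- Inserting `shanks k k` twice adds 0 in characteristic 2; one copy completes `shanks-step`,
      -- the other is the induction hypothesis.
      ≈⟨ solve 3 (λ c h b → c :+ b := (c :+ h) :+ (h :+ b)) ≈-refl (f ⊠ shanks (suc k) k) (shanks k k) b ⟩
    (f ⊠ shanks (suc k) k ⊞ shanks k k) ⊞ (shanks k k ⊞ b)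
      ≈⟨ +-cong (shanks-step k k) (+-cong (shanks-pentagonal k) ≈-refl) ⟩
    X (pent⁻ k) ⊞ (pentagonal t k ⊞ b)
      ≈⟨ solve 3 (λ a p b → a :+ (p :+ b) := p :+ (a :+ b)) ≈-refl (X (pent⁻ k)) (pentagonal t k) b ⟩
    pentagonal t k ⊞ (X (pent⁻ k) ⊞ b) ∎
    where
    f = 1+q^ (t * suc k)
    b = X (pent⁺ (suc k))

  -- Every summand with j ≥ 1 has exponent at least tn > m, so only the product in the summand j = 0
  -- survives the truncation.
  shanks-low : ∀ n s → m < t * n → shanks n s ≈ euler t s
  shanks-low n zero    m<tn = ≈-refl
  shanks-low n (suc s) m<tn = begin
    1+q^ (t * suc s) ⊠ shanks n s ⊞ X (suc s * n + tri (suc s))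
      ≈⟨ +-cong (*-cong ≈-refl (shanks-low n s m<tn)) (X-high s (tri (suc s)) m<tn) ⟩
    euler t (suc s) ⊞ O
      ≈⟨ solve 1 (λ a → a :+ con 0ℙ := a) ≈-refl (euler t (suc s)) ⟩
    euler t (suc s) ∎

  pentagonal-number-theorem : ∀ n → m < t * n → euler t n ≈ pentagonal t n
  pentagonal-number-theorem n m<tn = ≈-trans (≈-sym (shanks-low n n m<tn)) (shanks-pentagonal n)

  evens : ℕ → Poly
  evens zero    = q^ 0
  evens (suc n) = 1+q^ (t * (suc n * 2)) ⊠ evens n

  odds : ℕ → Poly
  odds zero    = q^ 0
  odds (suc n) = 1+q^ (t * suc (n * 2)) ⊠ odds n

  -- Shanks' finite form of Gauss' identity (q²;q²)_∞ = (q;q²)_∞ Σ q^{j(j+1)/2}: this is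
  -- Σ_{j≤s} (evens s / evens j) (odds j) q^{j(2n+1)}, again in Horner form.
  shanks′ : ℕ → ℕ → Poly
  shanks′ n zero    = q^ 0
  shanks′ n (suc s) = 1+q^ (t * (suc s * 2)) ⊠ shanks′ n s ⊞ odds (suc s) ⊠ q^ (t * (suc s * suc (n * 2)))

  -- The analogue of `shanks-step`. The second sum carries the factor `1 + q^(t(2k+1))` because
  -- `shanks′ k k` is compared with `odds k`, and this factor turns `odds k` into `odds (suc k)`. At
  -- s = k the exponent on the right is `t * tri⁻ k`.
  shanks′-step : ∀ k s → 1+q^ (t * (suc k * 2)) ⊠ shanks′ (suc k) s ⊞ 1+q^ (t * suc (k * 2)) ⊠ shanks′ k s
                 ≈ q^ (t * (suc s * suc (k * 2))) ⊠ odds (suc s)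
  shanks′-step k zero = begin
    (q^ 0 ⊞ X (suc k * 2)) ⊠ q^ 0 ⊞ (q^ 0 ⊞ y) ⊠ q^ 0
      ≈⟨ +-cong (*-cong (+-cong ≈-refl (X-+ (suc (k * 2)) 1 (e₁ k))) ≈-refl) ≈-refl ⟩
    (q^ 0 ⊞ y ⊠ c) ⊠ q^ 0 ⊞ (q^ 0 ⊞ y) ⊠ q^ 0
      ≈⟨ solve 2 (λ y c → (con 1ℙ :+ y :* c) :* con 1ℙ :+ (con 1ℙ :+ y) :* con 1ℙ := y :* ((con 1ℙ :+ c) :* con 1ℙ)) ≈-refl y c ⟩
    y ⊠ ((q^ 0 ⊞ c) ⊠ q^ 0)
      ≈⟨ *-cong (q^-cong (cong (t *_) (e₂ k))) ≈-refl ⟩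
    X (1 * suc (k * 2)) ⊠ ((q^ 0 ⊞ c) ⊠ q^ 0) ∎
    where
    y = X (suc (k * 2))
    c = X 1
    e₁ : ∀ k → suc k * 2 ≡ suc (k * 2) + 1
    e₁ = solve-∀
    e₂ : ∀ k → suc (k * 2) ≡ 1 * suc (k * 2)
    e₂ = solve-∀
  shanks′-step k (suc s) = begin
    (q^ 0 ⊞ X (suc k * 2)) ⊠ ((q^ 0 ⊞ b) ⊠ h ⊞ d ⊠ X (suc s * suc (suc k * 2))) ⊞ (q^ 0 ⊞ y) ⊠ ((q^ 0 ⊞ b) ⊠ h′ ⊞ d ⊠ u)
      ≈⟨ +-cong (*-cong (+-cong ≈-refl yc) (+-cong ≈-refl (*-cong ≈-refl (X-+ _ (suc s * 2) (e₁ k s))))) ≈-refl ⟩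
    (q^ 0 ⊞ y ⊠ c) ⊠ ((q^ 0 ⊞ b) ⊠ h ⊞ d ⊠ (u ⊠ b)) ⊞ (q^ 0 ⊞ y) ⊠ ((q^ 0 ⊞ b) ⊠ h′ ⊞ d ⊠ u)
      ≈⟨ solve 7 (λ b c d y h h′ u →
           (con 1ℙ :+ y :* c) :* ((con 1ℙ :+ b) :* h :+ d :* (u :* b)) :+ (con 1ℙ :+ y) :* ((con 1ℙ :+ b) :* h′ :+ d :* u)
             := (con 1ℙ :+ b) :* ((con 1ℙ :+ y :* c) :* h :+ (con 1ℙ :+ y) :* h′) :+ ((con 1ℙ :+ y :* c) :* (d :* (u :* b)) :+ (con 1ℙ :+ y) :* (d :* u)))
           ≈-refl b c d y h h′ u ⟩
    (q^ 0 ⊞ b) ⊠ ((q^ 0 ⊞ y ⊠ c) ⊠ h ⊞ (q^ 0 ⊞ y) ⊠ h′) ⊞ ((q^ 0 ⊞ y ⊠ c) ⊠ (d ⊠ (u ⊠ b)) ⊞ (q^ 0 ⊞ y) ⊠ (d ⊠ u))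
      ≈⟨ +-cong (*-cong ≈-refl (≈-trans (+-cong (*-cong (+-cong ≈-refl (≈-sym yc)) ≈-refl) ≈-refl) (shanks′-step k s))) ≈-refl ⟩
    (q^ 0 ⊞ b) ⊠ (u ⊠ d) ⊞ ((q^ 0 ⊞ y ⊠ c) ⊠ (d ⊠ (u ⊠ b)) ⊞ (q^ 0 ⊞ y) ⊠ (d ⊠ u))
      ≈⟨ solve 5 (λ b c d y u →
           (con 1ℙ :+ b) :* (u :* d) :+ ((con 1ℙ :+ y :* c) :* (d :* (u :* b)) :+ (con 1ℙ :+ y) :* (d :* u))
             := (y :* u) :* ((con 1ℙ :+ b :* c) :* d)) ≈-refl b c d y u ⟩
    (y ⊠ u) ⊠ ((q^ 0 ⊞ b ⊠ c) ⊠ d)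
      ≈⟨ *-cong (≈-sym (X-+ (suc (k * 2)) (suc s * suc (k * 2)) refl)) (*-cong (+-cong ≈-refl (≈-sym (X-+ (suc s * 2) 1 (e₂ s)))) ≈-refl) ⟩
    X (suc (suc s) * suc (k * 2)) ⊠ ((q^ 0 ⊞ X (suc (suc s * 2))) ⊠ d) ∎
    where
    b = X (suc s * 2)
    c = X 1
    d = odds (suc s)
    y = X (suc (k * 2))
    h = shanks′ (suc k) s
    h′ = shanks′ k s
    u = X (suc s * suc (k * 2))
    e₀ : ∀ k → suc k * 2 ≡ suc (k * 2) + 1
    e₀ = solve-∀
    yc : X (suc k * 2) ≈ y ⊠ c
    yc = X-+ (suc (k * 2)) 1 (e₀ k)
    e₁ : ∀ k s → suc s * suc (suc k * 2) ≡ suc s * suc (k * 2) + suc s * 2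
    e₁ = solve-∀
    e₂ : ∀ s → suc (suc s * 2) ≡ suc s * 2 + 1
    e₂ = solve-∀

  shanks′-triangular : ∀ n → shanks′ n n ≈ odds n ⊠ triangular t n
  shanks′-triangular zero    = begin
    q^ 0             ≈⟨ solve 0 (con 1ℙ := con 1ℙ :* con 1ℙ) ≈-refl ⟩
    q^ 0 ⊠ q^ 0      ≈⟨ *-cong ≈-refl (q^-cong (sym (ℕₚ.*-zeroʳ t))) ⟩
    q^ 0 ⊠ X 0       ∎
  shanks′-triangular (suc k) = begin
    f ⊠ shanks′ (suc k) k ⊞ d ⊠ b
      ≈⟨ solve 3 (λ l r z → l :+ z := (l :+ r) :+ (r :+ z)) ≈-refl (f ⊠ shanks′ (suc k) k) (g ⊠ shanks′ k k) (d ⊠ b) ⟩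
    (f ⊠ shanks′ (suc k) k ⊞ g ⊠ shanks′ k k) ⊞ (g ⊠ shanks′ k k ⊞ d ⊠ b)
      ≈⟨ +-cong (shanks′-step k k) (+-cong (*-cong ≈-refl (shanks′-triangular k)) ≈-refl) ⟩
    a ⊠ d ⊞ (g ⊠ (odds k ⊠ triangular t k) ⊞ d ⊠ b)
      ≈⟨ solve 5 (λ a g o p b → a :* (g :* o) :+ (g :* (o :* p) :+ (g :* o) :* b) := (g :* o) :* (p :+ (a :+ b))) ≈-refl a g (odds k) (triangular t k) b ⟩
    d ⊠ (triangular t k ⊞ (a ⊞ b)) ∎
    where
    f = 1+q^ (t * (suc k * 2))
    g = 1+q^ (t * suc (k * 2))
    d = odds (suc k)
    a = X (suc k * suc (k * 2))
    b = X (suc k * suc (suc k * 2))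

  shanks′-low : ∀ n s → m < t * n → shanks′ n s ≈ evens s
  shanks′-low n zero    m<tn = ≈-refl
  shanks′-low n (suc s) m<tn = begin
    1+q^ (t * (suc s * 2)) ⊠ shanks′ n s ⊞ odds (suc s) ⊠ X (suc s * suc (n * 2))
      ≈⟨ +-cong (*-cong ≈-refl (shanks′-low n s m<tn)) (*-cong ≈-refl (≈-trans (q^-cong (cong (t *_) (e n s))) (X-high s (suc s * suc n) m<tn))) ⟩
    evens (suc s) ⊞ odds (suc s) ⊠ O
      ≈⟨ solve 2 (λ a b → a :+ b :* con 0ℙ := a) ≈-refl (evens (suc s)) (odds (suc s)) ⟩
    evens (suc s) ∎
    where
    e : ∀ n s → suc s * suc (n * 2) ≡ suc s * n + suc s * suc n
    e = solve-∀

  evens-odds : ∀ n → evens n ⊠ odds n ≈ euler t (n * 2)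
  evens-odds zero    = solve 0 (con 1ℙ :* con 1ℙ := con 1ℙ) ≈-refl
  evens-odds (suc n) = begin
    a ⊠ evens n ⊠ (b ⊠ odds n)
      ≈⟨ solve 4 (λ a e b o → a :* e :* (b :* o) := a :* (b :* (e :* o))) ≈-refl a (evens n) b (odds n) ⟩
    a ⊠ (b ⊠ (evens n ⊠ odds n))
      ≈⟨ *-cong ≈-refl (*-cong ≈-refl (evens-odds n)) ⟩
    a ⊠ (b ⊠ euler t (n * 2)) ∎
    where
    a = 1+q^ (t * (suc n * 2))
    b = 1+q^ (t * suc (n * 2))

  -- Frobenius, factor by factor: `1 + q^(2i) = (1 + q^i)²` over 𝔽₂.
  evens-square : ∀ n → evens n ≈ euler t n ⊠ euler t n
  evens-square zero    = solve 0 (con 1ℙ := con 1ℙ :* con 1ℙ) ≈-refl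
  evens-square (suc n) = begin
    (q^ 0 ⊞ X (suc n * 2)) ⊠ evens n
      ≈⟨ *-cong (+-cong ≈-refl (X-+ (suc n) (suc n) (e n))) (evens-square n) ⟩
    (q^ 0 ⊞ x ⊠ x) ⊠ (euler t n ⊠ euler t n)
      ≈⟨ solve 2 (λ x p → (con 1ℙ :+ x :* x) :* (p :* p) := ((con 1ℙ :+ x) :* p) :* ((con 1ℙ :+ x) :* p)) ≈-refl x (euler t n) ⟩
    euler t (suc n) ⊠ euler t (suc n) ∎
    where
    x = X (suc n)
    e : ∀ n → suc n * 2 ≡ suc n + suc n
    e = solve-∀

  -- Jacobi's (q;q)_∞³ = Σ (-1)^j (2j+1) q^{j(j+1)/2} mod 2.
  euler-cubed : 0 < t → ∀ n → m < t * n → euler t n ⊠ euler t n ⊠ euler t n ≈ triangular t n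
  euler-cubed 0<t n m<tn with euler-inverse 0<t n
  ... | r , e≈1 = begin
    p ⊠ p ⊠ p
      ≈⟨ solve 1 (λ c → c := c :* con 1ℙ) ≈-refl (p ⊠ p ⊠ p) ⟩
    p ⊠ p ⊠ p ⊠ q^ 0
      ≈⟨ *-cong ≈-refl (≈-sym e≈1) ⟩
    p ⊠ p ⊠ p ⊠ (p ⊠ r)
      ≈⟨ solve 2 (λ p r → p :* p :* p :* (p :* r) := (p :* p) :* (p :* p) :* r) ≈-refl p r ⟩
    (p ⊠ p) ⊠ (p ⊠ p) ⊠ r
      ≈⟨ *-cong (*-cong (≈-sym (evens-square n)) (≈-sym (evens-square n))) ≈-refl ⟩
    -- Gauss' identity is applied to one of the two copies of `evens n`. The other then combines
    -- with `odds n` to `euler t (n * 2)`, which agrees with `p` up to degree m and is cancelled by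
    -- `r`.
    evens n ⊠ evens n ⊠ r
      ≈⟨ *-cong (*-cong ≈-refl (≈-trans (≈-sym (shanks′-low n n m<tn)) (shanks′-triangular n))) ≈-refl ⟩
    evens n ⊠ (odds n ⊠ triangular t n) ⊠ r
      ≈⟨ solve 4 (λ e o ψ r → e :* (o :* ψ) :* r := (e :* o) :* r :* ψ) ≈-refl (evens n) (odds n) (triangular t n) r ⟩
    evens n ⊠ odds n ⊠ r ⊠ triangular t n
      ≈⟨ *-cong (*-cong (≈-trans (evens-odds n) (≈-trans (≈-reflexive (cong (euler t) (double n))) (euler-stable n n (ℕₚ.<-≤-trans m<tn (ℕₚ.*-monoʳ-≤ t (ℕₚ.n≤1+n n)))))) ≈-refl) ≈-refl ⟩
    p ⊠ r ⊠ triangular t n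
      ≈⟨ *-cong e≈1 ≈-refl ⟩
    q^ 0 ⊠ triangular t n
      ≈⟨ solve 1 (λ a → con 1ℙ :* a := a) ≈-refl (triangular t n) ⟩
    triangular t n ∎
    where
    p = euler t n
    double : ∀ n → n * 2 ≡ n + n
    double = solve-∀

  euler-double : ∀ n → euler (t * 2) n ≈ euler t n ⊠ euler t n
  euler-double n = ≈-trans (same n) (evens-square n)
    where
    e : ∀ t n → t * 2 * n ≡ t * (n * 2)
    e = solve-∀
    same : ∀ n → euler (t * 2) n ≈ evens n
    same zero    = ≈-refl
    same (suc n) = *-cong (+-cong ≈-refl (q^-cong (e t (suc n)))) (same n)

-- Generating functions of B and a₂

parityℤ : ℤ → Parity
parityℤ i = parity ∣ i ∣

parityℤ-⊖ : ∀ m n → parityℤ (m ℤ.⊖ n) ≡ parity m ℙ.+ parity n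
parityℤ-⊖ m       zero    = sym (ℙₚ.+-identityʳ (parity m))
parityℤ-⊖ zero    (suc n) = refl
parityℤ-⊖ (suc m) (suc n) = begin
  parityℤ (suc m ℤ.⊖ suc n)                ≡⟨ cong parityℤ (ℤₚ.[1+m]⊖[1+n]≡m⊖n m n) ⟩
  parityℤ (m ℤ.⊖ n)                        ≡⟨ parityℤ-⊖ m n ⟩
  parity m ℙ.+ parity n                    ≡⟨ cong (ℙ._+ (parity m ℙ.+ parity n)) (sym (ℙₚ.p+p≡0ℙ 1ℙ)) ⟩
  (1ℙ ℙ.+ 1ℙ) ℙ.+ (parity m ℙ.+ parity n)  ≡⟨ ℙ-interchange 1ℙ 1ℙ (parity m) (parity n) ⟩
  (1ℙ ℙ.+ parity m) ℙ.+ (1ℙ ℙ.+ parity n)  ≡⟨ sym (cong₂ ℙ._+_ (ℙₚ.+-homo-+ 1 m) (ℙₚ.+-homo-+ 1 n)) ⟩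
  parity (suc m) ℙ.+ parity (suc n)        ∎
  where open ≡-Reasoning

parityℤ-+ : ∀ i j → parityℤ (i ℤ.+ j) ≡ parityℤ i ℙ.+ parityℤ j
parityℤ-+ (+ m)    (+ n)    = ℙₚ.+-homo-+ m n
parityℤ-+ (+ m)    -[1+ n ] = parityℤ-⊖ m (suc n)
parityℤ-+ -[1+ m ] (+ n)    = trans (parityℤ-⊖ n (suc m)) (ℙₚ.+-comm (parity n) (parity (suc m)))
parityℤ-+ -[1+ m ] -[1+ n ] = trans (cong parity (sym (ℕₚ.+-suc (suc m) n))) (ℙₚ.+-homo-+ (suc m) (suc n))

parityℤ-- : ∀ i j → parityℤ (i ℤ.- j) ≡ parityℤ i ℙ.+ parityℤ j
parityℤ-- i j = trans (parityℤ-+ i (- j)) (cong (λ k → parityℤ i ℙ.+ parity k) (ℤₚ.∣-i∣≡∣i∣ j))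

parityℤ-* : ∀ i j → parityℤ (i ℤ.* j) ≡ parityℤ i ℙ.* parityℤ j
parityℤ-* i j = trans (cong parity (ℤₚ.abs-* i j)) (ℙₚ.*-homo-* ∣ i ∣ ∣ j ∣)

mulOneMinus-parity : ∀ d {f g} → parityℤ ∘ f ≗ g → parityℤ ∘ mulOneMinus d f ≗ ⟦ 1+q^ d ⟧ g
mulOneMinus-parity d {f} {g} e n with d ≤? n
... | yes d≤n = trans (parityℤ-- (f n) (f (n ∸ d)))
        (cong₂ ℙ._+_ (e n) (trans (e (n ∸ d)) (sym (shift-≥ d g n d≤n))))
... | no  d≰n = trans (e n) (sym (trans (cong (g n ℙ.+_) (shift-< d g n (ℕₚ.≰⇒> d≰n))) (ℙₚ.+-identityʳ (g n))))

mulEtaTrunc-parity : ∀ t N {f g} → parityℤ ∘ f ≗ g → parityℤ ∘ mulEtaTrunc t N f ≗ ⟦ euler t N ⟧ g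
mulEtaTrunc-parity t zero    e = e
mulEtaTrunc-parity t (suc N) e = mulOneMinus-parity (t * suc N) (mulEtaTrunc-parity t N e)

one-parity : parityℤ ∘ one ≗ one₂
one-parity zero    = refl
one-parity (suc n) = refl

etaProduct : ℕ → Poly
etaProduct n = e ⊠ (e ⊠ (e ⊠ (e ⊠ (e ⊠ e)))) ⊠ euler 3 n
  where e = euler 1 n

a₂-parity : ∀ n → parityℤ (a₂ n) ≡ ⟦ etaProduct n ⟧ one₂ n
a₂-parity n = E 1 (E 1 (E 1 (E 1 (E 1 (E 1 (E 3 one-parity)))))) n
  where
  E : ∀ t {f g} → parityℤ ∘ f ≗ g → parityℤ ∘ mulEtaTrunc t n f ≗ ⟦ euler t n ⟧ g
  E t = mulEtaTrunc-parity t n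

-- Sums and list counts mod 2.

Σ : ℕ → (ℕ → Parity) → Parity
Σ zero    h = 0ℙ
Σ (suc n) h = h 0 ℙ.+ Σ n (h ∘ suc)

Σ-cong : ∀ n {h k} → (∀ i → i < n → h i ≡ k i) → Σ n h ≡ Σ n k
Σ-cong zero    e = refl
Σ-cong (suc n) e = cong₂ ℙ._+_ (e 0 (s≤s z≤n)) (Σ-cong n (λ i i<n → e (suc i) (s≤s i<n)))

Σ-0 : ∀ n {h} → (∀ i → h i ≡ 0ℙ) → Σ n h ≡ 0ℙ
Σ-0 zero    e = refl
Σ-0 (suc n) e = cong₂ ℙ._+_ (e 0) (Σ-0 n (e ∘ suc))

Σ-+ : ∀ n h k → Σ n (λ i → h i ℙ.+ k i) ≡ Σ n h ℙ.+ Σ n k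
Σ-+ zero    h k = refl
Σ-+ (suc n) h k = trans (cong ((h 0 ℙ.+ k 0) ℙ.+_) (Σ-+ n (h ∘ suc) (k ∘ suc)))
  (ℙ-interchange (h 0) (k 0) (Σ n (h ∘ suc)) (Σ n (k ∘ suc)))

Σ-last : ∀ n h → Σ (suc n) h ≡ Σ n h ℙ.+ h n
Σ-last zero    h = ℙₚ.+-identityʳ (h 0)
Σ-last (suc n) h = trans (cong (h 0 ℙ.+_) (Σ-last n (h ∘ suc))) (sym (ℙₚ.+-assoc (h 0) (Σ n (h ∘ suc)) (h (suc n))))

sumOver : ∀ {A : Set} → (A → Parity) → List A → Parity
sumOver h []       = 0ℙ
sumOver h (x ∷ xs) = h x ℙ.+ sumOver h xs

sumOver-applyUpTo : ∀ {A : Set} (h : A → Parity) f n → sumOver h (applyUpTo f n) ≡ Σ n (h ∘ f)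
sumOver-applyUpTo h f zero    = refl
sumOver-applyUpTo h f (suc n) = cong (h (f 0) ℙ.+_) (sumOver-applyUpTo h (f ∘ suc) n)

module _ {A : Set} {P : Pred A 0ℓ} (P? : Decidable P) where

  countℙ : List A → Parity
  countℙ xs = parity (length (filter P? xs))

  countℙ-++ : ∀ xs ys → countℙ (xs ++ ys) ≡ countℙ xs ℙ.+ countℙ ys
  countℙ-++ xs ys = begin
    parity (length (filter P? (xs ++ ys)))           ≡⟨ cong (parity ∘ length) (Listₚ.filter-++ P? xs ys) ⟩
    parity (length (filter P? xs ++ filter P? ys))   ≡⟨ cong parity (Listₚ.length-++ (filter P? xs)) ⟩
    parity (length (filter P? xs) + length (filter P? ys)) ≡⟨ ℙₚ.+-homo-+ (length (filter P? xs)) _ ⟩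
    countℙ xs ℙ.+ countℙ ys ∎
    where open ≡-Reasoning

  countℙ-concatMap : ∀ {C : Set} (h : C → List A) xs → countℙ (concatMap h xs) ≡ sumOver (countℙ ∘ h) xs
  countℙ-concatMap h []       = refl
  countℙ-concatMap h (x ∷ xs) = trans (countℙ-++ (h x) (concatMap h xs)) (cong (countℙ (h x) ℙ.+_) (countℙ-concatMap h xs))

  sumOver-filter : ∀ {h g} → (∀ x → P x → h x ≡ g x) → (∀ x → ¬ P x → g x ≡ 0ℙ) →
                   ∀ xs → sumOver h (filter P? xs) ≡ sumOver g xs
  sumOver-filter e z [] = refl
  sumOver-filter {h} {g} e z (x ∷ xs) with P? x
  ... | yes p = cong₂ ℙ._+_ (e x p) (sumOver-filter e z xs)
  ... | no ¬p = trans (sumOver-filter e z xs) (sym (cong (ℙ._+ sumOver g xs) (z x ¬p)))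

  countℙ-map : ∀ {C : Set} {Q : Pred C 0ℓ} (Q? : Decidable Q) (f : C → A) →
               (∀ x → P (f x) → Q x) → (∀ x → Q x → P (f x)) → ∀ xs → countℙ (map f xs) ≡ parity (length (filter Q? xs))
  countℙ-map Q? f to from [] = refl
  countℙ-map Q? f to from (x ∷ xs) with P? (f x) | Q? x
  ... | yes p | yes q = trans (ℙₚ.+-homo-+ 1 (length (filter P? (map f xs))))
        (trans (cong (1ℙ ℙ.+_) (countℙ-map Q? f to from xs)) (sym (ℙₚ.+-homo-+ 1 (length (filter Q? xs)))))
  ... | no ¬p | no ¬q = countℙ-map Q? f to from xs
  ... | yes p | no ¬q = ⊥-elim (¬q (to x p))
  ... | no ¬p | yes q = ⊥-elim (¬p (from x q))

  countℙ-none : ∀ xs → All (¬_ ∘ P) xs → countℙ xs ≡ 0ℙ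
  countℙ-none xs none = cong (parity ∘ length) (Listₚ.filter-none P? none)

module _ {A C : Set} {P : Pred A 0ℓ} {Q : Pred C 0ℓ} (P? : Decidable P) (Q? : Decidable Q) where

  private
    R? : Decidable (λ ((a , c) : A × C) → P a × Q c)
    R? ac = P? (proj₁ ac) ×-dec Q? (proj₂ ac)

  countℙ-cartesianProduct : ∀ xs ys → countℙ R? (cartesianProduct xs ys) ≡ countℙ P? xs ℙ.* countℙ Q? ys
  countℙ-cartesianProduct [] ys = refl
  countℙ-cartesianProduct (x ∷ xs) ys = trans (countℙ-++ R? (map (x ,_) ys) (cartesianProduct xs ys))
    (trans (cong (countℙ R? (map (x ,_) ys) ℙ.+_) (countℙ-cartesianProduct xs ys)) row)
    where
    row : countℙ R? (map (x ,_) ys) ℙ.+ (countℙ P? xs ℙ.* countℙ Q? ys) ≡ countℙ P? (x ∷ xs) ℙ.* countℙ Q? ys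
    row with P? x
    ... | yes p = begin
      countℙ R? (map (x ,_) ys) ℙ.+ (countℙ P? xs ℙ.* countℙ Q? ys)
        ≡⟨ cong (ℙ._+ (countℙ P? xs ℙ.* countℙ Q? ys)) (countℙ-map R? Q? (x ,_) (λ _ → proj₂) (λ _ q → p , q) ys) ⟩
      countℙ Q? ys ℙ.+ (countℙ P? xs ℙ.* countℙ Q? ys)
        ≡⟨ sym (ℙₚ.*-distribʳ-+ (countℙ Q? ys) 1ℙ (countℙ P? xs)) ⟩
      (1ℙ ℙ.+ countℙ P? xs) ℙ.* countℙ Q? ys
        ≡⟨ cong (ℙ._* countℙ Q? ys) (sym (ℙₚ.+-homo-+ 1 (length (filter P? xs)))) ⟩
      parity (suc (length (filter P? xs))) ℙ.* countℙ Q? ys ∎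
      where open ≡-Reasoning
    ... | no ¬p = cong (ℙ._+ (countℙ P? xs ℙ.* countℙ Q? ys))
                    (countℙ-none R? (map (x ,_) ys) (Allₚ.map⁺ (All.universal (λ _ → ¬p ∘ proj₁) ys)))

-- Generating functions of regular partitions and bipartitions.

geometric-Σ : ∀ d J f n → ⟦ geometric d J ⟧ f n ≡ Σ J (λ j → shift (j * d) f n)
geometric-Σ d zero    f n = refl
geometric-Σ d (suc J) f n = trans (cong (ℙ._+ shift (J * d) f n) (geometric-Σ d J f n)) (sym (Σ-last J _))

-- Partitions with parts at most the last argument and none divisible by u. Each factor
-- `1/(1 - q^i)` is cut to M + 1 terms, which is exact up to degree M.
regular : ℕ → ℕ → ℕ → Poly
regular u M zero = q^ 0
regular u M (suc m) with u ∣? suc m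
... | yes _ = regular u M m
... | no  _ = geometric (suc m) (suc M) ⊠ regular u M m

regularCount : ℕ → ℕ → Series₂
regularCount u m n = countℙ (noPartDivBy? u) (partsBounded m n)

module _ (u : ℕ) where
  open ≡-Reasoning

  private
    prepend : ℕ → ℕ → List ℕ → List ℕ
    prepend m j = replicate j (suc m) ++_

    -- Sorts partitions by the multiplicity j of the part m + 1. Requiring `g` to vanish where
    -- j(m+1) > n removes the filter from the sum.
    regularCount-suc : ∀ m n {g : ℕ → Parity} →
      (∀ j → j * suc m ≤ n → countℙ (noPartDivBy? u) (map (prepend m j) (partsBounded m (n ∸ j * suc m))) ≡ g j) →
      (∀ j → ¬ (j * suc m ≤ n) → g j ≡ 0ℙ) →
      regularCount u (suc m) n ≡ Σ (suc n) g
    regularCount-suc m n {g} e z = begin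
      regularCount u (suc m) n
        ≡⟨ countℙ-concatMap (noPartDivBy? u) h (filter (λ j → j * suc m ≤? n) (upTo (suc n))) ⟩
      sumOver (countℙ (noPartDivBy? u) ∘ h) (filter (λ j → j * suc m ≤? n) (upTo (suc n)))
        ≡⟨ sumOver-filter (λ j → j * suc m ≤? n) e z (upTo (suc n)) ⟩
      sumOver g (upTo (suc n))
        ≡⟨ sumOver-applyUpTo g id (suc n) ⟩
      Σ (suc n) g ∎
      where
      h : ℕ → List (List ℕ)
      h j = map (prepend m j) (partsBounded m (n ∸ j * suc m))

  regularCount-divisible : ∀ m n → u N.∣ suc m → regularCount u (suc m) n ≡ regularCount u m n
  regularCount-divisible m n u∣ = begin
    regularCount u (suc m) n                        ≡⟨ regularCount-suc m n {g} e z ⟩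
    regularCount u m n ℙ.+ Σ n (λ _ → 0ℙ)          ≡⟨ cong (regularCount u m n ℙ.+_) (Σ-0 n (λ _ → refl)) ⟩
    regularCount u m n ℙ.+ 0ℙ                      ≡⟨ ℙₚ.+-identityʳ _ ⟩
    regularCount u m n                              ∎
    where
    g : ℕ → Parity
    g zero    = regularCount u m n
    g (suc _) = 0ℙ
    e : ∀ j → j * suc m ≤ n → countℙ (noPartDivBy? u) (map (prepend m j) (partsBounded m (n ∸ j * suc m))) ≡ g j
    e zero    _ = countℙ-map (noPartDivBy? u) (noPartDivBy? u) id (λ _ → id) (λ _ → id) (partsBounded m n)
    e (suc j) _ = countℙ-none (noPartDivBy? u) (map (prepend m (suc j)) parts)
                    (Allₚ.map⁺ (All.universal (λ { _ (u∤ All.∷ _) → u∤ u∣ }) parts))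
      where parts = partsBounded m (n ∸ suc j * suc m)
    z : ∀ j → ¬ (j * suc m ≤ n) → g j ≡ 0ℙ
    z zero    ¬≤ = ⊥-elim (¬≤ z≤n)
    z (suc j) _  = refl

  regularCount-nondivisible : ∀ m n → ¬ (u N.∣ suc m) → regularCount u (suc m) n ≡ ⟦ geometric (suc m) (suc n) ⟧ (regularCount u m) n
  regularCount-nondivisible m n u∤ = trans
    (regularCount-suc m n
      (λ j j≤ → trans (countℙ-map (noPartDivBy? u) (noPartDivBy? u) (prepend m j)
                         (λ α → Allₚ.++⁻ʳ (replicate j (suc m))) (λ α r → Allₚ.++⁺ (Allₚ.replicate⁺ j u∤) r) (partsBounded m (n ∸ j * suc m)))
                      (sym (shift-≥ (j * suc m) (regularCount u m) n j≤)))
      (λ j ¬≤ → shift-< (j * suc m) (regularCount u m) n (ℕₚ.≰⇒> ¬≤)))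
    (sym (geometric-Σ (suc m) (suc n) (regularCount u m) n))

geometric-stable : ∀ d j n f → ⟦ geometric (suc d) (suc (j + n)) ⟧ f n ≡ ⟦ geometric (suc d) (suc n) ⟧ f n
geometric-stable d zero    n f = refl
geometric-stable d (suc j) n f = begin
  ⟦ geometric (suc d) (suc (j + n)) ⟧ f n ℙ.+ shift (suc (j + n) * suc d) f n
    ≡⟨ cong₂ ℙ._+_ (geometric-stable d j n f) (shift-< (suc (j + n) * suc d) f n high) ⟩
  ⟦ geometric (suc d) (suc n) ⟧ f n ℙ.+ 0ℙ
    ≡⟨ ℙₚ.+-identityʳ _ ⟩
  ⟦ geometric (suc d) (suc n) ⟧ f n ∎
  where
  open ≡-Reasoning
  high : n < suc (j + n) * suc d
  high = ℕₚ.≤-trans (s≤s (ℕₚ.m≤n+m n j)) (ℕₚ.m≤m*n (suc (j + n)) (suc d))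

regularCount-regular : ∀ u M m → regularCount u m ≗[ M ] ⟦ regular u M m ⟧ one₂
regularCount-regular u M zero zero    n≤M = refl
regularCount-regular u M zero (suc n) n≤M = refl
regularCount-regular u M (suc m) n n≤M with u ∣? suc m
... | yes u∣ = trans (regularCount-divisible u m n u∣) (regularCount-regular u M m n n≤M)
... | no  u∤ = begin
  regularCount u (suc m) n
    ≡⟨ regularCount-nondivisible u m n u∤ ⟩
  ⟦ geometric (suc m) (suc n) ⟧ (regularCount u m) n
    ≡⟨ sym (geometric-stable m (M ∸ n) n (regularCount u m)) ⟩
  ⟦ geometric (suc m) (suc (M ∸ n + n)) ⟧ (regularCount u m) n
    ≡⟨ cong (λ k → ⟦ geometric (suc m) (suc k) ⟧ (regularCount u m) n) (ℕₚ.m∸n+n≡m n≤M) ⟩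
  ⟦ geometric (suc m) (suc M) ⟧ (regularCount u m) n
    ≡⟨ ⟦⟧-local (geometric (suc m) (suc M)) M (regularCount-regular u M m) n n≤M ⟩
  ⟦ geometric (suc m) (suc M) ⟧ (⟦ regular u M m ⟧ one₂) n ∎
  where open ≡-Reasoning

geometric-high : ∀ d j n f → n < d → ⟦ geometric d (suc j) ⟧ f n ≡ f n
geometric-high d zero    n f n<d = refl
geometric-high d (suc j) n f n<d = begin
  ⟦ geometric d (suc j) ⟧ f n ℙ.+ shift (suc j * d) f n
    ≡⟨ cong₂ ℙ._+_ (geometric-high d j n f n<d) (shift-< (suc j * d) f n (ℕₚ.<-≤-trans n<d (ℕₚ.m≤m+n d (j * d)))) ⟩
  f n ℙ.+ 0ℙ
    ≡⟨ ℙₚ.+-identityʳ _ ⟩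
  f n ∎
  where open ≡-Reasoning

-- Parts larger than n cannot affect the coefficient of degree n. This gives all `partitions n` with
-- n ≤ M one common generating polynomial, as the convolution in `B-parity` demands.
regular-stable : ∀ u M n j → ⟦ regular u M (j + n) ⟧ one₂ n ≡ ⟦ regular u M n ⟧ one₂ n
regular-stable u M n zero = refl
regular-stable u M n (suc j) with u ∣? suc (j + n)
... | yes _ = regular-stable u M n j
... | no  _ = trans (geometric-high (suc (j + n)) M n _ (s≤s (ℕₚ.m≤n+m n j))) (regular-stable u M n j)

partitions-regular : ∀ u M n → n ≤ M → countℙ (noPartDivBy? u) (partitions n) ≡ ⟦ regular u M M ⟧ one₂ n
partitions-regular u M n n≤M = begin
  regularCount u n n                       ≡⟨ regularCount-regular u M n n n≤M ⟩
  ⟦ regular u M n ⟧ one₂ n                 ≡⟨ sym (regular-stable u M n (M ∸ n)) ⟩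
  ⟦ regular u M (M ∸ n + n) ⟧ one₂ n       ≡⟨ cong (λ k → ⟦ regular u M k ⟧ one₂ n) (ℕₚ.m∸n+n≡m n≤M) ⟩
  ⟦ regular u M M ⟧ one₂ n                 ∎
  where open ≡-Reasoning

convolution : Series₂ → Series₂ → Series₂
convolution f g n = Σ (suc n) (λ i → f i ℙ.* g (n ∸ i))

convolution-one₂ : ∀ g → convolution one₂ g ≗ g
convolution-one₂ g n = trans (cong (g n ℙ.+_) (Σ-0 n (λ _ → refl))) (ℙₚ.+-identityʳ (g n))

-- Together with `convolution-one₂`, this identifies the Cauchy product of two generating functions
-- with the composition of their operators.
convolution-⟦⟧ : ∀ a f g → convolution (⟦ a ⟧ f) g ≗ ⟦ a ⟧ (convolution f g)
convolution-⟦⟧ O f g n = Σ-0 (suc n) (λ _ → refl)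
convolution-⟦⟧ (q^ d) f g n = shifted d n
  where
  shifted : ∀ d n → convolution (shift d f) g n ≡ shift d (convolution f g) n
  shifted zero    n       = refl
  shifted (suc d) zero    = refl
  shifted (suc d) (suc n) = shifted d n
convolution-⟦⟧ (a ⊞ b) f g n = begin
  Σ (suc n) (λ i → (⟦ a ⟧ f i ℙ.+ ⟦ b ⟧ f i) ℙ.* g (n ∸ i))
    ≡⟨ Σ-cong (suc n) (λ i _ → ℙₚ.*-distribʳ-+ (g (n ∸ i)) (⟦ a ⟧ f i) (⟦ b ⟧ f i)) ⟩
  Σ (suc n) (λ i → (⟦ a ⟧ f i ℙ.* g (n ∸ i)) ℙ.+ (⟦ b ⟧ f i ℙ.* g (n ∸ i)))
    ≡⟨ Σ-+ (suc n) (λ i → ⟦ a ⟧ f i ℙ.* g (n ∸ i)) (λ i → ⟦ b ⟧ f i ℙ.* g (n ∸ i)) ⟩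
  convolution (⟦ a ⟧ f) g n ℙ.+ convolution (⟦ b ⟧ f) g n
    ≡⟨ cong₂ ℙ._+_ (convolution-⟦⟧ a f g n) (convolution-⟦⟧ b f g n) ⟩
  ⟦ a ⟧ (convolution f g) n ℙ.+ ⟦ b ⟧ (convolution f g) n ∎
  where open ≡-Reasoning
convolution-⟦⟧ (a ⊠ b) f g n = trans (convolution-⟦⟧ a (⟦ b ⟧ f) g n) (⟦⟧-cong a (convolution-⟦⟧ b f g) n)

B-parity : ∀ u v n → parity (B u v n) ≡ ⟦ regular u n n ⊠ regular v n n ⟧ one₂ n
B-parity u v n = begin
  countℙ R? (bipartitions n)
    ≡⟨ countℙ-concatMap R? (λ i → cartesianProduct (partitions i) (partitions (n ∸ i))) (upTo (suc n)) ⟩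
  sumOver (λ i → countℙ R? (cartesianProduct (partitions i) (partitions (n ∸ i)))) (upTo (suc n))
    ≡⟨ sumOver-applyUpTo (λ i → countℙ R? (cartesianProduct (partitions i) (partitions (n ∸ i)))) id (suc n) ⟩
  Σ (suc n) (λ i → countℙ R? (cartesianProduct (partitions i) (partitions (n ∸ i))))
    ≡⟨ Σ-cong (suc n) (λ i i<1+n → trans (countℙ-cartesianProduct (noPartDivBy? u) (noPartDivBy? v) (partitions i) (partitions (n ∸ i)))
         (cong₂ ℙ._*_ (partitions-regular u n i (ℕₚ.≤-pred i<1+n)) (partitions-regular v n (n ∸ i) (ℕₚ.m∸n≤m n i)))) ⟩
  convolution (⟦ regular u n n ⟧ one₂) (⟦ regular v n n ⟧ one₂) n
    ≡⟨ convolution-⟦⟧ (regular u n n) one₂ (⟦ regular v n n ⟧ one₂) n ⟩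
  ⟦ regular u n n ⟧ (convolution one₂ (⟦ regular v n n ⟧ one₂)) n
    ≡⟨ ⟦⟧-cong (regular u n n) (convolution-one₂ (⟦ regular v n n ⟧ one₂)) n ⟩
  ⟦ regular u n n ⟧ (⟦ regular v n n ⟧ one₂) n ∎
  where
  open ≡-Reasoning
  R? : Decidable (λ ((α , β) : List ℕ × List ℕ) → NoPartDivBy u α × NoPartDivBy v β)
  R? ab = noPartDivBy? u (proj₁ ab) ×-dec noPartDivBy? v (proj₂ ab)

-- Eta quotients mod 2.

multiples : ℕ → ℕ → Poly
multiples u zero = q^ 0
multiples u (suc k) with u ∣? suc k
... | yes _ = 1+q^ (suc k) ⊠ multiples u k
... | no  _ = multiples u k

module _ {m : ℕ} where
  open Truncated m
  open Relation.Binary.Reasoning.Setoid setoid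

  -- The factor of `euler` at each non-multiple of u cancels its geometric series, leaving the
  -- factors at multiples of u.
  regular-euler : ∀ u k → regular u m k ⊠ euler 1 k ≈ multiples u k
  regular-euler u zero = solve 0 (con 1ℙ :* con 1ℙ := con 1ℙ) ≈-refl
  regular-euler u (suc k) with u ∣? suc k
  ... | yes _ = begin
    regular u m k ⊠ (1+q^ (1 * suc k) ⊠ euler 1 k)
      ≈⟨ solve 3 (λ a b c → a :* (b :* c) := b :* (a :* c)) ≈-refl (regular u m k) (1+q^ (1 * suc k)) (euler 1 k) ⟩
    1+q^ (1 * suc k) ⊠ (regular u m k ⊠ euler 1 k)
      ≈⟨ *-cong (+-cong ≈-refl (q^-cong (ℕₚ.*-identityˡ (suc k)))) (regular-euler u k) ⟩
    1+q^ (suc k) ⊠ multiples u k ∎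
  ... | no _ = begin
    geometric (suc k) (suc m) ⊠ regular u m k ⊠ (1+q^ (1 * suc k) ⊠ euler 1 k)
      ≈⟨ solve 4 (λ g a b c → g :* a :* (b :* c) := (b :* g) :* (a :* c)) ≈-refl (geometric (suc k) (suc m)) (regular u m k) (1+q^ (1 * suc k)) (euler 1 k) ⟩
    1+q^ (1 * suc k) ⊠ geometric (suc k) (suc m) ⊠ (regular u m k ⊠ euler 1 k)
      ≈⟨ *-cong (*-cong (+-cong ≈-refl (q^-cong (ℕₚ.*-identityˡ (suc k)))) ≈-refl) (regular-euler u k) ⟩
    1+q^ (suc k) ⊠ geometric (suc k) (suc m) ⊠ multiples u k
      ≈⟨ *-cong (geometric-inverse (suc k) (s≤s z≤n)) ≈-refl ⟩
    q^ 0 ⊠ multiples u k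
      ≈⟨ solve 1 (λ a → con 1ℙ :* a := a) ≈-refl (multiples u k) ⟩
    multiples u k ∎

  -- Counting down by division with remainder: a factor appears only when the remainder reaches 0,
  -- at the multiples of u.
  multiples-euler : ∀ u j r → r < u → multiples u (r + j * u) ≈ euler u j
  multiples-euler (suc u) zero    zero    r<u = ≈-refl
  multiples-euler (suc u) (suc j) zero    r<u with suc u ∣? suc (u + j * suc u)
  ... | yes _ = *-cong (+-cong ≈-refl (q^-cong (ℕₚ.*-comm (suc j) (suc u)))) (multiples-euler (suc u) j u ℕₚ.≤-refl)
  ... | no ¬∣ = ⊥-elim (¬∣ (N.n∣m*n (suc j)))
  multiples-euler u j (suc r) r<u with u ∣? suc (r + j * u)
  ... | no _  = multiples-euler u j r (ℕₚ.<-trans (ℕₚ.n<1+n r) r<u)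
  ... | yes d = ⊥-elim (ℕₚ.<⇒≱ r<u (N.∣⇒≤ (N.∣m+n∣m⇒∣n (subst (u N.∣_) (ℕₚ.+-comm (suc r) (j * u)) d) (N.n∣m*n j))))

  regular-quotient : ∀ u → .{{NonZero u}} → regular u m m ⊠ euler 1 m ≈ euler u m
  regular-quotient u = begin
    regular u m m ⊠ euler 1 m            ≈⟨ regular-euler u m ⟩
    multiples u m                        ≈⟨ ≈-reflexive (cong (multiples u) (m≡m%n+[m/n]*n m u)) ⟩
    multiples u (m % u + m / u * u)      ≈⟨ multiples-euler u (m / u) (m % u) (m%n<n m u) ⟩
    euler u (m / u)                      ≈⟨ ≈-sym (euler-stable u (m / u) (m ∸ m / u) high) ⟩
    euler u (m ∸ m / u + m / u)          ≈⟨ ≈-reflexive (cong (euler u) (ℕₚ.m∸n+n≡m (m/n≤m m u))) ⟩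
    euler u m                            ∎
    where
    high : m < u * suc (m / u)
    high = ℕₚ.<-≤-trans (ℕₚ.≤-<-trans (ℕₚ.≤-reflexive (m≡m%n+[m/n]*n m u)) (ℕₚ.+-monoˡ-< (m / u * u) (m%n<n m u)))
      (ℕₚ.≤-reflexive (ℕₚ.*-comm (suc (m / u)) u))

  regular-8-3 : regular 8 m m ⊠ regular 3 m m ≈ etaProduct m
  regular-8-3 with euler-inverse {m} 1 (s≤s z≤n) m
  ... | r , e≈1 = begin
    a ⊠ b
      ≈⟨ solve 2 (λ a b → a :* b := a :* b :* (con 1ℙ :* con 1ℙ)) ≈-refl a b ⟩
    a ⊠ b ⊠ (q^ 0 ⊠ q^ 0)
      ≈⟨ *-cong ≈-refl (≈-sym (*-cong e≈1 e≈1)) ⟩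
    a ⊠ b ⊠ (e ⊠ r ⊠ (e ⊠ r))
      ≈⟨ solve 4 (λ a b e r → a :* b :* (e :* r :* (e :* r)) := (a :* e) :* (b :* e) :* (r :* r)) ≈-refl a b e r ⟩
    (a ⊠ e) ⊠ (b ⊠ e) ⊠ (r ⊠ r)
      -- Three Frobenius doublings make the numerator for 8 an eighth power of `e`; the denominator
      -- `e²` then leaves the sixth power that occurs in `a₂`.
      ≈⟨ *-cong (*-cong (≈-trans (regular-quotient 8) e⁸) (regular-quotient 3)) ≈-refl ⟩
    ((e ⊠ e) ⊠ (e ⊠ e)) ⊠ ((e ⊠ e) ⊠ (e ⊠ e)) ⊠ c ⊠ (r ⊠ r)
      ≈⟨ solve 3 (λ e c r → ((e :* e) :* (e :* e)) :* ((e :* e) :* (e :* e)) :* c :* (r :* r)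
            := e :* (e :* (e :* (e :* (e :* e)))) :* c :* ((e :* r) :* (e :* r))) ≈-refl e c r ⟩
    etaProduct m ⊠ (e ⊠ r ⊠ (e ⊠ r))
      ≈⟨ *-cong ≈-refl (*-cong e≈1 e≈1) ⟩
    etaProduct m ⊠ (q^ 0 ⊠ q^ 0)
      ≈⟨ solve 1 (λ a → a :* (con 1ℙ :* con 1ℙ) := a) ≈-refl (etaProduct m) ⟩
    etaProduct m ∎
    where
    e = euler 1 m
    a = regular 8 m m
    b = regular 3 m m
    c = euler 3 m
    e⁸ : euler 8 m ≈ ((e ⊠ e) ⊠ (e ⊠ e)) ⊠ ((e ⊠ e) ⊠ (e ⊠ e))
    e⁸ = ≈-trans (euler-double 4 m) (*-cong e⁴ e⁴)
      where
      e² = euler-double {m} 1 m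
      e⁴ = ≈-trans (euler-double 2 m) (*-cong e² e²)

B≡a₂ : ∀ n → parity (B 8 3 n) ≡ parityℤ (a₂ n)
B≡a₂ n = trans (B-parity 8 3 n) (trans (at regular-8-3 one₂ n ℕₚ.≤-refl) (sym (a₂-parity n)))
  where open Truncated n

-- `K` is left free because the search box of `reps (8 * n + 3)` later forces `K = suc (8 * n + 3)`.
a₂-theta : ∀ n K → n < K → parityℤ (a₂ n) ≡ ⟦ triangular 2 K ⊠ pentagonal 3 K ⟧ one₂ n
a₂-theta n K n<K = trans (a₂-parity n) (at etaProduct-theta one₂ n ℕₚ.≤-refl)
  where
  open Truncated n
  open Relation.Binary.Reasoning.Setoid setoid
  stable : ∀ t → euler (suc t) n ≈ euler (suc t) K
  stable t = ≈-trans (≈-sym (euler-stable (suc t) n (K ∸ n) (ℕₚ.m≤n*m (suc n) (suc t))))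
    (≈-reflexive (cong (euler (suc t)) (ℕₚ.m∸n+n≡m (ℕₚ.<⇒≤ n<K))))
  low : ∀ t → n < suc t * K
  low t = ℕₚ.<-≤-trans n<K (ℕₚ.m≤n*m K (suc t))
  etaProduct-theta : etaProduct n ≈ triangular 2 K ⊠ pentagonal 3 K
  etaProduct-theta = begin
    e ⊠ (e ⊠ (e ⊠ (e ⊠ (e ⊠ e)))) ⊠ euler 3 n
      ≈⟨ solve 2 (λ e c → e :* (e :* (e :* (e :* (e :* e)))) :* c := (e :* e) :* (e :* e) :* (e :* e) :* c) ≈-refl e (euler 3 n) ⟩
    e ⊠ e ⊠ (e ⊠ e) ⊠ (e ⊠ e) ⊠ euler 3 n
      ≈⟨ *-cong (*-cong (*-cong e² e²) e²) (stable 2) ⟩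
    d ⊠ d ⊠ d ⊠ euler 3 K
      ≈⟨ *-cong (euler-cubed 2 (s≤s z≤n) K (low 1)) (pentagonal-number-theorem 3 K (low 2)) ⟩
    triangular 2 K ⊠ pentagonal 3 K ∎
    where
    e = euler 1 n
    d = euler 2 K
    e² : e ⊠ e ≈ d
    e² = ≈-trans (≈-sym (euler-double 1 n)) (stable 1)

-- Counting representations mod 2

2*tri : ∀ r → 2 * tri r ≡ r * r + r
2*tri zero    = refl
2*tri (suc r) = trans (l r (tri r)) (trans (cong (λ z → suc r + suc r + z) (2*tri r)) (s r))
  where
  l : ∀ r t → 2 * (suc r + t) ≡ suc r + suc r + 2 * t
  l = solve-∀
  s : ∀ r → suc r + suc r + (r * r + r) ≡ suc r * suc r + suc r
  s = solve-∀

indicator : ∀ {P : Set} → Dec P → Parity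
indicator (yes _) = 1ℙ
indicator (no  _) = 0ℙ

indicator-no : ∀ {P : Set} (d : Dec P) → ¬ P → indicator d ≡ 0ℙ
indicator-no (yes p) ¬p = ⊥-elim (¬p p)
indicator-no (no _)  _  = refl

countℙ-sumOver : ∀ {A : Set} {P : Pred A 0ℓ} (P? : Decidable P) xs → countℙ P? xs ≡ sumOver (indicator ∘ P?) xs
countℙ-sumOver P? [] = refl
countℙ-sumOver P? (x ∷ xs) with P? x
... | yes _ = trans (ℙₚ.+-homo-+ 1 (length (filter P? xs))) (cong (1ℙ ℙ.+_) (countℙ-sumOver P? xs))
... | no  _ = countℙ-sumOver P? xs

sumOver-++ : ∀ {A : Set} (h : A → Parity) xs ys → sumOver h (xs ++ ys) ≡ sumOver h xs ℙ.+ sumOver h ys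
sumOver-++ h []       ys = refl
sumOver-++ h (x ∷ xs) ys = trans (cong (h x ℙ.+_) (sumOver-++ h xs ys)) (sym (ℙₚ.+-assoc (h x) (sumOver h xs) (sumOver h ys)))

sumOver-map : ∀ {A C : Set} (h : C → Parity) (f : A → C) xs → sumOver h (map f xs) ≡ sumOver (h ∘ f) xs
sumOver-map h f []       = refl
sumOver-map h f (x ∷ xs) = cong (h (f x) ℙ.+_) (sumOver-map h f xs)

sumOver-cartesianProduct : ∀ {A C : Set} (h : A × C → Parity) xs ys →
  sumOver h (cartesianProduct xs ys) ≡ sumOver (λ x → sumOver (λ y → h (x , y)) ys) xs
sumOver-cartesianProduct h []       ys = refl
sumOver-cartesianProduct h (x ∷ xs) ys = trans (sumOver-++ h (map (x ,_) ys) (cartesianProduct xs ys))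
  (cong₂ ℙ._+_ (sumOver-map h (x ,_) ys) (sumOver-cartesianProduct h xs ys))

sumOver-box : ∀ (h : ℕ × ℕ → Parity) m n → sumOver h (cartesianProduct (upTo m) (upTo n)) ≡ Σ m (λ x → Σ n (λ y → h (x , y)))
sumOver-box h m n = trans (sumOver-cartesianProduct h (upTo m) (upTo n))
  (trans (sumOver-applyUpTo (λ x → sumOver (λ y → h (x , y)) (upTo n)) id m)
         (Σ-cong m (λ x _ → sumOver-applyUpTo (λ y → h (x , y)) id n)))

IsRep : ℕ → ℕ × ℕ → Set
IsRep N (x , y) = 2 * (x * x) + y * y ≡ N × ¬ (3 N.∣ y)

isRep? : ∀ N → Decidable (IsRep N)
isRep? N (x , y) = (2 * (x * x) + y * y ≟ N) ×-dec ¬? (3 ∣? y)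

-- The side lengths are multiples of 4 and 6 so that the box splits into full residue classes: x =
-- 4s + 1, 4s + 3 come from the triangular exponents and y = 6r + 1, 6r + 5 from the pentagonal
-- ones.
reps : ℕ → List (ℕ × ℕ)
reps N = filter (isRep? N) (cartesianProduct (upTo (suc N * 4)) (upTo (suc N * 6)))

n≤n*n : ∀ n → n ≤ n * n
n≤n*n zero    = z≤n
n≤n*n (suc n) = ℕₚ.m≤m*n (suc n) (suc n)

∈-reps⁺ : ∀ N {v} → IsRep N v → v ∈ reps N
∈-reps⁺ N {x , y} r@(e , _) = ∈-filter⁺ (isRep? N) (∈-cartesianProduct⁺
  (∈-upTo⁺ (ℕₚ.≤-<-trans (ℕₚ.≤-trans (n≤n*n x) (ℕₚ.≤-trans (ℕₚ.m≤n*m (x * x) 2) (ℕₚ.m≤m+n (2 * (x * x)) (y * y)))) (bound 4)))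
  (∈-upTo⁺ (ℕₚ.≤-<-trans (ℕₚ.≤-trans (n≤n*n y) (ℕₚ.m≤n+m (y * y) (2 * (x * x)))) (bound 6)))) r
  where
  bound : ∀ k → .{{NonZero k}} → 2 * (x * x) + y * y < suc N * k
  bound k = ℕₚ.≤-trans (s≤s (ℕₚ.≤-reflexive e)) (ℕₚ.m≤m*n (suc N) k)

∈-reps⁻ : ∀ N {v} → v ∈ reps N → IsRep N v
∈-reps⁻ N v∈ = proj₂ (∈-filter⁻ (isRep? N) {xs = cartesianProduct (upTo (suc N * 4)) (upTo (suc N * 6))} v∈)

reps-unique : ∀ N → Unique (reps N)
reps-unique N = Uniqueₚ.filter⁺ (isRep? N) (Uniqueₚ.cartesianProduct⁺ (Uniqueₚ.upTo⁺ (suc N * 4)) (Uniqueₚ.upTo⁺ (suc N * 6)))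

Σ-residues-4 : ∀ K h → Σ (K * 4) h ≡
  Σ K (λ s → h (s * 4) ℙ.+ (h (1 + s * 4) ℙ.+ (h (2 + s * 4) ℙ.+ h (3 + s * 4))))
Σ-residues-4 zero    h = refl
Σ-residues-4 (suc K) h = trans
  (cong (λ z → h 0 ℙ.+ (h 1 ℙ.+ (h 2 ℙ.+ (h 3 ℙ.+ z)))) (Σ-residues-4 K (λ i → h (4 + i))))
  (regroup (h 0) (h 1) (h 2) (h 3) _)
  where
  regroup : ∀ a b c d e → a ℙ.+ (b ℙ.+ (c ℙ.+ (d ℙ.+ e))) ≡ (a ℙ.+ (b ℙ.+ (c ℙ.+ d))) ℙ.+ e
  regroup a b c d e rewrite ℙₚ.+-assoc a (b ℙ.+ (c ℙ.+ d)) e | ℙₚ.+-assoc b (c ℙ.+ d) e | ℙₚ.+-assoc c d e = refl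

Σ-residues-6 : ∀ K h → Σ (K * 6) h ≡
  Σ K (λ s → h (s * 6) ℙ.+ (h (1 + s * 6) ℙ.+ (h (2 + s * 6) ℙ.+ (h (3 + s * 6) ℙ.+ (h (4 + s * 6) ℙ.+ h (5 + s * 6))))))
Σ-residues-6 zero    h = refl
Σ-residues-6 (suc K) h = trans
  (cong (λ z → h 0 ℙ.+ (h 1 ℙ.+ (h 2 ℙ.+ (h 3 ℙ.+ (h 4 ℙ.+ (h 5 ℙ.+ z)))))) (Σ-residues-6 K (λ i → h (6 + i))))
  (regroup (h 0) (h 1) (h 2) (h 3) (h 4) (h 5) _)
  where
  regroup : ∀ a b c d e f g → a ℙ.+ (b ℙ.+ (c ℙ.+ (d ℙ.+ (e ℙ.+ (f ℙ.+ g))))) ≡ (a ℙ.+ (b ℙ.+ (c ℙ.+ (d ℙ.+ (e ℙ.+ f))))) ℙ.+ g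
  regroup a b c d e f g rewrite ℙₚ.+-assoc a (b ℙ.+ (c ℙ.+ (d ℙ.+ (e ℙ.+ f)))) g | ℙₚ.+-assoc b (c ℙ.+ (d ℙ.+ (e ℙ.+ f))) g
    | ℙₚ.+-assoc c (d ℙ.+ (e ℙ.+ f)) g | ℙₚ.+-assoc d (e ℙ.+ f) g | ℙₚ.+-assoc e f g = refl

theta-Σ : ∀ a b K f n → ⟦ theta a b K ⟧ f n ≡ Σ K (λ s → shift (a s) f n ℙ.+ shift (b s) f n) ℙ.+ shift (a K) f n
theta-Σ a b zero    f n = refl
theta-Σ a b (suc K) f n = begin
  ⟦ theta a b K ⟧ f n ℙ.+ (z ℙ.+ y)              ≡⟨ cong (ℙ._+ (z ℙ.+ y)) (theta-Σ a b K f n) ⟩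
  (Σ K h ℙ.+ x) ℙ.+ (z ℙ.+ y)                    ≡⟨ sym (ℙₚ.+-assoc (Σ K h ℙ.+ x) z y) ⟩
  (Σ K h ℙ.+ x ℙ.+ z) ℙ.+ y                      ≡⟨ cong (ℙ._+ y) (ℙₚ.+-assoc (Σ K h) x z) ⟩
  (Σ K h ℙ.+ h K) ℙ.+ y                          ≡⟨ cong (ℙ._+ y) (sym (Σ-last K h)) ⟩
  Σ (suc K) h ℙ.+ y                              ∎
  where
  open ≡-Reasoning
  h : ℕ → Parity
  h s = shift (a s) f n ℙ.+ shift (b s) f n
  x = shift (a K) f n
  y = shift (a (suc K)) f n
  z = shift (b K) f n

-- The unpaired last term lies above degree n, so what remains is a sum of pairs that matches the
-- residue-class sums.
theta-Σ-low : ∀ a b K f n → n < a K → ⟦ theta a b K ⟧ f n ≡ Σ K (λ s → shift (a s) f n ℙ.+ shift (b s) f n)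
theta-Σ-low a b K f n n<aK = trans (theta-Σ a b K f n) (trans (cong (S ℙ.+_) (shift-< (a K) f n n<aK)) (ℙₚ.+-identityʳ S))
  where S = Σ K (λ s → shift (a s) f n ℙ.+ shift (b s) f n)

shift-one₂-≡ : ∀ d → shift d one₂ d ≡ 1ℙ
shift-one₂-≡ zero    = refl
shift-one₂-≡ (suc d) = shift-one₂-≡ d

shift-one₂-≢ : ∀ d n → d ≢ n → shift d one₂ n ≡ 0ℙ
shift-one₂-≢ zero    zero    d≢n = ⊥-elim (d≢n refl)
shift-one₂-≢ zero    (suc n) d≢n = refl
shift-one₂-≢ (suc d) zero    d≢n = refl
shift-one₂-≢ (suc d) (suc n) d≢n = shift-one₂-≢ d n (d≢n ∘ cong suc)

even⊎odd : ∀ n → ∃ λ k → n ≡ k * 2 ⊎ n ≡ suc (k * 2)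
even⊎odd zero    = 0 , inj₁ refl
even⊎odd (suc n) with even⊎odd n
... | k , inj₁ e = k , inj₂ (cong suc e)
... | k , inj₂ e = suc k , inj₁ (cong suc e)

even≢odd : ∀ a b → a * 2 ≢ suc (b * 2)
even≢odd zero    b       ()
even≢odd (suc a) zero    ()
even≢odd (suc a) (suc b) e = even≢odd a b (ℕₚ.suc-injective (ℕₚ.suc-injective e))

module _ (n : ℕ) where

  private
    N = 8 * n + 3

    ι : ℕ → ℕ → Parity
    ι x y = indicator (isRep? N (x , y))

  ¬rep-even-y : ∀ {x y} b → y ≡ b * 2 → ¬ IsRep N (x , y)
  ¬rep-even-y {x} b refl (e , _) = even≢odd (x * x + b * (b * 2)) (4 * n + 1) (trans (l x b) (trans e (r n)))
    where
    l : ∀ x b → (x * x + b * (b * 2)) * 2 ≡ 2 * (x * x) + b * 2 * (b * 2)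
    l = solve-∀
    r : ∀ n → 8 * n + 3 ≡ suc ((4 * n + 1) * 2)
    r = solve-∀

  -- For y odd and x even, 2x² + y² is 1 mod 4, whereas 8n + 3 is 3 mod 4.
  ¬rep-even-x : ∀ {x y} a → x ≡ a * 2 → ¬ IsRep N (x , y)
  ¬rep-even-x {x} {y} a refl r@(e , _) with even⊎odd y
  ... | b , inj₁ y≡ = ¬rep-even-y {a * 2} b y≡ r
  ... | b , inj₂ refl = even≢odd (2 * (a * a) + b * b + b) (2 * n) (ℕₚ.*-cancelʳ-≡ _ _ 2 (ℕₚ.+-cancelʳ-≡ 1 _ _ (trans (l a b) (trans e (s n)))))
    where
    l : ∀ a b → (2 * (a * a) + b * b + b) * 2 * 2 + 1 ≡ 2 * (a * 2 * (a * 2)) + suc (b * 2) * suc (b * 2)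
    l = solve-∀
    s : ∀ n → 8 * n + 3 ≡ suc (2 * n * 2) * 2 + 1
    s = solve-∀

  ι-even-x : ∀ a y x → x ≡ a * 2 → ι x y ≡ 0ℙ
  ι-even-x a y x e = indicator-no (isRep? N (x , y)) (¬rep-even-x a e)

  ι-even-y : ∀ x b y → y ≡ b * 2 → ι x y ≡ 0ℙ
  ι-even-y x b y e = indicator-no (isRep? N (x , y)) (¬rep-even-y {x} b e)

  ι-3∣y : ∀ x b y → y ≡ b * 3 → ι x y ≡ 0ℙ
  ι-3∣y x b y e = indicator-no (isRep? N (x , y)) (λ r → proj₂ r (N.divides b e))

  ι-odd : ∀ d x y → 8 * d + 3 ≡ 2 * (x * x) + y * y → ¬ (3 N.∣ y) → shift d one₂ n ≡ ι x y
  ι-odd d x y e 3∤y with isRep? N (x , y)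
  ... | yes (e′ , _) = trans (cong (λ k → shift k one₂ n) (ℕₚ.*-cancelˡ-≡ d n 8 (ℕₚ.+-cancelʳ-≡ 3 _ _ (trans e e′)))) (shift-one₂-≡ n)
  ... | no ¬r = shift-one₂-≢ d n (λ { refl → ¬r (sym e , 3∤y) })

  module _ (K : ℕ) (n<K : n < K) where
    open ≡-Reasoning

    private
      a b : ℕ → ℕ
      a r = 3 * pent⁺ r
      b r = 3 * pent⁻ r

      square⁺ : ∀ r → 8 * a r + 1 ≡ (1 + r * 6) * (1 + r * 6)
      square⁺ r = trans (l r (tri r)) (trans (cong (λ z → 24 * (r * r) + 12 * z + 1) (2*tri r)) (s r))
        where
        l : ∀ r t → 8 * (3 * (r * r + t)) + 1 ≡ 24 * (r * r) + 12 * (2 * t) + 1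
        l = solve-∀
        s : ∀ r → 24 * (r * r) + 12 * (r * r + r) + 1 ≡ (1 + r * 6) * (1 + r * 6)
        s = solve-∀

      square⁻ : ∀ r → 8 * b r + 1 ≡ (5 + r * 6) * (5 + r * 6)
      square⁻ r = trans (l r (tri r)) (trans (cong (λ z → 24 * (suc r * suc r) + 12 * z + 1) (2*tri r)) (s r))
        where
        l : ∀ r t → 8 * (3 * (suc r * suc r + t)) + 1 ≡ 24 * (suc r * suc r) + 12 * (2 * t) + 1
        l = solve-∀
        s : ∀ r → 24 * (suc r * suc r) + 12 * (r * r + r) + 1 ≡ (5 + r * 6) * (5 + r * 6)
        s = solve-∀

      norm-sum : ∀ c d x y → 8 * c + 1 ≡ y * y → 8 * d + 2 ≡ 2 * (x * x) → 8 * (c + d) + 3 ≡ 2 * (x * x) + y * y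
      norm-sum c d x y e e′ = trans (l c d) (cong₂ _+_ e′ e)
        where
        l : ∀ c d → 8 * (c + d) + 3 ≡ 8 * d + 2 + (8 * c + 1)
        l = solve-∀

      3∤ : ∀ i r → ¬ (3 N.∣ i) → ¬ (3 N.∣ i + r * 6)
      3∤ i r 3∤i d = 3∤i (N.∣m+n∣m⇒∣n (subst (3 N.∣_) (ℕₚ.+-comm i (r * 6)) d) (N.∣n⇒∣m*n r (N.divides 2 refl)))

    -- For a fixed x, the pentagonal exponents 3e run through y = 6r + 1 and 6r + 5 via 8·3e + 1 =
    -- y². The other residues of y mod 6 are even or divisible by 3 and contribute 0.
    theta-row : ∀ d x → 8 * d + 2 ≡ 2 * (x * x) → shift d (⟦ pentagonal 3 K ⟧ one₂) n ≡ Σ (K * 6) (ι x)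
    theta-row d x e = begin
      shift d (⟦ pentagonal 3 K ⟧ one₂) n
        ≡⟨ sym (⟦⟧-shift (pentagonal 3 K) d one₂ n) ⟩
      ⟦ pentagonal 3 K ⟧ (shift d one₂) n
        ≡⟨ theta-Σ-low a b K (shift d one₂) n (ℕₚ.<-≤-trans n<K (ℕₚ.≤-trans (n≤n*n K) (ℕₚ.≤-trans (ℕₚ.m≤m+n (K * K) (tri K)) (ℕₚ.m≤n*m (pent⁺ K) 3)))) ⟩
      Σ K (λ r → shift (a r) (shift d one₂) n ℙ.+ shift (b r) (shift d one₂) n)
        ≡⟨ Σ-cong K (λ r _ → terms r) ⟩
      Σ K (λ r → ι x (r * 6) ℙ.+ (ι x (1 + r * 6) ℙ.+ (ι x (2 + r * 6) ℙ.+ (ι x (3 + r * 6) ℙ.+ (ι x (4 + r * 6) ℙ.+ ι x (5 + r * 6))))))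
        ≡⟨ sym (Σ-residues-6 K (ι x)) ⟩
      Σ (K * 6) (ι x) ∎
      where
      term : ∀ c y → 8 * c + 1 ≡ y * y → ¬ (3 N.∣ y) → shift c (shift d one₂) n ≡ ι x y
      term c y e′ 3∤y = trans (sym (shift-+ c d one₂ n)) (ι-odd (c + d) x y (norm-sum c d x y e′ e) 3∤y)
      terms : ∀ r → shift (a r) (shift d one₂) n ℙ.+ shift (b r) (shift d one₂) n ≡
        ι x (r * 6) ℙ.+ (ι x (1 + r * 6) ℙ.+ (ι x (2 + r * 6) ℙ.+ (ι x (3 + r * 6) ℙ.+ (ι x (4 + r * 6) ℙ.+ ι x (5 + r * 6)))))
      terms r
        rewrite ι-3∣y x (r * 2) (r * 6) (sym (ℕₚ.*-assoc r 2 3))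
              | ι-even-y x (1 + r * 3) (2 + r * 6) (cong (λ z → 2 + z) (sym (ℕₚ.*-assoc r 3 2)))
              | ι-3∣y x (1 + r * 2) (3 + r * 6) (cong (λ z → 3 + z) (sym (ℕₚ.*-assoc r 2 3)))
              | ι-even-y x (2 + r * 3) (4 + r * 6) (cong (λ z → 4 + z) (sym (ℕₚ.*-assoc r 3 2)))
        = cong₂ ℙ._+_ (term (a r) (1 + r * 6) (square⁺ r) (3∤ 1 r (λ d → N.>⇒∤ (s≤s (s≤s z≤n)) d)))
                      (term (b r) (5 + r * 6) (square⁻ r) (3∤ 5 r (λ d → N.>⇒∤ {2} {3} (s≤s (s≤s (s≤s z≤n))) (N.∣m+n∣m⇒∣n {3} {3} {2} d N.∣-refl))))

    theta-reps : ⟦ triangular 2 K ⊠ pentagonal 3 K ⟧ one₂ n ≡ Σ (K * 4) (λ x → Σ (K * 6) (ι x))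
    theta-reps = begin
      ⟦ triangular 2 K ⟧ f n
        ≡⟨ theta-Σ-low (λ s → 2 * tri⁺ s) (λ s → 2 * tri⁻ s) K f n (ℕₚ.<-≤-trans n<K (ℕₚ.≤-trans (ℕₚ.m≤m*n K (suc (K * 2))) (ℕₚ.m≤n*m (tri⁺ K) 2))) ⟩
      Σ K (λ s → shift (2 * tri⁺ s) f n ℙ.+ shift (2 * tri⁻ s) f n)
        ≡⟨ Σ-cong K (λ s _ → terms s) ⟩
      Σ K (λ s → h (s * 4) ℙ.+ (h (1 + s * 4) ℙ.+ (h (2 + s * 4) ℙ.+ h (3 + s * 4))))
        ≡⟨ sym (Σ-residues-4 K h) ⟩
      Σ (K * 4) h ∎
      where
      f = ⟦ pentagonal 3 K ⟧ one₂
      h : ℕ → Parity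
      h x = Σ (K * 6) (ι x)
      h-even : ∀ a x → x ≡ a * 2 → h x ≡ 0ℙ
      h-even a x e = Σ-0 (K * 6) (λ y → ι-even-x a y x e)
      e₁ : ∀ s → 8 * (2 * (s * suc (s * 2))) + 2 ≡ 2 * ((1 + s * 4) * (1 + s * 4))
      e₁ = solve-∀
      e₃ : ∀ s → 8 * (2 * (suc s * suc (s * 2))) + 2 ≡ 2 * ((3 + s * 4) * (3 + s * 4))
      e₃ = solve-∀
      terms : ∀ s → shift (2 * tri⁺ s) f n ℙ.+ shift (2 * tri⁻ s) f n ≡ h (s * 4) ℙ.+ (h (1 + s * 4) ℙ.+ (h (2 + s * 4) ℙ.+ h (3 + s * 4)))
      terms s rewrite h-even (s * 2) (s * 4) (sym (ℕₚ.*-assoc s 2 2)) | h-even (1 + s * 2) (2 + s * 4) (cong (λ z → 2 + z) (sym (ℕₚ.*-assoc s 2 2)))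
        = cong₂ ℙ._+_ (theta-row (2 * tri⁺ s) (1 + s * 4) (e₁ s)) (theta-row (2 * tri⁻ s) (3 + s * 4) (e₃ s))

  a₂-reps : parityℤ (a₂ n) ≡ parity (length (reps (8 * n + 3)))
  a₂-reps = begin
    parityℤ (a₂ n)                                            ≡⟨ a₂-theta n K n<K ⟩
    ⟦ triangular 2 K ⊠ pentagonal 3 K ⟧ one₂ n                ≡⟨ theta-reps K n<K ⟩
    Σ (K * 4) (λ x → Σ (K * 6) (ι x))                         ≡⟨ sym (sumOver-box (indicator ∘ isRep? N) (K * 4) (K * 6)) ⟩
    sumOver (indicator ∘ isRep? N) box                        ≡⟨ sym (countℙ-sumOver (isRep? N) box) ⟩
    parity (length (reps (8 * n + 3)))                        ∎
    where
    open ≡-Reasoning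
    K = suc N
    box = cartesianProduct (upTo (K * 4)) (upTo (K * 6))
    n<K : n < K
    n<K = s≤s (ℕₚ.≤-trans (ℕₚ.m≤n*m n 8) (ℕₚ.m≤m+n (8 * n) 3))

-- Counting by bijections and involutions.

Unique-resp-↭ : ∀ {A : Set} {xs ys : List A} → xs ↭ ys → Unique xs → Unique ys
Unique-resp-↭ {A} p = Permutationₛ.Unique-resp-↭ (≡.setoid A) (↭⇒↭ₛ p)

extract : ∀ {A : Set} {x : A} {xs} → x ∈ xs → ∃ λ xs′ → xs ↭ x ∷ xs′
extract {x = x} x∈xs with ∈-∃++ x∈xs
... | ys , zs , refl = ys ++ zs , ↭ₚ.shift x ys zs

fresh : ∀ {A : Set} {x : A} {xs} → Unique (x ∷ xs) → ∀ {y} → y ∈ xs → x ≢ y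
fresh (x≢ AllPairs.∷ _) y∈xs = All.lookup x≢ y∈xs

-- Stated for a relation because the maps needed later are given by lifts to ℤ[√-2] and are
-- single-valued only after passing to absolute values.
length-bijection : ∀ {A C : Set} (R : A → C → Set) →
  (∀ {a c c′} → R a c → R a c′ → c ≡ c′) → (∀ {a a′ c} → R a c → R a′ c → a ≡ a′) →
  ∀ xs ys → Unique xs → Unique ys →
  (∀ {a} → a ∈ xs → ∃ λ c → c ∈ ys × R a c) → (∀ {c} → c ∈ ys → ∃ λ a → a ∈ xs × R a c) →
  length xs ≡ length ys
length-bijection R fun inj [] [] ux uy to from = refl
length-bijection R fun inj [] (c ∷ ys) ux uy to from with from (here refl)
... | _ , () , _
length-bijection R fun inj (a ∷ xs) ys ux@(_ AllPairs.∷ ux′) uy to from with to (here refl)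
... | c , c∈ys , Rac with extract c∈ys
...   | ys′ , ys↭ = trans (cong suc (length-bijection R fun inj xs ys′ ux′ uy′ to′ from′)) (sym (↭ₚ.↭-length ys↭))
  where
  uy″ : Unique (c ∷ ys′)
  uy″ = Unique-resp-↭ ys↭ uy
  uy′ : Unique ys′
  uy′ = AllPairs.tail uy″
  to′ : ∀ {a′} → a′ ∈ xs → ∃ λ c′ → c′ ∈ ys′ × R a′ c′
  to′ a′∈ with to (there a′∈)
  ... | c′ , c′∈ , r with ↭ₚ.∈-resp-↭ ys↭ c′∈
  ...   | here refl = ⊥-elim (fresh ux a′∈ (inj Rac r))
  ...   | there p   = c′ , p , r
  from′ : ∀ {c′} → c′ ∈ ys′ → ∃ λ a′ → a′ ∈ xs × R a′ c′
  from′ c′∈ with from (↭ₚ.∈-resp-↭ (↭-sym ys↭) (there c′∈))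
  ... | _ , here refl , r = ⊥-elim (fresh uy″ c′∈ (fun Rac r))
  ... | a′ , there p , r  = a′ , p , r

module _ {A : Set} (R : A → A → Set) (R-sym : ∀ {a b} → R a b → R b a) (fun : ∀ {a b b′} → R a b → R a b′ → b ≡ b′) where

  -- Elements are removed together with their partners. The bound `k` is fuel, since the remaining
  -- list `ys` is not a structural sublist.
  involution-even : ∀ k xs → length xs ≤ k → Unique xs → (∀ {a} → a ∈ xs → ¬ R a a) →
    (∀ {a} → a ∈ xs → ∃ λ b → b ∈ xs × R a b) → parity (length xs) ≡ 0ℙ
  involution-even k [] _ ux irr to = refl
  involution-even (suc k) (a ∷ xs) (s≤s len) ux irr to with to (here refl)
  ... | _ , here refl , r = ⊥-elim (irr (here refl) r)
  ... | b , there b∈xs , Rab with extract b∈xs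
  ...   | ys , xs↭ = trans (cong (parity ∘ suc) (↭ₚ.↭-length xs↭)) (involution-even k ys len′ (AllPairs.tail uby) irr′ to′)
    where
    uby : Unique (b ∷ ys)
    uby = Unique-resp-↭ xs↭ (AllPairs.tail ux)
    len′ : length ys ≤ k
    len′ = ℕₚ.≤-trans (ℕₚ.n≤1+n (length ys)) (ℕₚ.≤-trans (ℕₚ.≤-reflexive (sym (↭ₚ.↭-length xs↭))) len)
    back : ∀ {c} → c ∈ ys → c ∈ xs
    back c∈ = ↭ₚ.∈-resp-↭ (↭-sym xs↭) (there c∈)
    irr′ : ∀ {c} → c ∈ ys → ¬ R c c
    irr′ c∈ = irr (there (back c∈))
    to′ : ∀ {c} → c ∈ ys → ∃ λ d → d ∈ ys × R c d
    to′ c∈ with to (there (back c∈))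
    ... | _ , here refl , r = ⊥-elim (fresh uby c∈ (fun Rab (R-sym r)))
    ... | d , there d∈ , r with ↭ₚ.∈-resp-↭ xs↭ d∈
    ...   | here refl = ⊥-elim (fresh ux (back c∈) (fun (R-sym Rab) (R-sym r)))
    ...   | there p   = d , p , r

  involution-odd : ∀ xs a₀ → a₀ ∈ xs → Unique xs → R a₀ a₀ → (∀ {a} → a ∈ xs → R a a → a₀ ≡ a) →
    (∀ {a} → a ∈ xs → ∃ λ b → b ∈ xs × R a b) → parity (length xs) ≡ 1ℙ
  involution-odd xs a₀ a₀∈ ux R₀ fix to with extract a₀∈
  ... | ys , xs↭ = trans (cong parity (↭ₚ.↭-length xs↭)) (trans (ℙₚ.+-homo-+ 1 (length ys))
      (cong (1ℙ ℙ.+_) (involution-even (length ys) ys ℕₚ.≤-refl (AllPairs.tail u) (λ a∈ r → fresh u a∈ (fix (back a∈) r)) to′)))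
    where
    u : Unique (a₀ ∷ ys)
    u = Unique-resp-↭ xs↭ ux
    back : ∀ {c} → c ∈ ys → c ∈ xs
    back c∈ = ↭ₚ.∈-resp-↭ (↭-sym xs↭) (there c∈)
    to′ : ∀ {c} → c ∈ ys → ∃ λ d → d ∈ ys × R c d
    to′ c∈ with to (back c∈)
    ... | d , d∈ , r with ↭ₚ.∈-resp-↭ xs↭ d∈
    ...   | here refl = ⊥-elim (fresh u c∈ (fun R₀ (R-sym r)))
    ...   | there p   = d , p , r

-- The ring ℤ[√-2]

-- ⟨ x , y ⟩ stands for y + x√-2; a data type, so that products do not unfold during unification.
data ℤ[√-2] : Set where
  ⟨_,_⟩ : ℤ → ℤ → ℤ[√-2]

coeff : ℤ[√-2] → ℤ × ℤ
coeff ⟨ x , y ⟩ = x , y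

infixl 7 _·_
_·_ : ℤ[√-2] → ℤ[√-2] → ℤ[√-2]
⟨ x , y ⟩ · ⟨ x′ , y′ ⟩ = ⟨ x ℤ.* y′ ℤ.+ y ℤ.* x′ , y ℤ.* y′ ℤ.- + 2 ℤ.* (x ℤ.* x′) ⟩

conj neg : ℤ[√-2] → ℤ[√-2]
conj ⟨ x , y ⟩ = ⟨ - x , y ⟩
neg  ⟨ x , y ⟩ = ⟨ - x , - y ⟩

norm : ℤ[√-2] → ℤ
norm ⟨ x , y ⟩ = + 2 ℤ.* (x ℤ.* x) ℤ.+ y ℤ.* y

scale : ℤ → ℤ[√-2] → ℤ[√-2]
scale c ⟨ x , y ⟩ = ⟨ c ℤ.* x , c ℤ.* y ⟩

abs : ℤ[√-2] → ℕ × ℕ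
abs ⟨ x , y ⟩ = ∣ x ∣ , ∣ y ∣

pair-≡ : ∀ {x x′ y y′ : ℤ} → x ≡ x′ → y ≡ y′ → ⟨ x , y ⟩ ≡ ⟨ x′ , y′ ⟩
pair-≡ = cong₂ ⟨_,_⟩

norm-· : ∀ u v → norm (u · v) ≡ norm u ℤ.* norm v
norm-· ⟨ x , y ⟩ ⟨ x′ , y′ ⟩ = l x y x′ y′
  where
  l : ∀ x y x′ y′ → + 2 ℤ.* ((x ℤ.* y′ ℤ.+ y ℤ.* x′) ℤ.* (x ℤ.* y′ ℤ.+ y ℤ.* x′)) ℤ.+ (y ℤ.* y′ ℤ.- + 2 ℤ.* (x ℤ.* x′)) ℤ.* (y ℤ.* y′ ℤ.- + 2 ℤ.* (x ℤ.* x′))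
    ≡ (+ 2 ℤ.* (x ℤ.* x) ℤ.+ y ℤ.* y) ℤ.* (+ 2 ℤ.* (x′ ℤ.* x′) ℤ.+ y′ ℤ.* y′)
  l = ℤSolver.solve-∀

norm-conj : ∀ u → norm (conj u) ≡ norm u
norm-conj ⟨ x , y ⟩ = l x y
  where
  l : ∀ x y → + 2 ℤ.* (- x ℤ.* - x) ℤ.+ y ℤ.* y ≡ + 2 ℤ.* (x ℤ.* x) ℤ.+ y ℤ.* y
  l = ℤSolver.solve-∀

conj-conj : ∀ u → conj (conj u) ≡ u
conj-conj ⟨ x , y ⟩ = pair-≡ (ℤₚ.neg-involutive x) refl

conj-neg : ∀ u → conj (neg u) ≡ neg (conj u)
conj-neg ⟨ x , y ⟩ = refl

neg-neg : ∀ u → neg (neg u) ≡ u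
neg-neg ⟨ x , y ⟩ = pair-≡ (ℤₚ.neg-involutive x) (ℤₚ.neg-involutive y)

conj-· : ∀ u v → conj (u · v) ≡ conj u · conj v
conj-· ⟨ x , y ⟩ ⟨ x′ , y′ ⟩ = pair-≡ (l x y x′ y′) (r x y x′ y′)
  where
  l : ∀ x y x′ y′ → - (x ℤ.* y′ ℤ.+ y ℤ.* x′) ≡ - x ℤ.* y′ ℤ.+ y ℤ.* - x′
  l = ℤSolver.solve-∀
  r : ∀ x y x′ y′ → y ℤ.* y′ ℤ.- + 2 ℤ.* (x ℤ.* x′) ≡ y ℤ.* y′ ℤ.- + 2 ℤ.* (- x ℤ.* - x′)
  r = ℤSolver.solve-∀

·-neg : ∀ u v → u · neg v ≡ neg (u · v)
·-neg ⟨ x , y ⟩ ⟨ x′ , y′ ⟩ = pair-≡ (l x y x′ y′) (r x y x′ y′)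
  where
  l : ∀ x y x′ y′ → x ℤ.* - y′ ℤ.+ y ℤ.* - x′ ≡ - (x ℤ.* y′ ℤ.+ y ℤ.* x′)
  l = ℤSolver.solve-∀
  r : ∀ x y x′ y′ → y ℤ.* - y′ ℤ.- + 2 ℤ.* (x ℤ.* - x′) ≡ - (y ℤ.* y′ ℤ.- + 2 ℤ.* (x ℤ.* x′))
  r = ℤSolver.solve-∀

·-conj : ∀ π w → conj π · (π · w) ≡ scale (norm π) w
·-conj ⟨ b , a ⟩ ⟨ x , y ⟩ = pair-≡ (l a b x y) (r a b x y)
  where
  l : ∀ a b x y → - b ℤ.* (a ℤ.* y ℤ.- + 2 ℤ.* (b ℤ.* x)) ℤ.+ a ℤ.* (b ℤ.* y ℤ.+ a ℤ.* x) ≡ (+ 2 ℤ.* (b ℤ.* b) ℤ.+ a ℤ.* a) ℤ.* x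
  l = ℤSolver.solve-∀
  r : ∀ a b x y → a ℤ.* (a ℤ.* y ℤ.- + 2 ℤ.* (b ℤ.* x)) ℤ.- + 2 ℤ.* (- b ℤ.* (b ℤ.* y ℤ.+ a ℤ.* x)) ≡ (+ 2 ℤ.* (b ℤ.* b) ℤ.+ a ℤ.* a) ℤ.* y
  r = ℤSolver.solve-∀

scale-cancel : ∀ c .{{_ : ℤ.NonZero c}} u v → scale c u ≡ scale c v → u ≡ v
scale-cancel c ⟨ x , y ⟩ ⟨ x′ , y′ ⟩ e = pair-≡ (ℤₚ.*-cancelˡ-≡ c x x′ (cong (proj₁ ∘ coeff) e)) (ℤₚ.*-cancelˡ-≡ c y y′ (cong (proj₂ ∘ coeff) e))

·-cancel : ∀ π .{{_ : ℤ.NonZero (norm π)}} u v → π · u ≡ π · v → u ≡ v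
·-cancel π u v e = scale-cancel (norm π) u v (trans (sym (·-conj π u)) (trans (cong (conj π ·_) e) (·-conj π v)))

abs-neg : ∀ u → abs (neg u) ≡ abs u
abs-neg ⟨ x , y ⟩ = cong₂ _,_ (ℤₚ.∣-i∣≡∣i∣ x) (ℤₚ.∣-i∣≡∣i∣ y)

abs-conj : ∀ u → abs (conj u) ≡ abs u
abs-conj ⟨ x , y ⟩ = cong (_, ∣ y ∣) (ℤₚ.∣-i∣≡∣i∣ x)

∣i∣≡∣j∣⇒i≡±j : ∀ i j → ∣ i ∣ ≡ ∣ j ∣ → i ≡ j ⊎ i ≡ - j
∣i∣≡∣j∣⇒i≡±j (+ m)        (+ .m)       refl = inj₁ refl
∣i∣≡∣j∣⇒i≡±j (+ .(suc n)) ℤ.-[1+ n ]   refl = inj₂ refl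
∣i∣≡∣j∣⇒i≡±j ℤ.-[1+ m ]   (+ .(suc m)) refl = inj₂ refl
∣i∣≡∣j∣⇒i≡±j ℤ.-[1+ m ]   ℤ.-[1+ .m ]  refl = inj₁ refl

abs-≡ : ∀ u v → abs u ≡ abs v → (v ≡ u ⊎ v ≡ neg u) ⊎ (v ≡ conj u ⊎ v ≡ neg (conj u))
abs-≡ ⟨ x , y ⟩ ⟨ x′ , y′ ⟩ e with ∣i∣≡∣j∣⇒i≡±j x′ x (sym (cong proj₁ e)) | ∣i∣≡∣j∣⇒i≡±j y′ y (sym (cong proj₂ e))
... | inj₁ refl | inj₁ refl = inj₁ (inj₁ refl)
... | inj₂ refl | inj₂ refl = inj₁ (inj₂ refl)
... | inj₂ refl | inj₁ refl = inj₂ (inj₁ refl)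
... | inj₁ refl | inj₂ refl = inj₂ (inj₂ (pair-≡ (sym (ℤₚ.neg-involutive x)) refl))

∣i∣²≡i² : ∀ i → + (∣ i ∣ * ∣ i ∣) ≡ i ℤ.* i
∣i∣²≡i² (+ n)        = ℤₚ.pos-* n n
∣i∣²≡i² (ℤ.-[1+ n ]) = refl

norm-abs : ∀ x y → + (2 * (∣ x ∣ * ∣ x ∣) + ∣ y ∣ * ∣ y ∣) ≡ norm ⟨ x , y ⟩
norm-abs x y = trans (ℤₚ.pos-+ (2 * (∣ x ∣ * ∣ x ∣)) (∣ y ∣ * ∣ y ∣))
  (cong₂ ℤ._+_ (trans (ℤₚ.pos-* 2 (∣ x ∣ * ∣ x ∣)) (cong (+ 2 ℤ.*_) (∣i∣²≡i² x))) (∣i∣²≡i² y))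

norm≡⇒ℕ : ∀ u N → norm u ≡ + N → 2 * (proj₁ (abs u) * proj₁ (abs u)) + proj₂ (abs u) * proj₂ (abs u) ≡ N
norm≡⇒ℕ ⟨ x , y ⟩ N e = ℤₚ.+-injective (trans (norm-abs x y) e)

ℕ⇒norm≡ : ∀ u N → 2 * (proj₁ (abs u) * proj₁ (abs u)) + proj₂ (abs u) * proj₂ (abs u) ≡ N → norm u ≡ + N
ℕ⇒norm≡ ⟨ x , y ⟩ N e = trans (sym (norm-abs x y)) (cong +_ e)

prime-∣-* : ∀ {p} → Prime p → ∀ i j → + p S.∣ i ℤ.* j → + p S.∣ i ⊎ + p S.∣ j
prime-∣-* {p} pp i j d with euclidsLemma ∣ i ∣ ∣ j ∣ pp (subst (p N.∣_) (ℤₚ.abs-* i j) (S.∣⇒∣ᵤ d))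
... | inj₁ e = inj₁ (S.∣ᵤ⇒∣ e)
... | inj₂ e = inj₂ (S.∣ᵤ⇒∣ e)

prime-∣-square : ∀ {p} → Prime p → ∀ i → + p S.∣ i ℤ.* i → + p S.∣ i
prime-∣-square pp i d with prime-∣-* pp i i d
... | inj₁ e = e
... | inj₂ e = e

lift : ℕ × ℕ → ℤ[√-2]
lift (x , y) = ⟨ + x , + y ⟩

·-scale : ∀ u c v → u · scale c v ≡ scale c (u · v)
·-scale ⟨ x , y ⟩ c ⟨ x′ , y′ ⟩ = pair-≡ (l x y x′ y′ c) (r x y x′ y′ c)
  where
  l : ∀ x y x′ y′ c → x ℤ.* (c ℤ.* y′) ℤ.+ y ℤ.* (c ℤ.* x′) ≡ c ℤ.* (x ℤ.* y′ ℤ.+ y ℤ.* x′)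
  l = ℤSolver.solve-∀
  r : ∀ x y x′ y′ c → y ℤ.* (c ℤ.* y′) ℤ.- + 2 ℤ.* (x ℤ.* (c ℤ.* x′)) ≡ c ℤ.* (y ℤ.* y′ ℤ.- + 2 ℤ.* (x ℤ.* x′))
  r = ℤSolver.solve-∀

lift-norm : ∀ {N} m → IsRep N m → norm (lift m) ≡ + N
lift-norm {N} m (e , _) = ℕ⇒norm≡ (lift m) N e

-- A prime ℓ = a² + 2b², with π = a + b√-2.
module Split (ℓ : ℕ) (ℓ-prime : Prime ℓ) (ℓ∤2 : ¬ (ℓ N.∣ 2)) (b a : ℤ) (split : norm ⟨ b , a ⟩ ≡ + ℓ) where

  π : ℤ[√-2]
  π = ⟨ b , a ⟩

  instance
    ℓ-nonZero : ℤ.NonZero (+ ℓ)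
    ℓ-nonZero = prime⇒nonZero ℓ-prime

    norm-π-nonZero : ℤ.NonZero (norm π)
    norm-π-nonZero = subst ℤ.NonZero (sym split) ℓ-nonZero

  -- If ℓ divided one of a and b it would divide both, and then ℓ² would divide a² + 2b² = ℓ.
  ℓ∤a×ℓ∤b : ¬ (+ ℓ S.∣ a) × ¬ (+ ℓ S.∣ b)
  ℓ∤a×ℓ∤b = (λ ℓ∣a → contra ℓ∣a (b-from-a ℓ∣a)) , (λ ℓ∣b → contra (a-from-b ℓ∣b) ℓ∣b)
    where
    2b²+a² : + ℓ S.∣ + 2 ℤ.* (b ℤ.* b) ℤ.+ a ℤ.* a
    2b²+a² = S.divides (+ 1) (trans split (sym (ℤₚ.*-identityˡ (+ ℓ))))
    b-from-a : + ℓ S.∣ a → + ℓ S.∣ b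
    b-from-a d with prime-∣-* ℓ-prime (+ 2) (b ℤ.* b) (S.∣m+n∣n⇒∣m 2b²+a² (S.∣m⇒∣m*n a d))
    ... | inj₁ e = ⊥-elim (ℓ∤2 (S.∣⇒∣ᵤ e))
    ... | inj₂ e = prime-∣-square ℓ-prime b e
    a-from-b : + ℓ S.∣ b → + ℓ S.∣ a
    a-from-b d = prime-∣-square ℓ-prime a (S.∣m+n∣m⇒∣n {m = + 2 ℤ.* (b ℤ.* b)} 2b²+a² (S.∣n⇒∣m*n (+ 2) (S.∣m⇒∣m*n b d)))
    contra : + ℓ S.∣ a → + ℓ S.∣ b → ⊥
    contra (S.divides c refl) (S.divides d refl) = ℕ.nonTrivial⇒≢1 {{prime⇒nonTrivial ℓ-prime}} (N.∣1⇒≡1 (S.∣⇒∣ᵤ (S.divides {+ ℓ} {+ 1} (+ 2 ℤ.* (d ℤ.* d) ℤ.+ c ℤ.* c)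
      (ℤₚ.*-cancelˡ-≡ (+ ℓ) (+ 1) _ (trans (ℤₚ.*-identityʳ (+ ℓ)) (trans (sym split) (l c d (+ ℓ))))))))
      where
      l : ∀ c d k → + 2 ℤ.* (d ℤ.* k ℤ.* (d ℤ.* k)) ℤ.+ c ℤ.* k ℤ.* (c ℤ.* k) ≡ k ℤ.* ((+ 2 ℤ.* (d ℤ.* d) ℤ.+ c ℤ.* c) ℤ.* k)
      l = ℤSolver.solve-∀

  -- The product of `conj π` with y + x√-2 has coordinates ax - by and ay + 2bx; dividing both by ℓ
  -- gives the quotient. One divisibility suffices, since b(ay + 2bx) = ℓx - a(ax - by) and ℓ ∤ b.
  factor : ∀ x y → + ℓ S.∣ a ℤ.* x ℤ.- b ℤ.* y → ∃ λ w → ⟨ x , y ⟩ ≡ π · w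
  factor x y ℓ∣₁@(S.divides w₁ e₁) = from (prime-∣-* ℓ-prime b (a ℤ.* y ℤ.+ + 2 ℤ.* (b ℤ.* x)) ℓ∣b*)
    where
    l : ∀ a b x y → (+ 2 ℤ.* (b ℤ.* b) ℤ.+ a ℤ.* a) ℤ.* x ℤ.- a ℤ.* (a ℤ.* x ℤ.- b ℤ.* y) ≡ b ℤ.* (a ℤ.* y ℤ.+ + 2 ℤ.* (b ℤ.* x))
    l = ℤSolver.solve-∀
    ℓ∣b* : + ℓ S.∣ b ℤ.* (a ℤ.* y ℤ.+ + 2 ℤ.* (b ℤ.* x))
    ℓ∣b* = subst (+ ℓ S.∣_) (l a b x y) (S.∣m∣n⇒∣m-n
      (subst (λ z → + ℓ S.∣ z ℤ.* x) (sym split) (S.∣m⇒∣m*n x S.∣-refl)) (S.∣n⇒∣m*n a ℓ∣₁))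
    l₁ : ∀ a b x y → (+ 2 ℤ.* (b ℤ.* b) ℤ.+ a ℤ.* a) ℤ.* x ≡ b ℤ.* (a ℤ.* y ℤ.+ + 2 ℤ.* (b ℤ.* x)) ℤ.+ a ℤ.* (a ℤ.* x ℤ.- b ℤ.* y)
    l₁ = ℤSolver.solve-∀
    r₁ : ∀ a b w₁ w₂ k → b ℤ.* (w₂ ℤ.* k) ℤ.+ a ℤ.* (w₁ ℤ.* k) ≡ k ℤ.* (b ℤ.* w₂ ℤ.+ a ℤ.* w₁)
    r₁ = ℤSolver.solve-∀
    l₂ : ∀ a b x y → (+ 2 ℤ.* (b ℤ.* b) ℤ.+ a ℤ.* a) ℤ.* y ≡ a ℤ.* (a ℤ.* y ℤ.+ + 2 ℤ.* (b ℤ.* x)) ℤ.- + 2 ℤ.* (b ℤ.* (a ℤ.* x ℤ.- b ℤ.* y))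
    l₂ = ℤSolver.solve-∀
    r₂ : ∀ a b w₁ w₂ k → a ℤ.* (w₂ ℤ.* k) ℤ.- + 2 ℤ.* (b ℤ.* (w₁ ℤ.* k)) ≡ k ℤ.* (a ℤ.* w₂ ℤ.- + 2 ℤ.* (b ℤ.* w₁))
    r₂ = ℤSolver.solve-∀
    from : + ℓ S.∣ b ⊎ + ℓ S.∣ a ℤ.* y ℤ.+ + 2 ℤ.* (b ℤ.* x) → ∃ λ w → ⟨ x , y ⟩ ≡ π · w
    from (inj₁ ℓ∣b) = ⊥-elim (proj₂ ℓ∤a×ℓ∤b ℓ∣b)
    from (inj₂ (S.divides w₂ e₂)) = ⟨ w₁ , w₂ ⟩ , pair-≡
      (ℤₚ.*-cancelˡ-≡ (+ ℓ) x (b ℤ.* w₂ ℤ.+ a ℤ.* w₁) (begin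
        + ℓ ℤ.* x                                              ≡⟨ cong (ℤ._* x) (sym split) ⟩
        norm π ℤ.* x                                           ≡⟨ l₁ a b x y ⟩
        b ℤ.* (a ℤ.* y ℤ.+ + 2 ℤ.* (b ℤ.* x)) ℤ.+ a ℤ.* (a ℤ.* x ℤ.- b ℤ.* y) ≡⟨ cong₂ (λ u v → b ℤ.* u ℤ.+ a ℤ.* v) e₂ e₁ ⟩
        b ℤ.* (w₂ ℤ.* + ℓ) ℤ.+ a ℤ.* (w₁ ℤ.* + ℓ)             ≡⟨ r₁ a b w₁ w₂ (+ ℓ) ⟩
        + ℓ ℤ.* (b ℤ.* w₂ ℤ.+ a ℤ.* w₁)                        ∎))
      (ℤₚ.*-cancelˡ-≡ (+ ℓ) y (a ℤ.* w₂ ℤ.- + 2 ℤ.* (b ℤ.* w₁)) (begin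
        + ℓ ℤ.* y                                              ≡⟨ cong (ℤ._* y) (sym split) ⟩
        norm π ℤ.* y                                           ≡⟨ l₂ a b x y ⟩
        a ℤ.* (a ℤ.* y ℤ.+ + 2 ℤ.* (b ℤ.* x)) ℤ.- + 2 ℤ.* (b ℤ.* (a ℤ.* x ℤ.- b ℤ.* y)) ≡⟨ cong₂ (λ u v → a ℤ.* u ℤ.- + 2 ℤ.* (b ℤ.* v)) e₂ e₁ ⟩
        a ℤ.* (w₂ ℤ.* + ℓ) ℤ.- + 2 ℤ.* (b ℤ.* (w₁ ℤ.* + ℓ))   ≡⟨ r₂ a b w₁ w₂ (+ ℓ) ⟩
        + ℓ ℤ.* (a ℤ.* w₂ ℤ.- + 2 ℤ.* (b ℤ.* w₁))              ∎))
      where open ≡-Reasoning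

  multiple-∣ : ∀ x y w → ⟨ x , y ⟩ ≡ π · w → + ℓ S.∣ a ℤ.* x ℤ.- b ℤ.* y
  multiple-∣ _ _ ⟨ x , y ⟩ refl = S.divides x (trans (l a b x y) (cong (x ℤ.*_) split))
    where
    l : ∀ a b x y → a ℤ.* (b ℤ.* y ℤ.+ a ℤ.* x) ℤ.- b ℤ.* (a ℤ.* y ℤ.- + 2 ℤ.* (b ℤ.* x)) ≡ x ℤ.* (+ 2 ℤ.* (b ℤ.* b) ℤ.+ a ℤ.* a)
    l = ℤSolver.solve-∀

  -- The linear forms testing u and `conj u` multiply to b²·norm u - ℓx², a multiple of ℓ, so one of
  -- them is divisible by ℓ.
  factor± : ∀ u M → norm u ≡ + ℓ ℤ.* M → ∃ (λ w → u ≡ π · w) ⊎ ∃ (λ w → conj u ≡ π · w)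
  factor± ⟨ x , y ⟩ M e = from (prime-∣-* ℓ-prime (a ℤ.* x ℤ.- b ℤ.* y) (a ℤ.* - x ℤ.- b ℤ.* y) ℓ∣product)
    where
    l : ∀ a b x y → (a ℤ.* x ℤ.- b ℤ.* y) ℤ.* (a ℤ.* - x ℤ.- b ℤ.* y) ≡ b ℤ.* b ℤ.* (+ 2 ℤ.* (x ℤ.* x) ℤ.+ y ℤ.* y) ℤ.- (+ 2 ℤ.* (b ℤ.* b) ℤ.+ a ℤ.* a) ℤ.* (x ℤ.* x)
    l = ℤSolver.solve-∀
    r : ∀ b x M k → b ℤ.* b ℤ.* (k ℤ.* M) ℤ.- k ℤ.* (x ℤ.* x) ≡ (b ℤ.* b ℤ.* M ℤ.- x ℤ.* x) ℤ.* k
    r = ℤSolver.solve-∀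
    ℓ∣product : + ℓ S.∣ (a ℤ.* x ℤ.- b ℤ.* y) ℤ.* (a ℤ.* - x ℤ.- b ℤ.* y)
    ℓ∣product = S.divides (b ℤ.* b ℤ.* M ℤ.- x ℤ.* x)
      (trans (l a b x y) (trans (cong₂ (λ u v → b ℤ.* b ℤ.* u ℤ.- v ℤ.* (x ℤ.* x)) e split) (r b x M (+ ℓ))))
    from : + ℓ S.∣ a ℤ.* x ℤ.- b ℤ.* y ⊎ + ℓ S.∣ a ℤ.* - x ℤ.- b ℤ.* y → ∃ (λ w → ⟨ x , y ⟩ ≡ π · w) ⊎ ∃ (λ w → ⟨ - x , y ⟩ ≡ π · w)
    from (inj₁ d) = inj₁ (factor x y d)
    from (inj₂ d) = inj₂ (factor (- x) y d)

  -- The two linear forms differ by 2ax, and ℓ divides neither 2 nor a. Hence for ℓ ∤ x the choice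
  -- between u and `conj u` is unique.
  conj-multiple⇒∣ : ∀ u w w′ → u ≡ π · w → conj u ≡ π · w′ → ℓ N.∣ proj₁ (abs u)
  conj-multiple⇒∣ ⟨ x , y ⟩ w w′ e e′ = S.∣⇒∣ᵤ (from₁ (prime-∣-* ℓ-prime (+ 2) (a ℤ.* x)
      (subst (+ ℓ S.∣_) (l a b x y) (S.∣m∣n⇒∣m-n (multiple-∣ x y w e) (multiple-∣ (- x) y w′ e′)))))
    where
    l : ∀ a b x y → (a ℤ.* x ℤ.- b ℤ.* y) ℤ.- (a ℤ.* - x ℤ.- b ℤ.* y) ≡ + 2 ℤ.* (a ℤ.* x)
    l = ℤSolver.solve-∀
    from₂ : + ℓ S.∣ a ⊎ + ℓ S.∣ x → + ℓ S.∣ x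
    from₂ (inj₁ d) = ⊥-elim (proj₁ ℓ∤a×ℓ∤b d)
    from₂ (inj₂ d) = d
    from₁ : + ℓ S.∣ + 2 ⊎ + ℓ S.∣ a ℤ.* x → + ℓ S.∣ x
    from₁ (inj₁ d) = ⊥-elim (ℓ∤2 (S.∣⇒∣ᵤ d))
    from₁ (inj₂ d) = from₂ (prime-∣-* ℓ-prime a x d)

  -- Of the four elements with the same absolute values, the two conjugate ones are excluded by
  -- `conj-multiple⇒∣`. This makes the relations on pairs single-valued.
  abs-multiple : ∀ u w w′ → u ≡ π · w → abs (π · w′) ≡ abs u → ¬ (ℓ N.∣ proj₁ (abs u)) → w′ ≡ w ⊎ w′ ≡ neg w
  abs-multiple u w w′ e e′ ℓ∤x = from (abs-≡ u (π · w′) (sym e′))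
    where
    from : (π · w′ ≡ u ⊎ π · w′ ≡ neg u) ⊎ (π · w′ ≡ conj u ⊎ π · w′ ≡ neg (conj u)) → w′ ≡ w ⊎ w′ ≡ neg w
    from (inj₁ (inj₁ f)) = inj₁ (·-cancel π w′ w (trans f e))
    from (inj₁ (inj₂ f)) = inj₂ (·-cancel π w′ (neg w) (trans f (trans (cong neg e) (sym (·-neg π w)))))
    from (inj₂ (inj₁ f)) = ⊥-elim (ℓ∤x (conj-multiple⇒∣ u w w′ e (sym f)))
    from (inj₂ (inj₂ f)) = ⊥-elim (ℓ∤x (conj-multiple⇒∣ u w (neg w′) e
      (trans (sym (neg-neg (conj u))) (trans (cong neg (sym f)) (sym (·-neg π w′))))))

  infix 4 _∤x_
  _∤x_ : ℕ → ℤ[√-2] → Set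
  k ∤x u = ¬ (k N.∣ proj₁ (abs u))

  norm-quotient : ∀ u w M → u ≡ π · w → norm u ≡ + ℓ ℤ.* M → norm w ≡ M
  norm-quotient u w M e f = ℤₚ.*-cancelˡ-≡ (+ ℓ) (norm w) M
    (trans (cong (ℤ._* norm w) (sym split)) (trans (sym (norm-· π w)) (trans (cong norm (sym e)) f)))

  conj-π-· : ∀ c → π · (conj π · c) ≡ scale (+ ℓ) c
  conj-π-· c = trans (cong (_· (conj π · c)) (sym (conj-conj π))) (trans (·-conj (conj π) c)
    (cong (λ k → scale k c) (trans (norm-conj π) split)))

  conj-quotient : ∀ u w → conj u ≡ π · w → u ≡ conj π · conj w
  conj-quotient u w e = trans (sym (conj-conj u)) (trans (cong conj e) (conj-· π w))

  scale-∣x : ∀ {u c} → u ≡ scale (+ ℓ) c → ¬ (ℓ ∤x u)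
  scale-∣x {c = ⟨ x , _ ⟩} refl ℓ∤x = ℓ∤x (S.∣⇒∣ᵤ (S.∣m⇒∣m*n x (S.∣-refl {+ ℓ})))

  ∣x⇒scale : ∀ u w → u ≡ π · w → ℓ N.∣ proj₁ (abs u) → ∃ λ c → u ≡ scale (+ ℓ) c
  ∣x⇒scale ⟨ x , y ⟩ w e d = from (S.∣ᵤ⇒∣ {+ ℓ} {x} d)
    where
    from′ : + ℓ S.∣ x → + ℓ S.∣ b ⊎ + ℓ S.∣ y → ∃ λ c → ⟨ x , y ⟩ ≡ scale (+ ℓ) c
    from′ _ (inj₁ ℓ∣b) = ⊥-elim (proj₂ ℓ∤a×ℓ∤b ℓ∣b)
    from′ (S.divides c₁ e₁) (inj₂ (S.divides c₂ e₂)) = ⟨ c₁ , c₂ ⟩ , pair-≡ (trans e₁ (ℤₚ.*-comm c₁ (+ ℓ))) (trans e₂ (ℤₚ.*-comm c₂ (+ ℓ)))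
    l : ∀ a b x y → a ℤ.* x ℤ.- (a ℤ.* x ℤ.- b ℤ.* y) ≡ b ℤ.* y
    l = ℤSolver.solve-∀
    from : + ℓ S.∣ x → ∃ λ c → ⟨ x , y ⟩ ≡ scale (+ ℓ) c
    from ℓ∣x = from′ ℓ∣x (prime-∣-* ℓ-prime b y (subst (+ ℓ S.∣_) (l a b x y)
      (S.∣m∣n⇒∣m-n (S.∣n⇒∣m*n a ℓ∣x) (multiple-∣ x y w e))))

  -- Otherwise `π · u` would be ℓc = π·conj π·c, so u = conj π·c would be a multiple of both π and
  -- its conjugate.
  primitive-· : ∀ u w → u ≡ π · w → ℓ ∤x u → ℓ ∤x π · u
  primitive-· u w e ℓ∤x d = from (∣x⇒scale (π · u) u refl d)
    where
    from : ¬ ∃ λ c → π · u ≡ scale (+ ℓ) c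
    from (c , f) = ℓ∤x (conj-multiple⇒∣ u w (conj c) e
      (trans (cong conj (·-cancel π u (conj π · c) (trans f (sym (conj-π-· c)))))
        (trans (conj-· (conj π) c) (cong (_· conj c) (conj-conj π)))))

  -- If `conj π` divided u instead, then `π · u` would be a multiple of ℓ.
  factor-primitive : ∀ u M → norm u ≡ + ℓ ℤ.* M → ℓ ∤x π · u → ∃ λ w → u ≡ π · w
  factor-primitive u M e ℓ∤x = from (factor± u M e)
    where
    from : ∃ (λ w → u ≡ π · w) ⊎ ∃ (λ w → conj u ≡ π · w) → ∃ λ w → u ≡ π · w
    from (inj₁ r)       = r
    from (inj₂ (w , f)) = ⊥-elim (scale-∣x {π · u} {conj w} (trans (cong (π ·_) (conj-quotient u w f)) (conj-π-· (conj w))) ℓ∤x)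

  factor-lift : ∀ m M → norm (lift m) ≡ + ℓ ℤ.* M → ∃ λ u → ∃ λ w → u ≡ π · w × abs u ≡ m × norm u ≡ + ℓ ℤ.* M
  factor-lift m M e = from (factor± (lift m) M e)
    where
    from : ∃ (λ w → lift m ≡ π · w) ⊎ ∃ (λ w → conj (lift m) ≡ π · w) → ∃ λ u → ∃ λ w → u ≡ π · w × abs u ≡ m × norm u ≡ + ℓ ℤ.* M
    from (inj₁ (w , f)) = lift m , w , f , refl , e
    from (inj₂ (w , f)) = conj (lift m) , w , f , abs-conj (lift m) , trans (norm-conj (lift m)) e

-- Multiplication of primitive representations by π².

square-mod-3 : ∀ n → 3 N.∣ n ⊎ ∃ λ k → n * n ≡ 1 + 3 * k
square-mod-3 zero          = inj₁ (N.divides 0 refl)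
square-mod-3 (suc zero)    = inj₂ (0 , refl)
square-mod-3 (suc (suc zero)) = inj₂ (1 , refl)
square-mod-3 (suc (suc (suc n))) with square-mod-3 n
... | inj₁ d       = inj₁ (N.∣m∣n⇒∣m+n N.∣-refl d)
... | inj₂ (k , e) = inj₂ (k + 2 * n + 3 , trans (l n) (trans (cong (_+ (6 * n + 9)) e) (r n k)))
  where
  l : ∀ n → (3 + n) * (3 + n) ≡ n * n + (6 * n + 9)
  l = solve-∀
  r : ∀ n k → 1 + 3 * k + (6 * n + 9) ≡ 1 + 3 * (k + 2 * n + 3)
  r = solve-∀

prime-3 : Prime 3
prime-3 = toWitness {a? = prime? 3} _

module Raise (p : ℕ) (pp : Prime p) (p∤2 : ¬ (p N.∣ 2)) (3∤p : ¬ (3 N.∣ p)) (b a : ℤ) (split : norm ⟨ b , a ⟩ ≡ + p) where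
  open Split p pp p∤2 b a split

  private
    -- If 3 divided neither, both squares would be 1 mod 3 and p = a² + 2b² would be divisible by 3.
    3∣ab : + 3 S.∣ a ℤ.* b
    3∣ab = from (square-mod-3 ∣ a ∣) (square-mod-3 ∣ b ∣)
      where
      ab : 2 * (∣ b ∣ * ∣ b ∣) + ∣ a ∣ * ∣ a ∣ ≡ p
      ab = norm≡⇒ℕ ⟨ b , a ⟩ p split
      l : ∀ j k → 2 * (1 + 3 * k) + (1 + 3 * j) ≡ (1 + 2 * k + j) * 3
      l = solve-∀
      from : 3 N.∣ ∣ a ∣ ⊎ ∃ (λ k → ∣ a ∣ * ∣ a ∣ ≡ 1 + 3 * k) → 3 N.∣ ∣ b ∣ ⊎ ∃ (λ k → ∣ b ∣ * ∣ b ∣ ≡ 1 + 3 * k) → + 3 S.∣ a ℤ.* b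
      from (inj₁ d) _        = S.∣m⇒∣m*n b (S.∣ᵤ⇒∣ {+ 3} {a} d)
      from (inj₂ _) (inj₁ d) = S.∣n⇒∣m*n a (S.∣ᵤ⇒∣ {+ 3} {b} d)
      from (inj₂ (j , e)) (inj₂ (k , f)) = ⊥-elim (3∤p (N.divides (1 + 2 * k + j) (trans (sym ab) (trans (cong₂ (λ s t → 2 * s + t) f e) (l j k)))))

    A = a ℤ.* a ℤ.- + 2 ℤ.* (b ℤ.* b)

    -- From A² + 8(ab)² = p², the norm equation of π² = A + 2ab√-2.
    3∤A : ¬ (+ 3 S.∣ A)
    3∤A d = 3∤p (S.∣⇒∣ᵤ (prime-∣-square prime-3 (+ p) (subst (+ 3 S.∣_) (trans (l a b) (cong₂ ℤ._*_ split split))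
      (S.∣m∣n⇒∣m+n (S.∣m⇒∣m*n A d) (S.∣n⇒∣m*n (+ 8 ℤ.* (a ℤ.* b)) 3∣ab)))))
      where
      l : ∀ a b → (a ℤ.* a ℤ.- + 2 ℤ.* (b ℤ.* b)) ℤ.* (a ℤ.* a ℤ.- + 2 ℤ.* (b ℤ.* b)) ℤ.+ + 8 ℤ.* (a ℤ.* b) ℤ.* (a ℤ.* b)
        ≡ (+ 2 ℤ.* (b ℤ.* b) ℤ.+ a ℤ.* a) ℤ.* (+ 2 ℤ.* (b ℤ.* b) ℤ.+ a ℤ.* a)
      l = ℤSolver.solve-∀

    y-π² : ∀ x y → proj₂ (coeff (π · (π · ⟨ x , y ⟩))) ≡ A ℤ.* y ℤ.- + 4 ℤ.* x ℤ.* (a ℤ.* b)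
    y-π² x y = l a b x y
      where
      l : ∀ a b x y → a ℤ.* (a ℤ.* y ℤ.- + 2 ℤ.* (b ℤ.* x)) ℤ.- + 2 ℤ.* (b ℤ.* (b ℤ.* y ℤ.+ a ℤ.* x))
        ≡ (a ℤ.* a ℤ.- + 2 ℤ.* (b ℤ.* b)) ℤ.* y ℤ.- + 4 ℤ.* x ℤ.* (a ℤ.* b)
      l = ℤSolver.solve-∀

    3∣y⇒3∣y-π² : ∀ u → 3 N.∣ proj₂ (abs u) → 3 N.∣ proj₂ (abs (π · (π · u)))
    3∣y⇒3∣y-π² ⟨ x , y ⟩ d = S.∣⇒∣ᵤ (subst (+ 3 S.∣_) (sym (y-π² x y))
      (S.∣m∣n⇒∣m-n (S.∣n⇒∣m*n A (S.∣ᵤ⇒∣ {+ 3} {y} d)) (S.∣n⇒∣m*n (+ 4 ℤ.* x) 3∣ab)))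

    3∣y-π²⇒3∣y : ∀ u → 3 N.∣ proj₂ (abs (π · (π · u))) → 3 N.∣ proj₂ (abs u)
    3∣y-π²⇒3∣y ⟨ x , y ⟩ d = from (prime-∣-* prime-3 A y (subst (+ 3 S.∣_) (l (A ℤ.* y) (+ 4 ℤ.* x ℤ.* (a ℤ.* b)))
        (S.∣m∣n⇒∣m+n (subst (+ 3 S.∣_) (y-π² x y) (S.∣ᵤ⇒∣ d)) (S.∣n⇒∣m*n (+ 4 ℤ.* x) 3∣ab))))
      where
      l : ∀ s t → s ℤ.- t ℤ.+ t ≡ s
      l = ℤSolver.solve-∀
      from : + 3 S.∣ A ⊎ + 3 S.∣ y → 3 N.∣ ∣ y ∣
      from (inj₁ e) = ⊥-elim (3∤A e)
      from (inj₂ e) = S.∣⇒∣ᵤ e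

    -- The field `w` certifies that u is the lift divisible by π. Without it, u and its conjugate
    -- could give different images; `p∤u` and `p∤v` make the lifts unique up to sign.
    record _↝_ (m n : ℕ × ℕ) : Set where
      constructor mk
      field
        w u v : ℤ[√-2]
        u≡ : u ≡ π · w
        v≡ : v ≡ π · (π · u)
        abs-u : abs u ≡ m
        abs-v : abs v ≡ n
        p∤u : p ∤x u
        p∤v : p ∤x v

    ↝-functional : ∀ {m n n′} → m ↝ n → m ↝ n′ → n ≡ n′
    ↝-functional (mk w u v u≡ v≡ abs-u abs-v p∤u p∤v) (mk w′ u′ v′ u′≡ v′≡ abs-u′ abs-v′ p∤u′ p∤v′) =
      trans (sym abs-v) (trans (sym (from (abs-multiple u w w′ u≡ (trans (cong abs (sym u′≡)) (trans abs-u′ (sym abs-u))) p∤u))) abs-v′)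
      where
      from : w′ ≡ w ⊎ w′ ≡ neg w → abs v′ ≡ abs v
      from (inj₁ e) = cong abs (trans v′≡ (trans (cong (λ k → π · (π · k)) (trans u′≡ (trans (cong (π ·_) e) (sym u≡)))) (sym v≡)))
      from (inj₂ e) = trans (cong abs (trans v′≡ (trans (cong (λ k → π · (π · k)) u′≡neg) (trans (cong (π ·_) (·-neg π u)) (trans (·-neg π (π · u)) (cong neg (sym v≡))))))) (abs-neg v)
        where
        u′≡neg : u′ ≡ neg u
        u′≡neg = trans u′≡ (trans (cong (π ·_) e) (trans (·-neg π w) (cong neg (sym u≡))))

    ↝-injective : ∀ {m m′ n} → m ↝ n → m′ ↝ n → m ≡ m′
    ↝-injective (mk w u v u≡ v≡ abs-u abs-v p∤u p∤v) (mk w′ u′ v′ u′≡ v′≡ abs-u′ abs-v′ p∤u′ p∤v′) =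
      trans (sym abs-u) (trans (sym (from (abs-multiple v (π · u) (π · u′) v≡ (trans (cong abs (sym v′≡)) (trans abs-v′ (sym abs-v))) p∤v))) abs-u′)
      where
      from : π · u′ ≡ π · u ⊎ π · u′ ≡ neg (π · u) → abs u′ ≡ abs u
      from (inj₁ e) = cong abs (·-cancel π u′ u e)
      from (inj₂ e) = trans (cong abs (·-cancel π u′ (neg u) (trans e (sym (·-neg π u))))) (abs-neg u)

  Primitive : ℕ → ℕ × ℕ → Set
  Primitive M m = IsRep M m × ¬ (p N.∣ proj₁ m)

  raise : ∀ {M m} → p N.∣ M → Primitive M m → ∃ λ n → Primitive (p * (p * M)) n × m ↝ n
  raise {M} {m} (N.divides M′ M≡) (rep , p∤m) = from (factor-lift m (+ M′) (trans (lift-norm m rep) norm-m))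
    where
    norm-m : + M ≡ + p ℤ.* + M′
    norm-m = trans (cong +_ (trans M≡ (ℕₚ.*-comm M′ p))) (ℤₚ.pos-* p M′)
    from : (∃ λ u → ∃ λ w → u ≡ π · w × abs u ≡ m × norm u ≡ + p ℤ.* + M′) → ∃ λ n → Primitive (p * (p * M)) n × m ↝ n
    from (u , w , u≡ , abs-u , norm-u) = abs v , ((norm≡⇒ℕ v (p * (p * M)) norm-v , 3∤v) , p∤v) , mk w u v u≡ refl abs-u refl p∤u p∤v
      where
      v = π · (π · u)
      p∤u : p ∤x u
      p∤u = subst (λ k → ¬ (p N.∣ proj₁ k)) (sym abs-u) p∤m
      p∤v : p ∤x v
      p∤v = primitive-· (π · u) u refl (primitive-· u w u≡ p∤u)
      3∤v : ¬ (3 N.∣ proj₂ (abs v))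
      3∤v d = proj₂ rep (subst (λ k → 3 N.∣ proj₂ k) abs-u (3∣y-π²⇒3∣y u d))
      norm-v : norm v ≡ + (p * (p * M))
      norm-v = begin
        norm (π · (π · u))                ≡⟨ norm-· π (π · u) ⟩
        norm π ℤ.* norm (π · u)           ≡⟨ cong (norm π ℤ.*_) (norm-· π u) ⟩
        norm π ℤ.* (norm π ℤ.* norm u)    ≡⟨ cong₂ (λ k l → k ℤ.* (k ℤ.* l)) split (trans norm-u (sym norm-m)) ⟩
        + p ℤ.* (+ p ℤ.* + M)             ≡⟨ cong (+ p ℤ.*_) (sym (ℤₚ.pos-* p M)) ⟩
        + p ℤ.* + (p * M)                 ≡⟨ sym (ℤₚ.pos-* p (p * M)) ⟩
        + (p * (p * M))                   ∎
        where open ≡-Reasoning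

  -- Three factors π are split off. Only the first needs a choice of conjugate; afterwards a factor
  -- `conj π` would meet an earlier π and make v a multiple of p. The third exists because p | M and
  -- supplies the `w` that `_↝_` requires.
  lower : ∀ {M n} → p N.∣ M → Primitive (p * (p * M)) n → ∃ λ m → Primitive M m × m ↝ n
  lower {M} {n} (N.divides M′ M≡) (rep , p∤n) = from₁ (factor-lift n (+ (p * M)) (trans (lift-norm n rep) (ℤₚ.pos-* p (p * M))))
    where
    norm-M : + M ≡ + p ℤ.* + M′
    norm-M = trans (cong +_ (trans M≡ (ℕₚ.*-comm M′ p))) (ℤₚ.pos-* p M′)
    Goal = ∃ λ m → Primitive M m × m ↝ n
    from₁ : (∃ λ v → ∃ λ w → v ≡ π · w × abs v ≡ n × norm v ≡ + p ℤ.* + (p * M)) → Goal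
    from₁ (v , s , v≡s , abs-v , norm-v) = from₂ (factor-primitive s (+ M) norm-s (subst (p ∤x_) v≡s p∤v))
      where
      p∤v : p ∤x v
      p∤v = subst (λ k → ¬ (p N.∣ proj₁ k)) (sym abs-v) p∤n
      norm-s : norm s ≡ + p ℤ.* + M
      norm-s = trans (norm-quotient v s (+ (p * M)) v≡s norm-v) (ℤₚ.pos-* p M)
      from₂ : (∃ λ u → s ≡ π · u) → Goal
      from₂ (u , s≡) = from₃ (factor-primitive u (+ M′) (trans norm-u norm-M) p∤πu)
        where
        v≡ : v ≡ π · (π · u)
        v≡ = trans v≡s (cong (π ·_) s≡)
        norm-u : norm u ≡ + M
        norm-u = norm-quotient s u (+ M) s≡ norm-s
        ¬scale : ∀ t → v ≡ π · t → ¬ ∃ λ c → t ≡ scale (+ p) c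
        ¬scale t v≡t (c , e) = scale-∣x {v} {π · c} (trans v≡t (trans (cong (π ·_) e) (·-scale π (+ p) c))) p∤v
        p∤πu : p ∤x π · u
        p∤πu d = ¬scale (π · u) v≡ (∣x⇒scale (π · u) u refl d)
        from₃ : (∃ λ w → u ≡ π · w) → Goal
        from₃ (w , u≡) = abs u , ((norm≡⇒ℕ u M norm-u , 3∤u) , p∤u) , mk w u v u≡ v≡ refl abs-v p∤u p∤v
          where
          p∤u : p ∤x u
          p∤u d = ¬primitive (∣x⇒scale u w u≡ d)
            where
            ¬primitive : ¬ ∃ λ c → u ≡ scale (+ p) c
            ¬primitive (c , e) = ¬scale (π · u) v≡ (π · c , trans (cong (π ·_) e) (·-scale π (+ p) c))
          3∤u : ¬ (3 N.∣ proj₂ (abs u))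
          3∤u d = proj₂ rep (subst (λ k → 3 N.∣ proj₂ k) (trans (cong abs (sym v≡)) abs-v) (3∣y⇒3∣y-π² u d))

  raise-bijection : ∀ M → p N.∣ M → ∀ xs ys → Unique xs → Unique ys →
    (∀ {m} → m ∈ xs → Primitive M m) → (∀ {m} → Primitive M m → m ∈ xs) →
    (∀ {n} → n ∈ ys → Primitive (p * (p * M)) n) → (∀ {n} → Primitive (p * (p * M)) n → n ∈ ys) →
    length xs ≡ length ys
  raise-bijection M p∣M xs ys ux uy xs⁻ xs⁺ ys⁻ ys⁺ = length-bijection _↝_ ↝-functional ↝-injective xs ys ux uy
    (λ {m} m∈ → let n , prim , m↝n = raise {M} {m} p∣M (xs⁻ {m} m∈) in n , ys⁺ {n} prim , m↝n)
    (λ {n} n∈ → let m , prim , m↝n = lower {M} {n} p∣M (ys⁻ {n} n∈) in m , xs⁺ {m} prim , m↝n)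

-- Representations of 3p², and Thue's lemma

square-injective : ∀ m n → m * m ≡ n * n → m ≡ n
square-injective m n e with ℕₚ.<-cmp m n
... | tri< m<n _ _ = ⊥-elim (ℕₚ.<⇒≢ (ℕₚ.*-mono-< m<n m<n) e)
... | tri≈ _ m≡n _ = m≡n
... | tri> _ _ n<m = ⊥-elim (ℕₚ.<⇒≢ (ℕₚ.*-mono-< n<m n<m) (sym e))

-i≡i⇒i≡0 : ∀ i → - i ≡ i → i ≡ + 0
-i≡i⇒i≡0 (+ zero) _ = refl
-i≡i⇒i≡0 (+ suc n) ()
-i≡i⇒i≡0 ℤ.-[1+ n ] ()

norm-scale : ∀ c u → norm (scale c u) ≡ c ℤ.* (c ℤ.* norm u)
norm-scale c ⟨ x , y ⟩ = l c x y
  where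
  l : ∀ c x y → + 2 ℤ.* (c ℤ.* x ℤ.* (c ℤ.* x)) ℤ.+ c ℤ.* y ℤ.* (c ℤ.* y) ≡ c ℤ.* (c ℤ.* (+ 2 ℤ.* (x ℤ.* x) ℤ.+ y ℤ.* y))
  l = ℤSolver.solve-∀

module ThreePSquared (p : ℕ) (pp : Prime p) (2∤p : ¬ (2 N.∣ p)) (3∤p : ¬ (3 N.∣ p)) where

  private
    3∤2 : ¬ (3 N.∣ 2)
    3∤2 = N.>⇒∤ (s≤s (s≤s (s≤s z≤n)))

  open Split 3 prime-3 3∤2 (+ 1) (+ 1) refl

  private
    P = p * p

    prime∤P : ∀ {q} → Prime q → ¬ (q N.∣ p) → ¬ (q N.∣ P)
    prime∤P qp q∤p d = [ q∤p , q∤p ]′ (euclidsLemma p p qp d)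

    -- Here π = 1 + √-2. Conjugation acts on the cofactor because conjugating u itself would not
    -- change its absolute values.
    record _~_ (m n : ℕ × ℕ) : Set where
      constructor mk
      field
        w u v : ℤ[√-2]
        u≡ : u ≡ π · w
        v≡ : v ≡ π · conj w
        norm-w : norm w ≡ + P
        abs-u : abs u ≡ m
        abs-v : abs v ≡ n
        3∤u : 3 ∤x u
        3∤v : 3 ∤x v

    ~-sym : ∀ {m n} → m ~ n → n ~ m
    ~-sym (mk w u v u≡ v≡ norm-w abs-u abs-v 3∤u 3∤v) =
      mk (conj w) v u v≡ (trans u≡ (cong (π ·_) (sym (conj-conj w)))) (trans (norm-conj w) norm-w) abs-v abs-u 3∤v 3∤u

    ~-functional : ∀ {m n n′} → m ~ n → m ~ n′ → n ≡ n′
    ~-functional (mk w u v u≡ v≡ _ abs-u abs-v 3∤u _) (mk w′ u′ v′ u′≡ v′≡ _ abs-u′ abs-v′ _ _) =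
      trans (sym abs-v) (trans (sym (from (abs-multiple u w w′ u≡ (trans (cong abs (sym u′≡)) (trans abs-u′ (sym abs-u))) 3∤u))) abs-v′)
      where
      from : w′ ≡ w ⊎ w′ ≡ neg w → abs v′ ≡ abs v
      from (inj₁ e) = cong abs (trans v′≡ (trans (cong (λ k → π · conj k) e) (sym v≡)))
      from (inj₂ e) = trans (cong abs (trans v′≡ (trans (cong (λ k → π · conj k) e) (trans (cong (π ·_) (conj-neg w)) (trans (·-neg π (conj w)) (cong neg (sym v≡))))))) (abs-neg v)

    abs-π-real : ∀ y → ∣ y ∣ ≡ p → abs (π · ⟨ + 0 , y ⟩) ≡ (p , p)
    abs-π-real y e = cong₂ _,_ (trans (cong ∣_∣ (l y)) e) (trans (cong ∣_∣ (r y)) e)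
      where
      l : ∀ y → + 1 ℤ.* y ℤ.+ + 1 ℤ.* + 0 ≡ y
      l = ℤSolver.solve-∀
      r : ∀ y → + 1 ℤ.* y ℤ.- + 2 ℤ.* (+ 1 ℤ.* + 0) ≡ y
      r = ℤSolver.solve-∀

    self-conj : ∀ w → norm w ≡ + P → conj w ≡ w → abs (π · w) ≡ (p , p)
    self-conj ⟨ x , y ⟩ e f with -i≡i⇒i≡0 x (cong (proj₁ ∘ coeff) f)
    ... | refl = abs-π-real y (square-injective ∣ y ∣ p (norm≡⇒ℕ ⟨ + 0 , y ⟩ P e))

    ¬conj≡neg : ∀ w → norm w ≡ + P → conj w ≢ neg w
    ¬conj≡neg ⟨ x , y ⟩ e f with -i≡i⇒i≡0 y (sym (cong (proj₂ ∘ coeff) f))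
    -- With y = 0 the norm equation reads 2x² = p², impossible for odd p.
    ... | refl = prime∤P prime[2] 2∤p (N.divides (∣ x ∣ * ∣ x ∣)
      (trans (sym (norm≡⇒ℕ ⟨ x , + 0 ⟩ P e)) (trans (ℕₚ.+-identityʳ _) (ℕₚ.*-comm 2 (∣ x ∣ * ∣ x ∣)))))

    ~-fixed : ∀ {m} → m ~ m → (p , p) ≡ m
    ~-fixed (mk w u v u≡ v≡ norm-w abs-u abs-v 3∤u _) =
      trans (sym (from (abs-multiple u w (conj w) u≡ (trans (cong abs (sym v≡)) (trans abs-v (sym abs-u))) 3∤u))) (trans (cong abs (sym u≡)) abs-u)
      where
      from : conj w ≡ w ⊎ conj w ≡ neg w → abs (π · w) ≡ (p , p)
      from (inj₁ e) = self-conj w norm-w e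
      from (inj₂ e) = ⊥-elim (¬conj≡neg w norm-w e)

    -- If 3 | x then u = 3c, so 3p² = 9·norm c and 3 | p².
    3∤norm : ∀ u w → u ≡ π · w → norm u ≡ + 3 ℤ.* + P → 3 ∤x u
    3∤norm u w e f d with ∣x⇒scale u w e d
    ... | c , g = prime∤P prime-3 3∤p (S.∣⇒∣ᵤ {+ 3} {+ P} (S.divides (norm c) (trans
        (ℤₚ.*-cancelˡ-≡ (+ 3) (+ P) (+ 3 ℤ.* norm c) (trans (sym f) (trans (cong norm g) (norm-scale (+ 3) c)))) (ℤₚ.*-comm (+ 3) (norm c)))))

    -- For π = 1 + √-2 the linear form is x - y, so multiples of π have x and y congruent mod 3.
    -- Thus `3∤norm` also yields the condition 3 ∤ y in `IsRep`.
    3∣y⇒3∣x : ∀ u w → u ≡ π · w → 3 N.∣ proj₂ (abs u) → 3 N.∣ proj₁ (abs u)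
    3∣y⇒3∣x ⟨ x , y ⟩ w e d = S.∣⇒∣ᵤ (subst (+ 3 S.∣_) (l x y) (S.∣m∣n⇒∣m+n (multiple-∣ x y w e) (S.∣ᵤ⇒∣ {+ 3} {y} d)))
      where
      l : ∀ x y → + 1 ℤ.* x ℤ.- + 1 ℤ.* y ℤ.+ y ≡ x
      l = ℤSolver.solve-∀

    pp∈ : IsRep (3 * P) (p , p)
    pp∈ = l p , 3∤p
      where
      l : ∀ p → 2 * (p * p) + p * p ≡ 3 * (p * p)
      l = solve-∀

    pp~pp : (p , p) ~ (p , p)
    pp~pp = mk w (π · w) (π · w) refl refl norm-w abs-w abs-w 3∤w 3∤w
      where
      w = ⟨ + 0 , + p ⟩
      abs-w = abs-π-real (+ p) refl
      norm-w : norm w ≡ + P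
      norm-w = trans (ℤₚ.+-identityˡ (+ p ℤ.* + p)) (sym (ℤₚ.pos-* p p))
      3∤w : 3 ∤x π · w
      3∤w = subst (λ k → ¬ (3 N.∣ proj₁ k)) (sym abs-w) 3∤p

    partner : ∀ m → IsRep (3 * P) m → ∃ λ n → n ∈ reps (3 * P) × m ~ n
    partner m rep = from (factor-lift m (+ P) (trans (lift-norm m rep) (ℤₚ.pos-* 3 P)))
      where
      from : (∃ λ u → ∃ λ w → u ≡ π · w × abs u ≡ m × norm u ≡ + 3 ℤ.* + P) → ∃ λ n → n ∈ reps (3 * P) × m ~ n
      from (u , w , u≡ , abs-u , norm-u) = abs v , ∈-reps⁺ (3 * P) {abs v} (norm≡⇒ℕ v (3 * P) (trans norm-v (sym (ℤₚ.pos-* 3 P))) , 3∤v ∘ 3∣y⇒3∣x v (conj w) refl)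
          , mk w u v u≡ refl norm-w abs-u refl (3∤norm u w u≡ norm-u) 3∤v
        where
        v = π · conj w
        norm-w : norm w ≡ + P
        norm-w = norm-quotient u w (+ P) u≡ norm-u
        norm-v : norm v ≡ + 3 ℤ.* + P
        norm-v = trans (norm-· π (conj w)) (cong (+ 3 ℤ.*_) (trans (norm-conj w) norm-w))
        3∤v : 3 ∤x v
        3∤v = 3∤norm v (conj w) refl norm-v

  reps-odd : parity (length (reps (3 * (p * p)))) ≡ 1ℙ
  reps-odd = involution-odd _~_ ~-sym ~-functional (reps (3 * P)) (p , p) (∈-reps⁺ (3 * P) {p , p} pp∈) (reps-unique (3 * P)) pp~pp
    (λ _ → ~-fixed) (λ {m} m∈ → partner m (∈-reps⁻ (3 * P) {m} m∈))

-- Thue's lemma for 2x² + y².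

sqrt : ∀ n → ∃ λ s → s * s ≤ n × n < suc s * suc s
sqrt zero = 0 , z≤n , s≤s z≤n
sqrt (suc n) with sqrt n
... | s , s²≤n , n<s′² with suc s * suc s ≤? suc n
...   | yes s′²≤ = suc s , s′²≤ , ℕₚ.≤-<-trans n<s′² (ℕₚ.*-mono-< (ℕₚ.n<1+n (suc s)) (ℕₚ.n<1+n (suc s)))
...   | no  s′²≰ = s , ℕₚ.m≤n⇒m≤1+n s²≤n , ℕₚ.≰⇒> s′²≰

%-≡⇒∣ : ∀ m n p .{{_ : NonZero p}} → m % p ≡ n % p → + p S.∣ + m ℤ.- + n
%-≡⇒∣ m n p e = S.divides (+ (m / p) ℤ.- + (n / p)) (begin
  + m ℤ.- + n
    ≡⟨ cong₂ ℤ._-_ (expand m) (trans (expand n) (cong (λ k → + k ℤ.+ + (n / p) ℤ.* + p) (sym e))) ⟩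
  (+ (m % p) ℤ.+ + (m / p) ℤ.* + p) ℤ.- (+ (m % p) ℤ.+ + (n / p) ℤ.* + p)
    ≡⟨ l (+ (m % p)) (+ (m / p)) (+ (n / p)) (+ p) ⟩
  (+ (m / p) ℤ.- + (n / p)) ℤ.* + p ∎)
  where
  open ≡-Reasoning
  expand : ∀ k → + k ≡ + (k % p) ℤ.+ + (k / p) ℤ.* + p
  expand k = trans (cong +_ (m≡m%n+[m/n]*n k p)) (trans (ℤₚ.pos-+ (k % p) (k / p * p)) (cong (λ z → + (k % p) ℤ.+ z) (ℤₚ.pos-* (k / p) p)))
  l : ∀ r a b k → (r ℤ.+ a ℤ.* k) ℤ.- (r ℤ.+ b ℤ.* k) ≡ (a ℤ.- b) ℤ.* k
  l = ℤSolver.solve-∀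

-- Thue's lemma: among the (s+1)² > p values ix + jy with i, j ≤ s = ⌊√p⌋, two agree mod p.
module Thue (p : ℕ) (pp : Prime p) (x y : ℕ) (p∣ : p N.∣ 2 * (x * x) + y * y) (p∤x : ¬ (p N.∣ x)) where

  private
    instance
      p-nonZero : NonZero p
      p-nonZero = prime⇒nonZero pp

    s = proj₁ (sqrt p)

    -- A prime is not a square. Strictness is what gives D < 3p, excluding D = 3p.
    s²<p : s * s < p
    s²<p = ℕₚ.≤∧≢⇒< (proj₁ (proj₂ (sqrt p))) ¬square
      where
      ¬square : s * s ≢ p
      ¬square e = [ (λ s≡1 → ℕ.nonTrivial⇒≢1 {{prime⇒nonTrivial pp}} (trans (sym e) (cong (λ k → k * k) s≡1)))
                  , (λ s≡p → ℕ.nonTrivial⇒≢1 {{prime⇒nonTrivial pp}} (ℕₚ.*-cancelˡ-≡ p 1 p (trans (trans (cong (λ k → k * k) (sym s≡p)) e) (sym (ℕₚ.*-identityʳ p)))))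
                  ]′ (prime⇒irreducible pp (N.divides s (sym e)))

    value : ℕ → ℕ → ℕ
    value i j = i * x + j * y

    row column : Fin (suc s * suc s) → Fin (suc s)
    row k    = proj₁ (remQuot {suc s} (suc s) k)
    column k = proj₂ (remQuot {suc s} (suc s) k)

    I J : Fin (suc s * suc s) → ℕ
    I k = toℕ (row k)
    J k = toℕ (column k)

    residue : Fin (suc s * suc s) → Fin p
    residue k = fromℕ< (m%n<n (value (I k) (J k)) p)

    collision = Finₚ.pigeonhole (proj₂ (proj₂ (sqrt p))) residue
    k₁ = proj₁ collision
    k₂ = proj₁ (proj₂ collision)

    u v : ℤ
    u = + I k₁ ℤ.- + I k₂
    v = + J k₁ ℤ.- + J k₂

    difference-≤ : ∀ (i j : Fin (suc s)) → ∣ + toℕ i ℤ.- + toℕ j ∣ ≤ s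
    difference-≤ i j = ℕₚ.≤-trans (ℕₚ.≤-reflexive (cong ∣_∣ (ℤₚ.m-n≡m⊖n (toℕ i) (toℕ j))))
      (ℕₚ.≤-trans (ℤₚ.∣m⊝n∣≤m⊔n (toℕ i) (toℕ j)) (ℕₚ.⊔-lub (ℕₚ.≤-pred (Finₚ.toℕ<n i)) (ℕₚ.≤-pred (Finₚ.toℕ<n j))))

    p∣value : + p S.∣ u ℤ.* + x ℤ.+ v ℤ.* + y
    p∣value = subst (+ p S.∣_) (trans (cong₂ ℤ._-_ (cast (I k₁) (J k₁)) (cast (I k₂) (J k₂))) (l (+ I k₁) (+ I k₂) (+ J k₁) (+ J k₂) (+ x) (+ y)))
      (%-≡⇒∣ (value (I k₁) (J k₁)) (value (I k₂) (J k₂)) p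
        (trans (sym (Finₚ.toℕ-fromℕ< (m%n<n (value (I k₁) (J k₁)) p))) (trans (cong toℕ (proj₂ (proj₂ (proj₂ collision)))) (Finₚ.toℕ-fromℕ< (m%n<n (value (I k₂) (J k₂)) p)))))
      where
      cast : ∀ i j → + value i j ≡ + i ℤ.* + x ℤ.+ + j ℤ.* + y
      cast i j = trans (ℤₚ.pos-+ (i * x) (j * y)) (cong₂ ℤ._+_ (ℤₚ.pos-* i x) (ℤₚ.pos-* j y))
      l : ∀ i i′ j j′ x y → (i ℤ.* x ℤ.+ j ℤ.* y) ℤ.- (i′ ℤ.* x ℤ.+ j′ ℤ.* y) ≡ (i ℤ.- i′) ℤ.* x ℤ.+ (j ℤ.- j′) ℤ.* y
      l = ℤSolver.solve-∀

    -- Since (ux + vy)(ux - vy) + v²(2x² + y²) = x²(u² + 2v²), both factors x can be cancelled.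
    p∣norm : + p S.∣ norm ⟨ v , u ⟩
    p∣norm = cancel (cancel (subst (+ p S.∣_) (l u v (+ x) (+ y)) (S.∣m∣n⇒∣m+n
        (S.∣m⇒∣m*n (u ℤ.* + x ℤ.- v ℤ.* + y) p∣value) (S.∣n⇒∣m*n (v ℤ.* v) p∣xy))))
      where
      p∣xy : + p S.∣ norm ⟨ + x , + y ⟩
      p∣xy = subst (+ p S.∣_) (norm-abs (+ x) (+ y)) (S.∣ᵤ⇒∣ p∣)
      cancel : ∀ {k} → + p S.∣ + x ℤ.* k → + p S.∣ k
      cancel {k} d = [ (λ e → ⊥-elim (p∤x (S.∣⇒∣ᵤ e))) , id ]′ (prime-∣-* pp (+ x) k d)
      l : ∀ u v x y → (u ℤ.* x ℤ.+ v ℤ.* y) ℤ.* (u ℤ.* x ℤ.- v ℤ.* y) ℤ.+ v ℤ.* v ℤ.* (+ 2 ℤ.* (x ℤ.* x) ℤ.+ y ℤ.* y)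
        ≡ x ℤ.* (x ℤ.* (+ 2 ℤ.* (v ℤ.* v) ℤ.+ u ℤ.* u))
      l = ℤSolver.solve-∀

    D : ℕ
    D = 2 * (∣ v ∣ * ∣ v ∣) + ∣ u ∣ * ∣ u ∣

    p∣D : p N.∣ D
    p∣D = S.∣⇒∣ᵤ (subst (+ p S.∣_) (sym (norm-abs v u)) p∣norm)

    D<3p : D < 3 * p
    D<3p = ℕₚ.≤-<-trans (ℕₚ.+-mono-≤ (ℕₚ.*-monoʳ-≤ 2 (ℕₚ.*-mono-≤ v≤s v≤s)) (ℕₚ.*-mono-≤ u≤s u≤s))
      (ℕₚ.≤-<-trans (ℕₚ.≤-reflexive (l (s * s))) (ℕₚ.*-monoʳ-< 3 s²<p))
      where
      u≤s = difference-≤ (row k₁) (row k₂)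
      v≤s = difference-≤ (column k₁) (column k₂)
      l : ∀ k → 2 * k + k ≡ 3 * k
      l = solve-∀

    D≢0 : D ≢ 0
    D≢0 e = ℕₚ.<⇒≢ (proj₁ (proj₂ (proj₂ collision))) (cong toℕ (trans (sym (Finₚ.combine-remQuot {suc s} (suc s) k₁))
      (trans (cong₂ combine (same (row k₁) (row k₂) u≡0) (same (column k₁) (column k₂) v≡0)) (Finₚ.combine-remQuot {suc s} (suc s) k₂))))
      where
      square-0 : ∀ i → ∣ i ∣ * ∣ i ∣ ≡ 0 → ∣ i ∣ ≡ 0
      square-0 i f = square-injective ∣ i ∣ 0 f
      u≡0 : ∣ u ∣ ≡ 0
      u≡0 = square-0 u (ℕₚ.m+n≡0⇒n≡0 (2 * (∣ v ∣ * ∣ v ∣)) e)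
      v≡0 : ∣ v ∣ ≡ 0
      v≡0 = square-0 v (ℕₚ.m+n≡0⇒m≡0 (∣ v ∣ * ∣ v ∣) (ℕₚ.m+n≡0⇒m≡0 (2 * (∣ v ∣ * ∣ v ∣)) e))
      same : ∀ (i j : Fin (suc s)) → ∣ + toℕ i ℤ.- + toℕ j ∣ ≡ 0 → i ≡ j
      same i j f = Finₚ.toℕ-injective (ℤₚ.+-injective (ℤₚ.i-j≡0⇒i≡j (+ toℕ i) (+ toℕ j) (ℤₚ.∣i∣≡0⇒i≡0 f)))

  -- From 0 < D < 3p and p | D, either D = p or D = 2p. In the second case u = 2c is even, and
  -- halving gives p = v² + 2c² with the coordinates exchanged.
  splits : ∃ λ b → ∃ λ a → norm ⟨ b , a ⟩ ≡ + p
  splits = from p∣D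
    where
    halve : D ≡ 2 * p → ∃ (λ c → ∣ u ∣ ≡ c * 2 ⊎ ∣ u ∣ ≡ suc (c * 2)) → ∃ λ b → ∃ λ a → norm ⟨ b , a ⟩ ≡ + p
    halve e (c , inj₁ f) = + c , + ∣ v ∣ , ℕ⇒norm≡ ⟨ + c , + ∣ v ∣ ⟩ p (ℕₚ.*-cancelˡ-≡ (2 * (c * c) + ∣ v ∣ * ∣ v ∣) p 2
        (trans (l c ∣ v ∣) (trans (cong (λ k → 2 * (∣ v ∣ * ∣ v ∣) + k * k) (sym f)) e)))
      where
      l : ∀ c k → 2 * (2 * (c * c) + k * k) ≡ 2 * (k * k) + c * 2 * (c * 2)
      l = solve-∀
    halve e (c , inj₂ f) = ⊥-elim (even≢odd p (∣ v ∣ * ∣ v ∣ + 2 * (c * c) + 2 * c)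
        (trans (ℕₚ.*-comm p 2) (trans (sym e) (trans (cong (λ k → 2 * (∣ v ∣ * ∣ v ∣) + k * k) f) (l c ∣ v ∣)))))
      where
      l : ∀ c k → 2 * (k * k) + suc (c * 2) * suc (c * 2) ≡ suc ((k * k + 2 * (c * c) + 2 * c) * 2)
      l = solve-∀
    from : p N.∣ D → ∃ λ b → ∃ λ a → norm ⟨ b , a ⟩ ≡ + p
    from (N.divides 0 e) = ⊥-elim (D≢0 e)
    from (N.divides 1 e) = v , u , ℕ⇒norm≡ ⟨ v , u ⟩ p (trans e (ℕₚ.*-identityˡ p))
    from (N.divides 2 e) = halve e (even⊎odd ∣ u ∣)
    from (N.divides (suc (suc (suc q))) e) = ⊥-elim (ℕₚ.<⇒≱ D<3p (ℕₚ.≤-trans (ℕₚ.*-monoˡ-≤ p {3} {suc (suc (suc q))} (s≤s (s≤s (s≤s z≤n)))) (ℕₚ.≤-reflexive (sym e))))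

-- Representations of p^{2j+1}N′

length-filter-split : ∀ {A : Set} {P : Pred A 0ℓ} (P? : Decidable P) xs →
  length xs ≡ length (filter (¬? ∘ P?) xs) + length (filter P? xs)
length-filter-split P? [] = refl
length-filter-split P? (x ∷ xs) with P? x
... | yes _ = trans (cong suc (length-filter-split P? xs)) (sym (ℕₚ.+-suc _ _))
... | no  _ = cong suc (length-filter-split P? xs)

empty⊎member : ∀ {A : Set} (xs : List A) → length xs ≡ 0 ⊎ ∃ λ x → x ∈ xs
empty⊎member []      = inj₁ refl
empty⊎member (x ∷ _) = inj₂ (x , here refl)

parity-0⇒2∣ : ∀ n → parity n ≡ 0ℙ → 2 N.∣ n
parity-0⇒2∣ n e with even⊎odd n
... | k , inj₁ f    = N.divides k f
... | k , inj₂ refl = ⊥-elim (1≢0 (trans (sym odd) e))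
  where
  odd : parity (suc (k * 2)) ≡ 1ℙ
  odd = trans (ℙₚ.+-homo-+ 1 (k * 2)) (cong (1ℙ ℙ.+_) (trans (ℙₚ.*-homo-* k 2) (ℙₚ.*-zeroʳ (parity k))))
  1≢0 : 1ℙ ≢ 0ℙ
  1≢0 ()

2∤⇒parity-1 : ∀ n → ¬ (2 N.∣ n) → parity n ≡ 1ℙ
2∤⇒parity-1 n 2∤n = from (parity n) refl
  where
  from : ∀ b → parity n ≡ b → parity n ≡ 1ℙ
  from 0ℙ e = ⊥-elim (2∤n (parity-0⇒2∣ n e))
  from 1ℙ e = e

module OddPowers (p : ℕ) (pp : Prime p) (2∤p : ¬ (2 N.∣ p)) (p∤2 : ¬ (p N.∣ 2)) (3∤p : ¬ (3 N.∣ p)) where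

  private
    instance
      p-nonZero : NonZero p
      p-nonZero = prime⇒nonZero pp

    p∣x? : Decidable (λ (m : ℕ × ℕ) → p N.∣ proj₁ m)
    p∣x? m = p ∣? proj₁ m

  primitives imprimitives : ℕ → List (ℕ × ℕ)
  primitives   N = filter (¬? ∘ p∣x?) (reps N)
  imprimitives N = filter p∣x? (reps N)

  private
    primitives-unique : ∀ N → Unique (primitives N)
    primitives-unique N = Uniqueₚ.filter⁺ (¬? ∘ p∣x?) (reps-unique N)

    ∈-primitives⁻ : ∀ N m → m ∈ primitives N → IsRep N m × ¬ (p N.∣ proj₁ m)
    ∈-primitives⁻ N m m∈ = let m∈reps , p∤ = ∈-filter⁻ (¬? ∘ p∣x?) {xs = reps N} m∈ in ∈-reps⁻ N {m} m∈reps , p∤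

    ∈-primitives⁺ : ∀ N m → IsRep N m × ¬ (p N.∣ proj₁ m) → m ∈ primitives N
    ∈-primitives⁺ N m (rep , p∤) = ∈-filter⁺ (¬? ∘ p∣x?) (∈-reps⁺ N {m} rep) p∤

    raise-split : ∀ M → p N.∣ M → (∃ λ b → ∃ λ a → norm ⟨ b , a ⟩ ≡ + p) →
                  length (primitives M) ≡ length (primitives (p * (p * M)))
    raise-split M p∣M (b , a , split) = Raise.raise-bijection p pp p∤2 3∤p b a split M p∣M
      (primitives M) (primitives (p * (p * M))) (primitives-unique M) (primitives-unique (p * (p * M)))
      (λ {m} → ∈-primitives⁻ M m) (λ {m} → ∈-primitives⁺ M m)
      (λ {n} → ∈-primitives⁻ (p * (p * M)) n) (λ {n} → ∈-primitives⁺ (p * (p * M)) n)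

    split-of-primitive : ∀ N m → p N.∣ N → m ∈ primitives N → ∃ λ b → ∃ λ a → norm ⟨ b , a ⟩ ≡ + p
    split-of-primitive N (x , y) p∣N m∈ = let (e , _) , p∤x = ∈-primitives⁻ N (x , y) m∈ in
      Thue.splits p pp x y (subst (p N.∣_) (sym e) p∣N) p∤x

  -- A member of either list makes p split. The remaining case, which covers inert p, compares two
  -- empty lists.
  primitives-raise : ∀ M → p N.∣ M → length (primitives M) ≡ length (primitives (p * (p * M)))
  primitives-raise M p∣M = from (empty⊎member (primitives M)) (empty⊎member (primitives (p * (p * M))))
    where
    from : length (primitives M) ≡ 0 ⊎ (∃ λ m → m ∈ primitives M) →
           length (primitives (p * (p * M))) ≡ 0 ⊎ (∃ λ n → n ∈ primitives (p * (p * M))) →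
           length (primitives M) ≡ length (primitives (p * (p * M)))
    from (inj₂ (m , m∈)) _               = raise-split M p∣M (split-of-primitive M m p∣M m∈)
    from (inj₁ _)        (inj₂ (n , n∈)) = raise-split M p∣M (split-of-primitive (p * (p * M)) n (N.m∣m*n (p * M)) n∈)
    from (inj₁ e)        (inj₁ f)        = trans e (sym f)

  private
    p∣x⇒p∣y : ∀ {N} x y → p N.∣ N → IsRep N (x , y) → p N.∣ x → p N.∣ y
    p∣x⇒p∣y x y p∣N (e , _) p∣x = [ id , id ]′ (euclidsLemma y y pp
      (N.∣m+n∣m⇒∣n (subst (p N.∣_) (sym e) p∣N) (N.∣n⇒∣m*n 2 (N.∣m⇒∣m*n x p∣x))))

    scale-square : ∀ p x y → 2 * (p * x * (p * x)) + p * y * (p * y) ≡ p * (p * (2 * (x * x) + y * y))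
    scale-square = solve-∀

    Multiple : ℕ × ℕ → ℕ × ℕ → Set
    Multiple (x , y) (x′ , y′) = x ≡ p * x′ × y ≡ p * y′

    multiple-functional : ∀ {m n n′} → Multiple m n → Multiple m n′ → n ≡ n′
    multiple-functional {n = a , b} {n′ = c , d} (e , f) (g , h) =
      cong₂ _,_ (ℕₚ.*-cancelˡ-≡ a c p (trans (sym e) g)) (ℕₚ.*-cancelˡ-≡ b d p (trans (sym f) h))

    multiple-injective : ∀ {m m′ n} → Multiple m n → Multiple m′ n → m ≡ m′
    multiple-injective (refl , refl) (refl , refl) = refl

    divide : ∀ M m → m ∈ imprimitives (p * (p * M)) → ∃ λ n → n ∈ reps M × Multiple m n
    divide M (x , y) m∈ = from (proj₂ split-m) (p∣x⇒p∣y x y (N.m∣m*n (p * M)) rep (proj₂ split-m))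
      where
      split-m = ∈-filter⁻ p∣x? {xs = reps (p * (p * M))} m∈
      rep : IsRep (p * (p * M)) (x , y)
      rep = ∈-reps⁻ (p * (p * M)) {x , y} (proj₁ split-m)
      from : p N.∣ x → p N.∣ y → ∃ λ n → n ∈ reps M × Multiple (x , y) n
      from (N.divides c x≡) (N.divides d y≡) = (c , d) , ∈-reps⁺ M {c , d} (cd , 3∤d) , x≡pc , y≡pd
        where
        x≡pc = trans x≡ (ℕₚ.*-comm c p)
        y≡pd = trans y≡ (ℕₚ.*-comm d p)
        cd : 2 * (c * c) + d * d ≡ M
        cd = ℕₚ.*-cancelˡ-≡ _ M p (ℕₚ.*-cancelˡ-≡ _ (p * M) p (trans (sym (scale-square p c d))
          (trans (cong₂ (λ s t → 2 * (s * s) + t * t) (sym x≡pc) (sym y≡pd)) (proj₁ rep))))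
        3∤d : ¬ (3 N.∣ d)
        3∤d 3∣d = proj₂ rep (subst (3 N.∣_) (sym y≡pd) (N.∣n⇒∣m*n p 3∣d))

    multiply : ∀ M n → n ∈ reps M → ∃ λ m → m ∈ imprimitives (p * (p * M)) × Multiple m n
    multiply M (c , d) n∈ = (p * c , p * d) , ∈-filter⁺ p∣x? (∈-reps⁺ (p * (p * M)) {p * c , p * d}
        (trans (scale-square p c d) (cong (λ k → p * (p * k)) (proj₁ rep)) , 3∤pd)) (N.m∣m*n c) , refl , refl
      where
      rep : IsRep M (c , d)
      rep = ∈-reps⁻ M {c , d} n∈
      3∤pd : ¬ (3 N.∣ p * d)
      3∤pd e = [ 3∤p , proj₂ rep ]′ (euclidsLemma p d prime-3 e)

  imprimitives-length : ∀ M → length (imprimitives (p * (p * M))) ≡ length (reps M)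
  imprimitives-length M = length-bijection Multiple (λ {m} → multiple-functional {m}) (λ {m} {m′} {n} → multiple-injective {m} {m′} {n})
    (imprimitives (p * (p * M))) (reps M) (Uniqueₚ.filter⁺ p∣x? (reps-unique (p * (p * M)))) (reps-unique M)
    (λ {m} → divide M m) (λ {n} → multiply M n)

  oddPower : ℕ → ℕ → ℕ
  oddPower N′ zero    = p * N′
  oddPower N′ (suc j) = p * (p * oddPower N′ j)

  module _ (N′ : ℕ) (p∤N′ : ¬ (p N.∣ N′)) where

    private
      p∣oddPower : ∀ j → p N.∣ oddPower N′ j
      p∣oddPower zero    = N.m∣m*n N′
      p∣oddPower (suc j) = N.m∣m*n (p * oddPower N′ j)

      all-primitive : ∀ {m} → m ∈ reps (p * N′) → ¬ (p N.∣ proj₁ m)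
      all-primitive {x , y} m∈ p∣x = from p∣x (p∣x⇒p∣y x y (N.m∣m*n N′) rep p∣x)
        where
        rep : IsRep (p * N′) (x , y)
        rep = ∈-reps⁻ (p * N′) {x , y} m∈
        from : p N.∣ x → p N.∣ y → ⊥
        from (N.divides c refl) (N.divides d refl) = p∤N′ (N.divides (2 * (c * c) + d * d)
          (ℕₚ.*-cancelˡ-≡ N′ _ p (trans (sym (proj₁ rep)) (l c d p))))
          where
          l : ∀ c d p → 2 * (c * p * (c * p)) + d * p * (d * p) ≡ p * ((2 * (c * c) + d * d) * p)
          l = solve-∀

      primitives-oddPower : ∀ j → length (primitives (oddPower N′ j)) ≡ length (reps (p * N′))
      primitives-oddPower zero    = cong length (Listₚ.filter-all (¬? ∘ p∣x?) (All.tabulate (λ {m} → all-primitive {m})))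
      primitives-oddPower (suc j) = trans (sym (primitives-raise (oddPower N′ j) (p∣oddPower j))) (primitives-oddPower j)

    -- Each step adds one copy of r(pN′): the primitive representations keep that number, and the
    -- imprimitive ones reproduce the previous total. At j = 0 all are primitive, since p² ∤ pN′.
    reps-oddPower : ∀ j → length (reps (oddPower N′ j)) ≡ suc j * length (reps (p * N′))
    reps-oddPower zero    = sym (ℕₚ.+-identityʳ _)
    reps-oddPower (suc j) = begin
      length (reps (oddPower N′ (suc j)))
        ≡⟨ length-filter-split p∣x? (reps (oddPower N′ (suc j))) ⟩
      length (primitives (oddPower N′ (suc j))) + length (imprimitives (oddPower N′ (suc j)))
        ≡⟨ cong₂ _+_ (primitives-oddPower (suc j)) (trans (imprimitives-length (oddPower N′ j)) (reps-oddPower j)) ⟩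
      suc (suc j) * length (reps (p * N′)) ∎
      where open ≡-Reasoning

  oddPower-^ : ∀ N′ j → oddPower N′ j ≡ p ^ (2 * j + 1) * N′
  oddPower-^ N′ zero    = cong (_* N′) (sym (ℕₚ.^-identityʳ p))
  oddPower-^ N′ (suc j) = begin
    p * (p * oddPower N′ j)                ≡⟨ cong (λ k → p * (p * k)) (oddPower-^ N′ j) ⟩
    p * (p * (p ^ (2 * j + 1) * N′))       ≡⟨ l p (p ^ (2 * j + 1)) N′ ⟩
    p ^ (2 + (2 * j + 1)) * N′             ≡⟨ cong (λ k → p ^ k * N′) (e j) ⟩
    p ^ (2 * suc j + 1) * N′               ∎
    where
    open ≡-Reasoning
    l : ∀ p q n → p * (p * (q * n)) ≡ p * (p * q) * n
    l = solve-∀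
    e : ∀ j → 2 + (2 * j + 1) ≡ 2 * suc j + 1
    e = solve-∀

  -- From the indices of the theorem to 8m + 3.

  odd-square : ∃ λ t → p * p ≡ 1 + 8 * t
  odd-square with even⊎odd p
  ... | k , inj₁ p≡   = ⊥-elim (2∤p (N.divides k p≡))
  ... | k , inj₂ refl = tri k , trans (l k) (trans (cong (λ z → 1 + 4 * z) (sym (2*tri k))) (r (tri k)))
    where
    l : ∀ k → suc (k * 2) * suc (k * 2) ≡ 1 + 4 * (k * k + k)
    l = solve-∀
    r : ∀ t → 1 + 4 * (2 * t) ≡ 1 + 8 * t
    r = solve-∀

  even-power : ∀ j → ∃ λ c → p ^ (2 * j) ≡ 1 + 8 * c
  even-power zero    = 0 , refl
  even-power (suc j) with even-power j | odd-square
  ... | c , e | t , f = t + c * (1 + 8 * t) , (begin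
    p ^ (2 * suc j)              ≡⟨ cong (p ^_) (ℕₚ.*-suc 2 j) ⟩
    p * (p * p ^ (2 * j))        ≡⟨ sym (ℕₚ.*-assoc p p (p ^ (2 * j))) ⟩
    p * p * p ^ (2 * j)          ≡⟨ cong₂ _*_ f e ⟩
    (1 + 8 * t) * (1 + 8 * c)    ≡⟨ l t c ⟩
    1 + 8 * (t + c * (1 + 8 * t)) ∎)
    where
    open ≡-Reasoning
    l : ∀ t c → (1 + 8 * t) * (1 + 8 * c) ≡ 1 + 8 * (t + c * (1 + 8 * t))
    l = solve-∀

  index : ∀ e c → p ^ e ≡ 1 + 8 * c → 3 * (p ^ e ∸ 1) / 8 ≡ 3 * c
  index e c f = begin
    3 * (p ^ e ∸ 1) / 8    ≡⟨ cong (λ k → 3 * (k ∸ 1) / 8) f ⟩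
    3 * (8 * c) / 8        ≡⟨ cong (_/ 8) (l c) ⟩
    3 * c * 8 / 8          ≡⟨ m*n/n≡m (3 * c) 8 ⟩
    3 * c                  ∎
    where
    open ≡-Reasoning
    l : ∀ c → 3 * (8 * c) ≡ 3 * c * 8
    l = solve-∀

  B-even : ∀ n k → ¬ (p N.∣ 8 * n) → 2 N.∣ B 8 3 (p ^ (4 * k + 3) * n + 3 * (p ^ (4 * k + 4) ∸ 1) / 8)
  B-even n k p∤8n with even-power (2 * k + 2)
  ... | c , f = parity-0⇒2∣ (B 8 3 i) (begin
    parity (B 8 3 i)                                  ≡⟨ B≡a₂ i ⟩
    parityℤ (a₂ i)                                    ≡⟨ a₂-reps i ⟩
    parity (length (reps (8 * i + 3)))                ≡⟨ cong (parity ∘ length ∘ reps) 8i+3 ⟩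
    parity (length (reps (oddPower N′ j)))            ≡⟨ cong parity (reps-oddPower N′ p∤N′ j) ⟩
    parity (suc j * r)                                ≡⟨ cong (λ k → parity (k * r)) (e₃ k) ⟩
    parity ((k + 1) * 2 * r)                          ≡⟨ ℙₚ.*-homo-* ((k + 1) * 2) r ⟩
    parity ((k + 1) * 2) ℙ.* parity r                 ≡⟨ cong (ℙ._* parity r) (trans (ℙₚ.*-homo-* (k + 1) 2) (ℙₚ.*-zeroʳ (parity (k + 1)))) ⟩
    0ℙ                                                ∎)
    where
    open ≡-Reasoning
    i = p ^ (4 * k + 3) * n + 3 * (p ^ (4 * k + 4) ∸ 1) / 8
    -- With q = p^(4k+3), 8i + 3 = 8qn + 3pq = q(8n + 3p). Then j solves 2j + 1 = 4k + 3, and j + 1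
    -- = 2(k + 1) is the even factor.
    N′ = 8 * n + 3 * p
    j = 2 * k + 1
    r = length (reps (p * N′))
    p∤N′ : ¬ (p N.∣ N′)
    p∤N′ d = p∤8n (N.∣m+n∣m⇒∣n (subst (p N.∣_) (ℕₚ.+-comm (8 * n) (3 * p)) d) (N.n∣m*n 3))
    e₁ : ∀ k → 4 * k + 4 ≡ 2 * (2 * k + 2)
    e₁ = solve-∀
    e₂ : ∀ k → 4 * k + 3 ≡ 2 * (2 * k + 1) + 1
    e₂ = solve-∀
    e₃ : ∀ k → suc (2 * k + 1) ≡ (k + 1) * 2
    e₃ = solve-∀
    e₄ : ∀ k → 4 * k + 4 ≡ suc (4 * k + 3)
    e₄ = solve-∀
    q≡ : p ^ (4 * k + 4) ≡ 1 + 8 * c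
    q≡ = trans (cong (p ^_) (e₁ k)) f
    l : ∀ q n c → 8 * (q * n + 3 * c) + 3 ≡ 8 * (q * n) + 3 * (1 + 8 * c)
    l = solve-∀
    l′ : ∀ q n p → 8 * (q * n) + 3 * (p * q) ≡ q * (8 * n + 3 * p)
    l′ = solve-∀
    8i+3 : 8 * i + 3 ≡ oddPower N′ j
    8i+3 = begin
      8 * i + 3                                             ≡⟨ cong (λ z → 8 * (p ^ (4 * k + 3) * n + z) + 3) (index (4 * k + 4) c q≡) ⟩
      8 * (p ^ (4 * k + 3) * n + 3 * c) + 3                 ≡⟨ l (p ^ (4 * k + 3)) n c ⟩
      8 * (p ^ (4 * k + 3) * n) + 3 * (1 + 8 * c)           ≡⟨ cong (λ z → 8 * (p ^ (4 * k + 3) * n) + 3 * z) (trans (sym q≡) (cong (p ^_) (e₄ k))) ⟩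
      8 * (p ^ (4 * k + 3) * n) + 3 * (p * p ^ (4 * k + 3)) ≡⟨ l′ (p ^ (4 * k + 3)) n p ⟩
      p ^ (4 * k + 3) * N′                                  ≡⟨ cong (λ z → p ^ z * N′) (e₂ k) ⟩
      p ^ (2 * j + 1) * N′                                  ≡⟨ sym (oddPower-^ N′ j) ⟩
      oddPower N′ j                                         ∎

  a₂-odd : parityℤ (a₂ (3 * (p ^ 2 ∸ 1) / 8)) ≡ 1ℙ
  a₂-odd with even-power 1
  ... | c , f = trans (a₂-reps i) (trans (cong (parity ∘ length ∘ reps) 8i+3) (ThreePSquared.reps-odd p pp 2∤p 3∤p))
    where
    i = 3 * (p ^ 2 ∸ 1) / 8
    l : ∀ c → 8 * (3 * c) + 3 ≡ 3 * (1 + 8 * c)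
    l = solve-∀
    8i+3 : 8 * i + 3 ≡ 3 * (p * p)
    8i+3 = trans (cong (λ z → 8 * z + 3) (index 2 c f)) (trans (l c) (trans (cong (3 *_) (sym f)) (cong (λ z → 3 * (p * z)) (ℕₚ.*-identityʳ p))))

-- Parity of w₂ and conclusion.

%ℕ≡0⇒∣ : ∀ a p .{{_ : NonZero p}} → a %ℕ p ≡ 0 → p N.∣ ∣ a ∣
%ℕ≡0⇒∣ a p e = S.∣⇒∣ᵤ (S.divides {+ p} {a} (a /ℕ p) (trans (a≡a%ℕn+[a/ℕn]*n a p)
  (trans (cong (λ r → + r ℤ.+ (a /ℕ p) ℤ.* + p) e) (ℤₚ.+-identityˡ ((a /ℕ p) ℤ.* + p)))))

legendre-odd : ∀ a p .{{_ : NonZero p}} → ¬ (p N.∣ ∣ a ∣) → parityℤ (legendre a p) ≡ 1ℙ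
legendre-odd a p p∤a with a %ℕ p ≟ 0
... | yes e = ⊥-elim (p∤a (%ℕ≡0⇒∣ a p e))
... | no _ with Any.any? (λ x → ((x * x) ℕ.% p) ≟ (a %ℕ p)) (upTo p)
...   | yes _ = refl
...   | no  _ = refl

module _ (p : ℕ) (pp : Prime p) (p≥5 : p ≥ 5) where

  private
    prime∤p : ∀ q → q ≢ 1 → q < 5 → ¬ (q N.∣ p)
    prime∤p q q≢1 q<5 d = [ q≢1 , (λ q≡p → ℕₚ.<⇒≢ (ℕₚ.<-≤-trans q<5 p≥5) q≡p) ]′ (prime⇒irreducible pp d)

    2∤p : ¬ (2 N.∣ p)
    2∤p = prime∤p 2 (λ ()) (s≤s (s≤s (s≤s z≤n)))

    3∤p : ¬ (3 N.∣ p)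
    3∤p = prime∤p 3 (λ ()) (s≤s (s≤s (s≤s (s≤s z≤n))))

    p∤2 : ¬ (p N.∣ 2)
    p∤2 d = ℕₚ.<⇒≱ (ℕₚ.<-≤-trans (s≤s (s≤s (s≤s z≤n))) p≥5) (N.∣⇒≤ d)

    p∤3 : ¬ (p N.∣ 3)
    p∤3 d = ℕₚ.<⇒≱ (ℕₚ.<-≤-trans (s≤s (s≤s (s≤s (s≤s z≤n)))) p≥5) (N.∣⇒≤ d)

    p∤8n : ∀ n → ¬ (p N.∣ n) → ¬ (p N.∣ 8 * n)
    p∤8n n p∤n d with euclidsLemma 8 n pp d
    ... | inj₂ p∣n = p∤n p∣n
    ... | inj₁ p∣8 with euclidsLemma 2 4 pp p∣8
    ...   | inj₁ p∣2 = p∤2 p∣2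
    ...   | inj₂ p∣4 = [ p∤2 , p∤2 ]′ (euclidsLemma 2 2 pp p∣4)

    p∤6 : ¬ (p N.∣ 6)
    p∤6 d = [ p∤2 , p∤3 ]′ (euclidsLemma 2 3 pp d)

  open OddPowers p pp 2∤p p∤2 3∤p

  B-even-prime : ∀ n k → ¬ (p N.∣ n) → 2 N.∣ B 8 3 (p ^ (4 * k + 3) * n + 3 * (p ^ (4 * k + 4) ∸ 1) / 8)
  B-even-prime n k p∤n = B-even n k (p∤8n n p∤n)

  w₂-even : .{{_ : NonZero p}} → (+ 2) Z.∣ w₂ p
  w₂-even = parity-0⇒2∣ ∣ w₂ p ∣ (begin
    parityℤ (w₂ p)
      ≡⟨ parityℤ-+ (a₂ i) (+ (p ^ 2) ℤ.* χ₁ ℤ.* χ₂) ⟩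
    parityℤ (a₂ i) ℙ.+ parityℤ (+ (p ^ 2) ℤ.* χ₁ ℤ.* χ₂)
      ≡⟨ cong₂ ℙ._+_ a₂-odd (trans (parityℤ-* (+ (p ^ 2) ℤ.* χ₁) χ₂) (cong (ℙ._* parityℤ χ₂) (parityℤ-* (+ (p ^ 2)) χ₁))) ⟩
    1ℙ ℙ.+ (parity (p ^ 2) ℙ.* parityℤ χ₁ ℙ.* parityℤ χ₂)
      ≡⟨ cong₂ (λ s t → 1ℙ ℙ.+ (s ℙ.* t ℙ.* parityℤ χ₂)) p²-odd (legendre-odd (- (+ 6)) p p∤6) ⟩
    1ℙ ℙ.+ parityℤ χ₂
      ≡⟨ cong (1ℙ ℙ.+_) (legendre-odd (- (+ i)) p (p∤i ∘ subst (p N.∣_) (ℤₚ.∣-i∣≡∣i∣ (+ i)))) ⟩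
    0ℙ ∎)
    where
    open ≡-Reasoning
    i = 3 * (p ^ 2 ∸ 1) / 8
    χ₁ = legendre (- (+ 6)) p
    χ₂ = legendre (- (+ i)) p
    p²-odd : parity (p ^ 2) ≡ 1ℙ
    p²-odd = 2∤⇒parity-1 (p ^ 2) (λ d → [ 2∤p , 2∤p ]′ (euclidsLemma p p prime[2] (subst (λ k → 2 N.∣ p * k) (ℕₚ.*-identityʳ p) d)))
    p∤i : ¬ (p N.∣ i)
    p∤i d with even-power 1
    ... | c , f = p∤3 (N.∣m+n∣m⇒∣n (subst (p N.∣_) (trans (cong (3 *_) f) (l c)) (N.∣n⇒∣m*n 3 (N.m∣m*n (p * 1))))
                         (N.∣n⇒∣m*n 8 (subst (p N.∣_) (index 2 c f) d)))
      where
      l : ∀ c → 3 * (1 + 8 * c) ≡ 8 * (3 * c) + 3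
      l = solve-∀

theorem1p12 : (p : ℕ) → .{{_ : NonZero p}} → Prime p → p ≥ 5 →
    (((+ 2) Z.∣ w₂ p) →
    (n k : ℕ) → ¬ (p N.∣ n) →
    2 N.∣ B 8 3 (p ^ (4 * k + 3) * n + 3 * (p ^ (4 * k + 4) ∸ 1) / 8))
    × ((¬ ((+ 2) Z.∣ w₂ p)) →
    (n k : ℕ) → ¬ (p N.∣ n) →
    2 N.∣ B 8 3 (p ^ (6 * k + 5) * n + 3 * (p ^ (6 * k + 6) ∸ 1) / 8))
    × ((¬ ((+ 2) Z.∣ w₂ p)) →
    (n k : ℕ) →
    (+ 2) Z.∣ (w₂ p ℤ.- (+ (p ^ 2)) ℤ.* legendre (- (+ (6 * n)) ℤ.- + 2 ℤ.+ + ((p ^ 2 ∸ 1) / 4)) p) →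
    2 N.∣ B 8 3 (p ^ (6 * k + 2) * n + 3 * (p ^ (6 * k + 2) ∸ 1) / 8))
theorem1p12 p pp p≥5 =
    (λ _ → B-even-prime p pp p≥5)
  , (λ w₂-odd _ _ _ → ⊥-elim (w₂-odd (w₂-even p pp p≥5)))
  , (λ w₂-odd _ _ _ → ⊥-elim (w₂-odd (w₂-even p pp p≥5)))
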